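{- Let $\widetilde{W}/W\in\{\widetilde{C}_n/C_n,\widetilde{B}_n/B_n,\widetilde{B}_n/D_n,\widetilde{D}_n/D_n\}$, let $w\in\widetilde{W}/W$, let $\lambda=\mathcal{C}(w)$, and let $i\in\{0,1,\dots,n\}$. If $s_i$ is an ascent for $w$ then $s_i$ acts on $\lambda$ by adding all addable $i$-components to $\lambda$. If $s_i$ is a descent for $w$ then $s_i$ acts on $\lambda$ by removing all removable $i$-components from $\lambda$. If $s_i$ is neither an ascent nor a descent for $w$ then $s_i$ does not change $\lambda$.
   Context: Groups. Let $N=2n+1$. A mirrored $\mathbb{Z}$-permutation is a bijection $w:\mathbb{Z}\to\mathbb{Z}$ with $w(i+N)=w(i)+N$ and $w(-i)=-w(i)$ for all $i\in\mathbb{Z}$; it is determined by $(w(1),\dots,w(n))$. Under composition these form the affine Coxeter group $\widetilde{C}_n$. Define elements by their images $(w(1),\dots,w(n))$: $s_i=(1,\dots,i-1,i+1,i,i+2,\dots,n)$ for $1\le i\le n-1$; $s_0^C=(-1,2,3,\dots,n)$; $s_0^D=(-2,-1,3,\dots,n)$; $s_n^C=(1,\dots,n-1,n+1)$; $s_n^D=(1,\dots,n-2,n+1,n+2)$. The four types are: - $\widetilde{C}/C$: $\widetilde{W}$ is all mirrored $\mathbb{Z}$-permutations, generators $s_0=s_0^C,s_1,\dots,s_{n-1},s_n=s_n^C$ ($n\ge2$). - $\widetilde{B}/B$: those with $|\{i\le0:w(i)\ge1\}|$ even, generators $s_0=s_0^D,s_1,\dots,s_{n-1},s_n=s_n^C$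 ($n\ge3$). - $\widetilde{B}/D$: those with $|\{i\le n:w(i)\ge n+1\}|$ even, generators $s_0=s_0^C,s_1,\dots,s_{n-1},s_n=s_n^D$ ($n\ge3$). - $\widetilde{D}/D$: those satisfying both parity conditions, generators $s_0=s_0^D,s_1,\dots,s_{n-1},s_n=s_n^D$ ($n\ge4$). $W$ is generated by $s_1,\dots,s_n$, and $\widetilde{W}/W$ denotes the set of minimal length representatives of the cosets $wW$. $\widetilde{W}$ acts on $\widetilde{W}/W$ by left multiplication of cosets. For $w\in\widetilde{W}/W$, $s_i$ is a descent if $s_iw$ has smaller Coxeter length than $w$; an ascent if $s_iw$ has larger length and $s_iw\in\widetilde{W}/W$; it is neither if $s_iwW=wW$. Abaci and cores. An abacus has runners (columns) $1,\dots,2n$; runner $i$ has entries labeled $mN+i$ for each level $m\in\mathbb{Z}$; some entries are beads, the others gaps; reading order is the order of labels; "lowest" means largest label; the abacus is flush if no bead is preceded by a gap on its runner. $\mathcal{A}(w)$ is the flush abacus whose lowest bead in each runner is an element of $\{w(1),\dots,w(2n)\}$. $\mathcal{C}(w)$ is the partition whose southeast boundary is the lattice path obtained by reading the entries of $\mathcal{A}(w)$ in reading order, recording a north-step for each bead and an east-step for each gap (diagrams are drawn with the first row at the top). $w\mapsto\mathcal{C}(w)$ is a bijection from $\widetilde{W}/W$ onto the symmetric $(2n)$-cores (types $\widetilde{C}/C,\widetilde{B}/D$) or the symmetric $(2n)$-cores with an even number of boxes on the main diagonal (types $\widetilde{B}/B,\widetilde{D}/D$), where a $(2n)$-core is a partition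 with no hook length divisible by $2n$; the action of $\widetilde{W}$ on these partitions is the one transported through this bijection. Residues. Entries of $\mathbb{N}^2$ are $(i,j)$ = (row, column), starting at $(1,1)$. Write $p\,\|\,q$ for the element of $\{0,\dots,q-1\}$ congruent to $p$ mod $q$. The fixed residue of $(i,j)$ is $(j-i)\|(2n)$ if this is $\le n$, and $2n-((j-i)\|(2n))$ otherwise. An escalator is a connected component of the set of $(i,j)$ with $(j-i)\|(2n)\in\{n-1,n,n+1\}$; a descalator is a connected component of the set of $(i,j)$ with $(j-i)\|(2n)$ equal to $0$, $1$ or $2n-1$. Each is called upper if it lies above the main diagonal $i=j$, lower if it lies below; the descalator containing the main diagonal is the main descalator (neither upper nor lower). Given the partition $\lambda$, residues in an upper escalator are assigned row by row: a row meets the escalator in three consecutive cells $c_1,c_2,c_3$ (left to right), and (0) if the row of $\lambda$ ends immediately to the left of $c_1$: $c_1$ has both residues $n-1$ and $n$, $c_2$ has residue $n$, $c_3$ is undefined; (1) if the row of $\lambda$ ends at $c_1$: residues $n-1,n,n$; (2) if it ends at $c_2$: residues $n,n,n-1$; (3) if it ends at $c_3$: $c_1$ undefined, $c_2$ has residue $n$, $c_3$ has both residues $n-1$ and $n$; in all other cases the residues are undefined. Residues in an upper descalator are assigned by the same rule with $n-1$ replaced by $1$ and $n$ replaced by $0$. Residues in lower escalators and descalators are assigned column by column by the transposed rule. In the main descalator, $(i,j)$ has residue $0$ if $j=i$; if $|j-i|=1$ it has residue $1$ when $i+j\equiv1$ mod $4$ and $0$ when $i+j\equiv3$ mod $4$.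 The residue assignment used is: fixed residues everywhere in type $\widetilde{C}/C$; in type $\widetilde{B}/B$, the descalator (including main descalator) rules on descalators and fixed residues elsewhere; in type $\widetilde{B}/D$, the escalator rules on escalators and fixed residues elsewhere; in type $\widetilde{D}/D$, both escalator and descalator rules, and fixed residues elsewhere. Two boxes of $\mathbb{N}^2$ are $i$-connected if they share an edge and both have residue $i$; the $i$-connected components are the $i$-components. (A cell with two residues takes part in components for each of them.) An $i$-component is addable if adding its boxes to the diagram of $\lambda$ results in a partition, and removable if removing its boxes from the diagram of $\lambda$ results in a partition. -}

module Defs where

open import Data.Bool using (if_then_else_)
open import Data.Fin as Fin using (Fin; toℕ)
open import Data.Integer as ℤ using (ℤ; +_; -[1+_])
open import Data.Integer.Divisibility as ℤ∣ using ()
open import Data.Integer.DivMod using (_/ℕ_; _%ℕ_)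
open import Data.List using (List; []; _∷_; length; map)
import Data.List.Membership.Propositional as List
open import Data.List.Relation.Unary.Unique.Propositional using (Unique)
open import Data.Nat
open import Data.Nat.DivMod using (_%_)
open import Data.Nat.Divisibility using (_∣_)
open import Data.Nat.Properties using (m*n≢0)
open import Data.Product using (_×_; _,_; ∃; ∃-syntax; swap)
open import Data.Sum using (_⊎_)
open import Function using (_∘_; id)
open import Function.Bundles using (_⇔_)
open import Function.Definitions using (Bijective)
open import Level using (0ℓ)
open import Relation.Binary using (Rel)
open import Relation.Binary.Construct.Closure.ReflexiveTransitive using (Star)
open import Relation.Binary.PropositionalEquality using (_≡_; _≗_)
open import Relation.Nullary using (¬_)
open import Relation.Unary using (Pred; _∈_; _∉_; _⊆_; _≐_; _∪_)

HasCardinality : Pred ℤ 0ℓ → ℕ → Set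
HasCardinality P k =
  ∃[ xs ] Unique xs × length xs ≡ k × (∀ z → (z List.∈ xs) ⇔ (z ∈ P))

HasEvenCardinality : Pred ℤ 0ℓ → Set
HasEvenCardinality P = ∃[ k ] HasCardinality P k × 2 ∣ k

-- The constructor S̃/T stands for the quotient S̃ₙ/Tₙ.
data QuotientType : Set where
  C̃/C B̃/B B̃/D D̃/D : QuotientType

minRank : QuotientType → ℕ
minRank C̃/C = 2
minRank B̃/B = 3
minRank B̃/D = 3
minRank D̃/D = 4

-- Which of the two variants of s₀, respectively sₙ, is used: s₀ᶜ or s₀ᴰ,
-- respectively sₙᶜ or sₙᴰ.
data Variant : Set where
  variantC variantD : Variant

variant₀ variantₙ : QuotientType → Variant
variant₀ C̃/C = variantC
variant₀ B̃/B = variantD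
variant₀ B̃/D = variantC
variant₀ D̃/D = variantD
variantₙ C̃/C = variantC
variantₙ B̃/B = variantC
variantₙ B̃/D = variantD
variantₙ D̃/D = variantD

infixl 10 _[_↦_]

_[_↦_] : (ℕ → ℤ) → ℕ → ℤ → (ℕ → ℤ)
(g [ a ↦ v ]) j = if j ≡ᵇ a then v else g j

-- The box (a , b) is the entry in row a + 1 and column b + 1.
Box : Set
Box = ℕ × ℕ

row col : Box → ℕ
row (a , b) = suc a
col (a , b) = suc b

-- A partition is represented by the set of boxes of its diagram.
Diagram : Set₁
Diagram = Pred Box 0ℓ

IsPartition : Pred Diagram 0ℓ
IsPartition μ =
    (∃[ k ] ∀ x → x ∈ μ → row x ≤ k × col x ≤ k)
  × (∀ x y → row x ≤ row y → col x ≤ col y → y ∈ μ → x ∈ μ)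

transposed : Diagram → Diagram
transposed μ x = swap x ∈ μ

ShareEdge : Rel Box 0ℓ
ShareEdge x y = (row x ≡ row y × ∣ col x - col y ∣ ≡ 1)
              ⊎ (col x ≡ col y × ∣ row x - row y ∣ ≡ 1)

-- The connected component of S that contains x (empty if x ∉ S).
Component : Pred Box 0ℓ → Box → Pred Box 0ℓ
Component S x y = x ∈ S × Star (λ u v → ShareEdge u v × v ∈ S) x y

Upper Lower Main : Pred (Pred Box 0ℓ) 0ℓ
Upper E = ∀ x → x ∈ E → row x < col x
Lower E = ∀ x → x ∈ E → col x < row x
Main  E = ∃[ x ] x ∈ E × row x ≡ col x

-- The row (with zero-based index) r of μ consists of its first k boxes.
RowLength : Diagram → ℕ → ℕ → Set
RowLength μ r k = ∀ j → ((r , j) ∈ μ) ⇔ (j < k)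

-- Row r meets E exactly in c₁ = (r , c), c₂ = (r , c + 1), c₃ = (r , c + 2).
MeetsRow : Pred Box 0ℓ → ℕ → ℕ → Set
MeetsRow E r c = ∀ j → ((r , j) ∈ E) ⇔ (c ≤ j × j < c + 3)

-- (q , k) ∈ bandResidues a b p : if p of the boxes c₁, c₂, c₃ lie in the
-- partition, its row ending at the last of them (immediately to the left of c₁
-- for p = 0), then k is a residue of the box with offset q from c₁.
bandResidues : ℕ → ℕ → ℕ → List (ℕ × ℕ)
bandResidues a b 0 = (0 , a) ∷ (0 , b) ∷ (1 , b) ∷ []
bandResidues a b 1 = (0 , a) ∷ (1 , b) ∷ (2 , b) ∷ []
bandResidues a b 2 = (0 , b) ∷ (1 , b) ∷ (2 , a) ∷ []
bandResidues a b 3 = (1 , b) ∷ (2 , a) ∷ (2 , b) ∷ []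
bandResidues a b _ = []

RowResidue : Pred Box 0ℓ → ℕ → ℕ → Diagram → Box → ℕ → Set
RowResidue E a b μ (r , j) k =
  ∃[ c ] ∃[ p ] ∃[ q ] MeetsRow E r c × RowLength μ r (c + p)
                     × ((q , k) List.∈ bandResidues a b p) × j ≡ c + q

ColumnResidue : Pred Box 0ℓ → ℕ → ℕ → Diagram → Box → ℕ → Set
ColumnResidue E a b μ x k = RowResidue (E ∘ swap) a b (transposed μ) (swap x) k

BandResidue : Pred Box 0ℓ → ℕ → ℕ → Diagram → Box → ℕ → Set
BandResidue E a b μ x k = (Upper E × RowResidue E a b μ x k)
                        ⊎ (Lower E × ColumnResidue E a b μ x k)

data MainResidue (x : Box) : ℕ → Set where
  diagonal : row x ≡ col x → MainResidue x 0
  off₁     : ∣ row x - col x ∣ ≡ 1 → (row x + col x) % 4 ≡ 1 → MainResidue x 1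
  off₃     : ∣ row x - col x ∣ ≡ 1 → (row x + col x) % 4 ≡ 3 → MainResidue x 0

module Quotient (X : QuotientType) (n : ℕ) .{{_ : NonZero n}} where

  N : ℕ
  N = suc (2 * n)

  record Mirrored (w : ℤ → ℤ) : Set where
    field
      bijective : Bijective _≡_ _≡_ w
      periodic  : ∀ z → w (z ℤ.+ + N) ≡ w z ℤ.+ + N
      odd       : ∀ z → w (ℤ.- z) ≡ ℤ.- w z

  Even₀ Evenₙ : Pred (ℤ → ℤ) 0ℓ
  Even₀ w = HasEvenCardinality (λ z → z ℤ.≤ + 0 × + 1 ℤ.≤ w z)
  Evenₙ w = HasEvenCardinality (λ z → z ℤ.≤ + n × + suc n ℤ.≤ w z)

  W̃ : Pred (ℤ → ℤ) 0ℓ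
  W̃ w = Mirrored w × (variant₀ X ≡ variantD → Even₀ w)
                   × (variantₙ X ≡ variantD → Evenₙ w)

  -- The only function agreeing with g on 1, …, n that satisfies the periodicity
  -- and oddness conditions; w (N - r) = N - w r gives the values at n + 1, …, 2n.
  extend : (ℕ → ℤ) → (ℤ → ℤ)
  extend g z = base (z %ℕ N) ℤ.+ (z /ℕ N) ℤ.* + N
    where
    base : ℕ → ℤ
    base 0 = + 0
    base r = if r ≤ᵇ n then g r else + N ℤ.- g (N ∸ r)

  s₀ sₙ : Variant → ℕ → ℤ
  s₀ variantC = +_ [ 1 ↦ ℤ.- + 1 ]
  s₀ variantD = +_ [ 1 ↦ ℤ.- + 2 ] [ 2 ↦ ℤ.- + 1 ]
  sₙ variantC = +_ [ n ↦ + (n + 1) ]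
  sₙ variantD = +_ [ n ∸ 1 ↦ + (n + 1) ] [ n ↦ + (n + 2) ]

  s : Fin (suc n) → ℤ → ℤ
  s i = extend (if toℕ i ≡ᵇ 0 then s₀ (variant₀ X)
                else if toℕ i ≡ᵇ n then sₙ (variantₙ X)
                else +_ [ toℕ i ↦ + suc (toℕ i) ] [ suc (toℕ i) ↦ + toℕ i ])

  product : List (Fin (suc n)) → ℤ → ℤ
  product []       = id
  product (i ∷ is) = s i ∘ product is

  -- The generators are involutions, so products without inverses suffice.
  W : Pred (ℤ → ℤ) 0ℓ
  W v = ∃[ is ] v ≗ product (map Fin.suc is)

  HasLength : (ℤ → ℤ) → ℕ → Set
  HasLength w k = (∃[ is ] length is ≡ k × w ≗ product is)
                × (∀ is → w ≗ product is → k ≤ length is)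

  _≤ℓ_ _<ℓ_ : Rel (ℤ → ℤ) 0ℓ
  u ≤ℓ v = ∃[ k ] ∃[ l ] HasLength u k × HasLength v l × k ≤ l
  u <ℓ v = ∃[ k ] ∃[ l ] HasLength u k × HasLength v l × k < l

  _·W : (ℤ → ℤ) → Pred (ℤ → ℤ) 0ℓ
  (u ·W) x = ∃[ v ] v ∈ W × x ≗ u ∘ v

  W̃/W : Pred (ℤ → ℤ) 0ℓ
  W̃/W w = w ∈ W̃ × (∀ v → v ∈ W → w ≤ℓ (w ∘ v))

  Ascent Descent Neither : Fin (suc n) → Pred (ℤ → ℤ) 0ℓ
  Ascent  i w = w <ℓ (s i ∘ w) × (s i ∘ w) ∈ W̃/W
  Descent i w = (s i ∘ w) <ℓ w
  Neither i w = ((s i ∘ w) ·W) ≐ (w ·W)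

  -- The abacus of w. Integers not divisible by N are the entries; the beads are
  -- w 1, …, w (2n) and everything above them on their runners.
  Bead Gap : (ℤ → ℤ) → Pred ℤ 0ℓ
  Bead w e = ∃[ j ] ∃[ m ] 1 ≤ j × j ≤ 2 * n × e ≡ w (+ j) ℤ.- + (m * N)
  Gap  w e = ¬ (+ N ℤ∣.∣ e) × ¬ Bead w e

  -- Just before the entry e is read, the path has taken x east-steps from the
  -- left border of the diagram and has y north-steps left to its top border. The
  -- diagram is the union of the y × x rectangles to the northwest of the path.
  𝒞 : (ℤ → ℤ) → Diagram
  𝒞 w b = ∃[ e ] ∃[ y ] ∃[ x ] HasCardinality (λ z → z ∈ Bead w × e ℤ.≤ z) y
                             × HasCardinality (λ z → z ∈ Gap w × z ℤ.< e) x
                             × row b ≤ y × col b ≤ x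

  private instance
    2n≢0 : NonZero (2 * n)
    2n≢0 = m*n≢0 2 n

  content : Box → ℕ
  content x = (+ col x ℤ.- + row x) %ℕ (2 * n)

  fixedResidue : Box → ℕ
  fixedResidue x = if content x ≤ᵇ n then content x else 2 * n ∸ content x

  Escalators Descalators : Pred Box 0ℓ
  Escalators  x = content x ≡ n ∸ 1 ⊎ content x ≡ n ⊎ content x ≡ n + 1
  Descalators x = content x ≡ 0 ⊎ content x ≡ 1 ⊎ content x ≡ 2 * n ∸ 1

  data HasResidue (μ : Diagram) (x : Box) (k : ℕ) : Set where
    escalator      : variantₙ X ≡ variantD →
                     BandResidue (Component Escalators x) (n ∸ 1) n μ x k →
                     HasResidue μ x k
    descalator     : variant₀ X ≡ variantD →
                     BandResidue (Component Descalators x) 1 0 μ x k →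
                     HasResidue μ x k
    mainDescalator : variant₀ X ≡ variantD →
                     Main (Component Descalators x) → MainResidue x k →
                     HasResidue μ x k
    fixed          : (variantₙ X ≡ variantD → x ∉ Escalators) →
                     (variant₀ X ≡ variantD → x ∉ Descalators) →
                     fixedResidue x ≡ k → HasResidue μ x k

  _-component : ℕ → Diagram → Box → Pred Box 0ℓ
  (k -component) μ x = Component (λ y → HasResidue μ y k) x

  Addable Removable : Diagram → Pred (Pred Box 0ℓ) 0ℓ
  Addable   μ K = (∀ x → x ∈ K → x ∉ μ) × IsPartition (μ ∪ K)
  Removable μ K = K ⊆ μ × IsPartition (λ x → x ∈ μ × x ∉ K)

  addAll removeAll : ℕ → Diagram → Diagram
  addAll k μ x =
    x ∈ μ ⊎ (∃[ y ] Addable μ ((k -component) μ y) × x ∈ (k -component) μ y)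
  removeAll k μ x =
    x ∈ μ × ¬ (∃[ y ] Removable μ ((k -component) μ y) × x ∈ (k -component) μ y)

  -- s i acts on the partition 𝒞 w with result μ: the action is transported from
  -- the one on cosets, so the result is 𝒞 w′ for the minimal length
  -- representative w′ of s i w W.
  ActsWithResult : Fin (suc n) → (ℤ → ℤ) → Diagram → Set
  ActsWithResult i w μ = ∃[ w′ ] w′ ∈ W̃/W × w′ ∈ ((s i ∘ w) ·W) × 𝒞 w′ ≐ μ

{-# OPTIONS --safe #-}
module Submission where

-- The entries of the abacus are indexed, in reading order, by positions d ∈ ℤ.
-- If h d counts the beads from position d on, a box of content d lies in 𝒞 w
-- exactly when its row is at most h d. The generator of type C with index i
-- exchanges the positions d - 1 and d for every d ≡ ± i (mod 2n), hence changes
-- h only at these contents; a D-variant is the product s_B s_A s_B of generators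
-- of type C and permutes four positions around every content d ≡ B. As the
-- abacus is flush and mirrored, to the right of the main diagonal at most two of
-- these four carry a bead, and each such bead is the end of a row to which the
-- residue rule applies. This reduces the theorem to three local facts: the
-- changed boxes have residue i, a neighbour of residue i of a changed box is
-- changed, and a box of an addable (removable) component is changed. On the main
-- descalator the boxes of residue 0 form 2 × 2 squares, and the parity condition
-- says that the path meets the diagonal at a corner of such a square.
-- That an ascent only adds boxes follows from the exchange condition: if s_i
-- moved a bead the wrong way, then w would invert the two labels that s_i
-- exchanges, and s_i w would be shorter than w.

open import Data.Bool using (Bool; true; false; if_then_else_; not; T; _∧_)
import Data.Bool.Properties as Bool
open import Data.Empty using (⊥; ⊥-elim)
open import Data.Fin as Fin using (Fin; toℕ)
open import Data.Fin.Properties using (any?; toℕ<n)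
open import Data.Integer as ℤ using (ℤ; +_; -[1+_]; +≤+; +<+)
import Data.Integer.Properties as ℤ
open import Data.Integer.Divisibility.Signed using (divides; ∣⇒∣ᵤ; ∣ᵤ⇒∣) renaming (_∣_ to _∣ₛ_)
open import Data.Integer.DivMod using (_/ℕ_; _%ℕ_; a≡a%ℕn+[a/ℕn]*n; n%ℕd<d)
open import Data.Integer.Tactic.RingSolver using (solve-∀)
open import Data.List using ([]; _∷_; length; map)
open import Data.List.Membership.Propositional using () renaming (_∈_ to _∈ₗ_)
open import Data.List.Membership.Propositional.Properties using (∈-map⁺; ∈-map⁻)
open import Data.List.Membership.Propositional.Properties.WithK using (unique∧set⇒bag)
open import Data.List.Properties using (length-map)
open import Data.List.Relation.Binary.BagAndSetEquality using (∼bag⇒↭)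
open import Data.List.Relation.Binary.Permutation.Propositional.Properties using (↭-length)
open import Data.List.Relation.Unary.All as All using (All)
open import Data.List.Relation.Unary.AllPairs as AllPairs using ()
open import Data.List.Relation.Unary.Any using (here; there)
open import Data.List.Relation.Unary.Unique.Propositional.Properties as Unique using ()
open import Data.Nat
open import Data.Nat.Divisibility using (_∣_; divides; ∣m+n∣m⇒∣n; ∣m∣n⇒∣m+n; ∣-refl)
open import Data.Nat.DivMod using (_%_; [m+kn]%n≡m%n)
import Data.Nat.Properties as ℕ
open import Data.Nat.Tactic.RingSolver using () renaming (solve-∀ to solveℕ-∀)
open import Data.Product using (_×_; _,_; ∃; ∃-syntax; proj₁; proj₂; swap)
open import Data.Sum using (_⊎_; inj₁; inj₂; [_,_]′)
open import Function using (_∘_; id)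
open import Function.Bundles using (_⇔_; mk⇔; Equivalence)
open import Level using (0ℓ)
open import Relation.Binary using (Tri; tri<; tri≈; tri>)
open import Relation.Binary.Construct.Closure.ReflexiveTransitive using (Star; _◅_; _◅◅_) renaming (ε to done)
open import Relation.Binary.PropositionalEquality
open import Relation.Nullary using (¬_; yes; no; contradiction; Dec; does)
open import Relation.Nullary.Decidable using (map′; dec-true; dec-false; from-yes; _×-dec_; _⊎-dec_; _→-dec_)
open import Relation.Unary using (Pred; _∈_; _∉_; _∪_; _⊆_; _≐_)
open import Defs

-- The abacus is read through the inverse `g` of w: an entry is a bead exactly when `g` takes it to
-- at most N. By mirror symmetry the gaps before a position are the reflected beads from the
-- opposite position on, so a single height function controls both rows and columns, and a lower
-- band is the transpose of an upper one. The exchange argument meets an obstacle at the D-variants.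
-- Around a centre D such a generator reverses not only the pairs (D - 2, D) and (D - 1, D + 1) that
-- it exchanges, but also (D - 2, D + 1) and (D - 1, D), which are symmetric about D - 1/2. A
-- crossing of one of the latter does not identify the given reflection with the letter, so the
-- argument is confined to pairs symmetric about no centre; equivariance preserves this class along
-- a word. For a descent, membership of s_i w among the minimal representatives is not given but has
-- to be shown. The parity conditions are therefore carried along, and the one at n calls for
-- heights with a second threshold, which count the entries that `g` takes to at most N + n.

-- Linear arithmetic: the differences are compared by the ring solver.
≤-via : ∀ {x y x′ y′} → x ℤ.≤ y → y ℤ.- x ≡ y′ ℤ.- x′ → x′ ℤ.≤ y′
≤-via p e = ℤ.0≤i-j⇒j≤i (subst (+ 0 ℤ.≤_) e (ℤ.i≤j⇒0≤j-i p))

<⇒1+≤ : ∀ {x y} → x ℤ.< y → + 1 ℤ.+ x ℤ.≤ y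
<⇒1+≤ = ℤ.i<j⇒suc[i]≤j

1+≤⇒< : ∀ {x y} → + 1 ℤ.+ x ℤ.≤ y → x ℤ.< y
1+≤⇒< = ℤ.suc[i]≤j⇒i<j

<-via : ∀ {x y x′ y′} → x ℤ.< y → y ℤ.- x ≡ y′ ℤ.- x′ → x′ ℤ.< y′
<-via {x} {y} {x′} {y′} p e = 1+≤⇒< (≤-via (<⇒1+≤ p) (trans (h x y) (trans (cong (λ z → z ℤ.- + 1) e) (sym (h x′ y′)))))
  where
  h : ∀ u v → v ℤ.- (+ 1 ℤ.+ u) ≡ (v ℤ.- u) ℤ.- + 1
  h = solve-∀

≡-via : ∀ {x y x′ y′} → x ≡ y → x ℤ.- y ≡ x′ ℤ.- y′ → x′ ≡ y′
≡-via {x} {y} {x′} {y′} p e = ℤ.i-j≡0⇒i≡j x′ y′ (trans (sym e) (ℤ.i≡j⇒i-j≡0 p))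

+ʳ-cancel : ∀ {x y} z → x ℤ.+ z ≡ y ℤ.+ z → x ≡ y
+ʳ-cancel {x} {y} z e = ≡-via e (h x y z)
  where
  h : ∀ x y z → (x ℤ.+ z) ℤ.- (y ℤ.+ z) ≡ x ℤ.- y
  h = solve-∀

ℤ-ind : (Q : ℤ → Set) → Q (+ 0) → (∀ z → Q z → Q (+ 1 ℤ.+ z)) → (∀ z → Q (+ 1 ℤ.+ z) → Q z) → ∀ z → Q z
ℤ-ind Q z₀ up down (+ zero)      = z₀
ℤ-ind Q z₀ up down (+ suc m)     = up (+ m) (ℤ-ind Q z₀ up down (+ m))
ℤ-ind Q z₀ up down -[1+ zero ]   = down -[1+ 0 ] z₀
ℤ-ind Q z₀ up down -[1+ suc m ]  = down -[1+ suc m ] (ℤ-ind Q z₀ up down -[1+ m ])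

ℤ-ind-from : (Q : ℤ → Set) (c : ℤ) → Q c → (∀ z → Q z → Q (+ 1 ℤ.+ z)) → (∀ z → Q (+ 1 ℤ.+ z) → Q z) → ∀ z → Q z
ℤ-ind-from Q c q up down z = subst Q (h₂ z c)
  (ℤ-ind (λ y → Q (y ℤ.+ c)) (subst Q (sym (ℤ.+-identityˡ c)) q)
    (λ y p → subst Q (h₁ y c) (up (y ℤ.+ c) p))
    (λ y p → down (y ℤ.+ c) (subst Q (sym (h₁ y c)) p)) (z ℤ.- c))
  where
  h₁ : ∀ y c → + 1 ℤ.+ (y ℤ.+ c) ≡ (+ 1 ℤ.+ y) ℤ.+ c
  h₁ = solve-∀
  h₂ : ∀ z c → z ℤ.- c ℤ.+ c ≡ z
  h₂ = solve-∀

euclid-unique : ∀ m (r r′ : ℕ) (q q′ : ℤ) → r < m → r′ < m →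
  + r ℤ.+ q ℤ.* + m ≡ + r′ ℤ.+ q′ ℤ.* + m → r ≡ r′ × q ≡ q′
euclid-unique m r r′ q q′ r<m r′<m e = ℤ.+-injective r≡r′ , q≡q′
  where
  below : ∀ a b x y → a < m → x ℤ.< y → + a ℤ.+ x ℤ.* + m ℤ.< + b ℤ.+ y ℤ.* + m
  below a b x y a<m x<y = begin-strict
    + a ℤ.+ x ℤ.* + m    <⟨ ℤ.+-monoˡ-< (x ℤ.* + m) (+<+ a<m) ⟩
    + m ℤ.+ x ℤ.* + m    ≡⟨ ℤ.suc-* x (+ m) ⟨
    ℤ.suc x ℤ.* + m      ≤⟨ ℤ.*-monoʳ-≤-nonNeg (+ m) (<⇒1+≤ x<y) ⟩
    y ℤ.* + m            ≤⟨ ℤ.i≤j+i _ (+ b) ⟩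
    + b ℤ.+ y ℤ.* + m    ∎
    where open ℤ.≤-Reasoning
  q≡q′ : q ≡ q′
  q≡q′ with ℤ.<-cmp q q′
  ... | tri< l _ _ = contradiction e (ℤ.<⇒≢ (below r r′ q q′ r<m l))
  ... | tri≈ _ p _ = p
  ... | tri> _ _ l = contradiction (sym e) (ℤ.<⇒≢ (below r′ r q′ q r′<m l))
  r≡r′ : + r ≡ + r′
  r≡r′ = +ʳ-cancel (q ℤ.* + m) (trans e (cong (λ x → + r′ ℤ.+ x ℤ.* + m) (sym q≡q′)))

module _ (m : ℕ) .{{_ : NonZero m}} (r : ℕ) (q : ℤ) (r<m : r < m) where
  private
    u : r ≡ (+ r ℤ.+ q ℤ.* + m) %ℕ m × q ≡ (+ r ℤ.+ q ℤ.* + m) /ℕ m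
    u = euclid-unique m r _ q _ r<m (n%ℕd<d (+ r ℤ.+ q ℤ.* + m) m) (a≡a%ℕn+[a/ℕn]*n _ m)
  [r+qm]%m : (+ r ℤ.+ q ℤ.* + m) %ℕ m ≡ r
  [r+qm]%m = sym (proj₁ u)
  [r+qm]/m : (+ r ℤ.+ q ℤ.* + m) /ℕ m ≡ q
  [r+qm]/m = sym (proj₂ u)

-- Folded residues of contents and the labels of positions.

module Index (n : ℕ) .{{_ : NonZero n}} where
  instance
    2n≢0 : NonZero (2 * n)
    2n≢0 = ℕ.m*n≢0 2 n

  P N : ℤ
  P = + (2 * n)
  N = + suc (2 * n)

  0<n : 0 < n
  0<n = >-nonZero⁻¹ n

  2n≡n+n : 2 * n ≡ n + n
  2n≡n+n = cong (λ m → n + m) (ℕ.+-identityʳ n)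

  n<2n : n < 2 * n
  n<2n = subst (n <_) (sym 2n≡n+n) (ℕ.m<m+n n 0<n)

  P≡ : P ≡ + n ℤ.+ + n
  P≡ = cong +_ 2n≡n+n

  -- A step d is recorded through the window [-n, n) of its residue modulo 2n.
  data View (d : ℤ) : Set where
    up   : ∀ k t → t < n → d ≡ + t ℤ.+ k ℤ.* P → View d
    down : ∀ k t → t < n → d ≡ ℤ.- + suc t ℤ.+ k ℤ.* P → View d

  -- Passage from the window [-n, n) to the remainders in [0, 2n), on which division can be
  -- evaluated; it costs one period of the quotient.
  neg-form : ∀ k t u → suc t + u ≡ 2 * n → ℤ.- + suc t ℤ.+ k ℤ.* P ≡ + u ℤ.+ (k ℤ.- + 1) ℤ.* P
  neg-form k t u e = trans (h (+ suc t) (+ u) (k ℤ.* P))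
      (trans (cong (λ x → + u ℤ.+ (k ℤ.* P ℤ.- + x)) e) (h′ (+ u) k P))
    where
    h : ∀ s v y → ℤ.- s ℤ.+ y ≡ v ℤ.+ (y ℤ.- (s ℤ.+ v))
    h = solve-∀
    h′ : ∀ v k p → v ℤ.+ (k ℤ.* p ℤ.- p) ≡ v ℤ.+ (k ℤ.- + 1) ℤ.* p
    h′ = solve-∀

  k-1+1 : ∀ k → (+ 1 ℤ.+ k) ℤ.- + 1 ≡ k
  k-1+1 = solve-∀

  view : ∀ d → View d
  view d with d %ℕ (2 * n) | d /ℕ (2 * n) | a≡a%ℕn+[a/ℕn]*n d (2 * n) | n%ℕd<d d (2 * n)
  ... | r | q | e | r<2n with r <? n
  ... | yes r<n = up q r r<n e
  ... | no r≮n = down (+ 1 ℤ.+ q) t t<n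
        (trans e (sym (trans (neg-form (+ 1 ℤ.+ q) t r eq) (cong (λ x → + r ℤ.+ x ℤ.* P) (k-1+1 q)))))
    where
    t = 2 * n ∸ suc r
    eq : suc t + r ≡ 2 * n
    eq = trans (sym (ℕ.+-suc t r)) (ℕ.m∸n+n≡m r<2n)
    t<n : t < n
    t<n = ℕ.+-cancelʳ-≤ r (suc t) n (subst (_≤ n + r) (sym (trans eq 2n≡n+n)) (ℕ.+-monoʳ-≤ n (ℕ.≮⇒≥ r≮n)))

  -- The formula of `fixedResidue`. On remainders modulo 2n it is the distance to the nearest
  -- multiple of 2n, whence its invariance under negation.
  fold : ℕ → ℕ
  fold c = if c ≤ᵇ n then c else 2 * n ∸ c

  abstract
    fr : ℤ → ℕ
    fr d = fold (d %ℕ (2 * n))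

    fr-def : ∀ d → fr d ≡ fold (d %ℕ (2 * n))
    fr-def d = refl

  fold-≤ : ∀ {c} → c ≤ n → fold c ≡ c
  fold-≤ {c} c≤n with c ≤ᵇ n in eq
  ... | true  = refl
  ... | false = contradiction (ℕ.≤⇒≤ᵇ c≤n) (subst (¬_ ∘ T) (sym eq) id)

  fold-≥ : ∀ {c t} → t ≤ n → t + c ≡ 2 * n → fold c ≡ t
  fold-≥ {c} {t} t≤n e with c ≤ᵇ n in eq
  ... | false = trans (cong (_∸ c) (sym e)) (ℕ.m+n∸n≡m t c)
  -- Both tests can succeed only for c = t = n, where the two formulas agree.
  ... | true  = trans (ℕ.≤-antisym c≤n n≤c) (ℕ.≤-antisym n≤t t≤n)
    where
    c≤n = ℕ.≤ᵇ⇒≤ c n (subst T (sym eq) _)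
    n≤c = ℕ.+-cancelˡ-≤ n n c (subst (_≤ n + c) (trans e 2n≡n+n) (ℕ.+-monoˡ-≤ c t≤n))
    n≤t = ℕ.+-cancelʳ-≤ n n t (subst (_≤ t + n) (trans e 2n≡n+n) (ℕ.+-monoʳ-≤ t c≤n))

  fr-up : ∀ k {t} → t ≤ n → fr (+ t ℤ.+ k ℤ.* P) ≡ t
  fr-up k {t} t≤n = trans (fr-def (+ t ℤ.+ k ℤ.* P)) (trans (cong fold ([r+qm]%m (2 * n) t k (ℕ.≤-<-trans t≤n n<2n))) (fold-≤ t≤n))

  fr-down : ∀ k {t} → t ≤ n → fr (ℤ.- + t ℤ.+ k ℤ.* P) ≡ t
  fr-down k {zero} _ = fr-up k z≤n
  fr-down k {suc t} t<n = trans (cong fr (neg-form k t u eq))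
      (trans (fr-def (+ u ℤ.+ (k ℤ.- + 1) ℤ.* P)) (trans (cong fold ([r+qm]%m (2 * n) u (k ℤ.- + 1) u<)) (fold-≥ t<n eq)))
    where
    u = 2 * n ∸ suc t
    eq : suc t + u ≡ 2 * n
    eq = ℕ.m+[n∸m]≡n (ℕ.≤-trans t<n (ℕ.<⇒≤ n<2n))
    u< : u < 2 * n
    u< = subst (u <_) eq (ℕ.m<n+m u z<s)

  pred-suc : ∀ d → ℤ.- + 1 ℤ.+ (+ 1 ℤ.+ d) ≡ d
  pred-suc = solve-∀
  suc-pred : ∀ d → + 1 ℤ.+ (ℤ.- + 1 ℤ.+ d) ≡ d
  suc-pred = solve-∀
  +1-down : ∀ t x → + 1 ℤ.+ (ℤ.- (+ 1 ℤ.+ t) ℤ.+ x) ≡ ℤ.- t ℤ.+ x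
  +1-down = solve-∀
  -1-down : ∀ t x → ℤ.- + 1 ℤ.+ (ℤ.- t ℤ.+ x) ≡ ℤ.- (+ 1 ℤ.+ t) ℤ.+ x
  -1-down = solve-∀
  +1-up : ∀ t x → + 1 ℤ.+ (t ℤ.+ x) ≡ (+ 1 ℤ.+ t) ℤ.+ x
  +1-up = solve-∀
  -1-up : ∀ t x → ℤ.- + 1 ℤ.+ ((+ 1 ℤ.+ t) ℤ.+ x) ≡ t ℤ.+ x
  -1-up = solve-∀

  -- The folded residue runs up and down between 0 and n without plateaus and turns around only at 0
  -- and n. Hence adjacent contents never share a residue.
  data FrStep (d : ℤ) : Set where
    rise : ∀ t → t < n → fr d ≡ t → fr (+ 1 ℤ.+ d) ≡ suc t → FrStep d
    fall : ∀ t → t < n → fr d ≡ suc t → fr (+ 1 ℤ.+ d) ≡ t → FrStep d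

  frStep : ∀ d → FrStep d
  frStep d with view d
  ... | up k t t<n refl = rise t t<n (fr-up k (ℕ.<⇒≤ t<n)) (trans (cong fr (+1-up (+ t) (k ℤ.* P))) (fr-up k t<n))
  ... | down k t t<n refl = fall t t<n (fr-down k t<n) (trans (cong fr (+1-down (+ t) (k ℤ.* P))) (fr-down k (ℕ.<⇒≤ t<n)))

  fr-neg : ∀ d → fr (ℤ.- d) ≡ fr d
  fr-neg d with view d
  ... | up q t t<n refl = trans (cong fr (h (+ t) q P)) (trans (fr-down (ℤ.- q) (ℕ.<⇒≤ t<n)) (sym (fr-up q (ℕ.<⇒≤ t<n))))
    where
    h : ∀ t q P → ℤ.- (t ℤ.+ q ℤ.* P) ≡ ℤ.- t ℤ.+ (ℤ.- q) ℤ.* P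
    h = solve-∀
  ... | down q t t<n refl = trans (cong fr (h (+ suc t) q P)) (trans (fr-up (ℤ.- q) t<n) (sym (fr-down q t<n)))
    where
    h : ∀ t q P → ℤ.- (ℤ.- t ℤ.+ q ℤ.* P) ≡ t ℤ.+ (ℤ.- q) ℤ.* P
    h = solve-∀

  fr≡0 : ∀ d → fr d ≡ 0 → ∃[ k ] d ≡ k ℤ.* P
  fr≡0 d e with view d
  ... | up k zero _ refl = k , ℤ.+-identityˡ _
  ... | up k (suc t) t<n refl with () ← trans (sym (fr-up k (ℕ.<⇒≤ t<n))) e
  ... | down k t t<n refl with () ← trans (sym (fr-down k t<n)) e

  fr≡n : ∀ d → fr d ≡ n → ∃[ k ] d ≡ + n ℤ.+ k ℤ.* P
  fr≡n d e with view d
  ... | up k t t<n refl = contradiction (trans (sym (fr-up k (ℕ.<⇒≤ t<n))) e) (ℕ.<⇒≢ t<n)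
  ... | down k t t<n refl = k ℤ.- + 1 , neg-form k t n
        (trans (cong (_+ n) (trans (sym (fr-down k t<n)) e)) (sym 2n≡n+n))

  fr≡0⇒ : ∀ d → fr d ≡ 0 → fr (+ 1 ℤ.+ d) ≡ 1 × fr (ℤ.- + 1 ℤ.+ d) ≡ 1
  fr≡0⇒ d e with fr≡0 d e
  ... | k , refl = fr-up k 0<n , fr-down k 0<n

  fr≡n⇒ : ∀ d → fr d ≡ n → suc (fr (+ 1 ℤ.+ d)) ≡ n × suc (fr (ℤ.- + 1 ℤ.+ d)) ≡ n
  fr≡n⇒ d e = lemma₁ (frStep d) , lemma₂ (frStep (ℤ.- + 1 ℤ.+ d))
    where
    lemma₁ : FrStep d → suc (fr (+ 1 ℤ.+ d)) ≡ n
    lemma₁ (rise t t<n p q) = contradiction (trans (sym p) e) (ℕ.<⇒≢ t<n)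
    lemma₁ (fall t t<n p q) = trans (cong suc q) (trans (sym p) e)
    lemma₂ : FrStep (ℤ.- + 1 ℤ.+ d) → suc (fr (ℤ.- + 1 ℤ.+ d)) ≡ n
    lemma₂ (rise t t<n p q) = trans (cong suc p) (trans (sym q) (trans (cong fr (suc-pred d)) e))
    lemma₂ (fall t t<n p q) = contradiction (trans (sym q) (trans (cong fr (suc-pred d)) e)) (ℕ.<⇒≢ t<n)

  fr-0 : fr (+ 0) ≡ 0
  fr-0 = fr-up (+ 0) z≤n

  fr-consecutive : ∀ {i} d → fr d ≡ i → fr (+ 1 ℤ.+ d) ≢ i
  fr-consecutive d p q with frStep d
  ... | rise t _ x y = ℕ.1+n≢n (trans (sym y) (trans q (trans (sym p) x)))
  ... | fall t _ x y = ℕ.1+n≢n (trans (sym x) (trans p (trans (sym q) y)))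

  fr-inner : ∀ d t → fr d ≡ suc t → suc t < n →
    (fr (+ 1 ℤ.+ d) ≡ suc (suc t) × fr (ℤ.- + 1 ℤ.+ d) ≡ t) ⊎ (fr (+ 1 ℤ.+ d) ≡ t × fr (ℤ.- + 1 ℤ.+ d) ≡ suc (suc t))
  fr-inner d t e 1+t<n with view d
  ... | up k u u<n refl with trans (sym (fr-up k (ℕ.<⇒≤ u<n))) e
  ...   | refl = inj₁ (trans (cong fr (+1-up (+ u) (k ℤ.* P))) (fr-up k u<n)
                      , trans (cong fr (-1-up (+ t) (k ℤ.* P))) (fr-up k (ℕ.≤-trans (ℕ.n≤1+n t) (ℕ.<⇒≤ u<n))))
  fr-inner d t e 1+t<n | down k u u<n refl with trans (sym (fr-down k u<n)) e
  ...   | refl = inj₂ (trans (cong fr (+1-down (+ t) (k ℤ.* P))) (fr-down k (ℕ.<⇒≤ u<n))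
                      , trans (cong fr (-1-down (+ suc t) (k ℤ.* P))) (fr-down k 1+t<n))

  -- The label of the entry at position d of the reading order, where the
  -- entry N + 1 has position 0.
  abstract
    ε : ℤ → ℤ
    ε d = + suc (d %ℕ (2 * n)) ℤ.+ (+ 1 ℤ.+ d /ℕ (2 * n)) ℤ.* N

    ε-def : ∀ d → ε d ≡ + suc (d %ℕ (2 * n)) ℤ.+ (+ 1 ℤ.+ d /ℕ (2 * n)) ℤ.* N
    ε-def d = refl

  ε-up : ∀ k {t} → t < 2 * n → ε (+ t ℤ.+ k ℤ.* P) ≡ + suc t ℤ.+ (+ 1 ℤ.+ k) ℤ.* N
  ε-up k {t} t< = trans (ε-def (+ t ℤ.+ k ℤ.* P)) (cong₂ (λ r q → + suc r ℤ.+ (+ 1 ℤ.+ q) ℤ.* N) ([r+qm]%m (2 * n) t k t<) ([r+qm]/m (2 * n) t k t<))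

  ε-down : ∀ k {t} → t < 2 * n → ε (ℤ.- + suc t ℤ.+ k ℤ.* P) ≡ ℤ.- + suc t ℤ.+ (+ 1 ℤ.+ k) ℤ.* N
  ε-down k {t} t< = trans (cong ε (neg-form k t u eq)) (trans (ε-up (k ℤ.- + 1) u<)
      (trans (h (+ suc t) (+ u) k N) (cong (λ x → ℤ.- + suc t ℤ.+ x) (trans (cong (λ y → (+ 1 ℤ.+ + y) ℤ.+ k ℤ.* N) eq) (h′ k N)))))
    where
    u = 2 * n ∸ suc t
    eq : suc t + u ≡ 2 * n
    eq = ℕ.m+[n∸m]≡n t<
    u< : u < 2 * n
    u< = subst (u <_) eq (ℕ.m<n+m u z<s)
    h : ∀ s v k N → (+ 1 ℤ.+ v) ℤ.+ (+ 1 ℤ.+ (k ℤ.- + 1)) ℤ.* N ≡ ℤ.- s ℤ.+ ((+ 1 ℤ.+ (s ℤ.+ v)) ℤ.+ k ℤ.* N)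
    h = solve-∀
    h′ : ∀ k N → N ℤ.+ k ℤ.* N ≡ (+ 1 ℤ.+ k) ℤ.* N
    h′ = solve-∀

  ε-shift : ∀ k d → ε (d ℤ.+ k ℤ.* P) ≡ ε d ℤ.+ k ℤ.* N
  ε-shift k d = trans (cong (λ x → ε (x ℤ.+ k ℤ.* P)) e) (trans (cong ε (h (+ r) q k P))
      (trans (ε-up (q ℤ.+ k) r<) (trans (h′ (+ suc r) q k N) (cong (ℤ._+ k ℤ.* N) (sym (ε-def d))))))
    where
    r = d %ℕ (2 * n)
    q = d /ℕ (2 * n)
    e : d ≡ + r ℤ.+ q ℤ.* P
    e = a≡a%ℕn+[a/ℕn]*n d (2 * n)
    r< = n%ℕd<d d (2 * n)
    h : ∀ t q k P → t ℤ.+ q ℤ.* P ℤ.+ k ℤ.* P ≡ t ℤ.+ (q ℤ.+ k) ℤ.* P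
    h = solve-∀
    h′ : ∀ t q k P → t ℤ.+ (+ 1 ℤ.+ (q ℤ.+ k)) ℤ.* P ≡ t ℤ.+ (+ 1 ℤ.+ q) ℤ.* P ℤ.+ k ℤ.* P
    h′ = solve-∀

  -- The labels N - 1 and N + 1 stand at the positions -1 and 0, so reflecting labels in N reflects
  -- positions in -1/2.
  ε-mirror : ∀ d → ε (ℤ.- (+ 1 ℤ.+ d)) ≡ + 2 ℤ.* N ℤ.- ε d
  ε-mirror d with view d
  ... | up k t t<n refl = trans (cong ε (h (+ t) k P)) (trans (ε-down (ℤ.- k) t<) (trans (h′ (+ suc t) k N)
                            (cong (λ x → + 2 ℤ.* N ℤ.- x) (sym (ε-up k t<)))))
    where
    t< = ℕ.<-trans t<n n<2n
    h : ∀ t k P → ℤ.- (+ 1 ℤ.+ (t ℤ.+ k ℤ.* P)) ≡ ℤ.- (+ 1 ℤ.+ t) ℤ.+ (ℤ.- k) ℤ.* P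
    h = solve-∀
    h′ : ∀ s k N → ℤ.- s ℤ.+ (+ 1 ℤ.+ (ℤ.- k)) ℤ.* N ≡ + 2 ℤ.* N ℤ.- (s ℤ.+ (+ 1 ℤ.+ k) ℤ.* N)
    h′ = solve-∀
  ... | down k t t<n refl = trans (cong ε (h (+ t) k P)) (trans (ε-up (ℤ.- k) t<) (trans (h′ (+ suc t) k N)
                            (cong (λ x → + 2 ℤ.* N ℤ.- x) (sym (ε-down k t<)))))
    where
    t< = ℕ.<-trans t<n n<2n
    h : ∀ t k P → ℤ.- (+ 1 ℤ.+ (ℤ.- (+ 1 ℤ.+ t) ℤ.+ k ℤ.* P)) ≡ t ℤ.+ (ℤ.- k) ℤ.* P
    h = solve-∀
    h′ : ∀ s k N → s ℤ.+ (+ 1 ℤ.+ (ℤ.- k)) ℤ.* N ≡ + 2 ℤ.* N ℤ.- (ℤ.- s ℤ.+ (+ 1 ℤ.+ k) ℤ.* N)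
    h′ = solve-∀

  ε-step : ∀ d → ε d ℤ.< ε (+ 1 ℤ.+ d)
  ε-step d with view d
  ... | up k t t<n refl = subst₂ ℤ._<_ (sym (ε-up k (ℕ.<-trans t<n n<2n)))
          (sym (trans (cong ε (+1-up (+ t) (k ℤ.* P))) (ε-up k (ℕ.≤-<-trans t<n n<2n))))
          (ℤ.+-monoˡ-< ((+ 1 ℤ.+ k) ℤ.* N) (+<+ (ℕ.n<1+n (suc t))))
  -- This step jumps over a multiple of N, which is no entry.
  ... | down k zero t<n refl = subst₂ ℤ._<_ (sym (ε-down k (ℕ.<-trans t<n n<2n)))
          (sym (trans (cong ε (+1-down (+ 0) (k ℤ.* P))) (ε-up k (ℕ.<-trans t<n n<2n))))
          (ℤ.+-monoˡ-< ((+ 1 ℤ.+ k) ℤ.* N) ℤ.-<+)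
  ... | down k (suc t) t<n refl = subst₂ ℤ._<_ (sym (ε-down k (ℕ.<-trans t<n n<2n)))
          (sym (trans (cong ε (+1-down (+ suc t) (k ℤ.* P))) (ε-down k (ℕ.<-trans (ℕ.<⇒≤ t<n) n<2n))))
          (ℤ.+-monoˡ-< ((+ 1 ℤ.+ k) ℤ.* N) (ℤ.neg-mono-< (+<+ (ℕ.n<1+n (suc t)))))

  ≤⇒∃ : ∀ {x y} → x ℤ.≤ y → ∃[ m ] y ≡ + m ℤ.+ x
  ≤⇒∃ {x} {y} p with y ℤ.- x in eq | ℤ.i≤j⇒0≤j-i p
  ... | + m | _ = m , trans (h x y) (cong (ℤ._+ x) eq)
    where
    h : ∀ x y → y ≡ (y ℤ.- x) ℤ.+ x
    h = solve-∀

  ε-mono-≤ : ∀ {d d′} → d ℤ.≤ d′ → ε d ℤ.≤ ε d′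
  ε-mono-≤ {d} p with ≤⇒∃ p
  ... | m , refl = go m
    where
    go : ∀ m → ε d ℤ.≤ ε (+ m ℤ.+ d)
    go zero = ℤ.≤-reflexive (cong ε (sym (ℤ.+-identityˡ d)))
    go (suc m) = ℤ.≤-trans (go m) (ℤ.<⇒≤ (subst (λ x → ε (+ m ℤ.+ d) ℤ.< ε x) (sym (ℤ.+-assoc (+ 1) (+ m) d)) (ε-step (+ m ℤ.+ d))))

  ε-mono-< : ∀ {d d′} → d ℤ.< d′ → ε d ℤ.< ε d′
  ε-mono-< {d} p = ℤ.<-≤-trans (ε-step d) (ε-mono-≤ (<⇒1+≤ p))

  ε-cancel-≤ : ∀ {d d′} → ε d ℤ.≤ ε d′ → d ℤ.≤ d′
  ε-cancel-≤ {d} {d′} p = ℤ.≮⇒≥ λ q → ℤ.<⇒≱ (ε-mono-< q) p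

  ε-cancel-< : ∀ {d d′} → ε d ℤ.< ε d′ → d ℤ.< d′
  ε-cancel-< {d} {d′} p = ℤ.≰⇒> λ q → ℤ.<⇒≱ p (ε-mono-≤ q)

  ε-injective : ∀ {d d′} → ε d ≡ ε d′ → d ≡ d′
  ε-injective p = ℤ.≤-antisym (ε-cancel-≤ (ℤ.≤-reflexive p)) (ε-cancel-≤ (ℤ.≤-reflexive (sym p)))

  data Label (z : ℤ) : Set where
    multiple : ∀ k → z ≡ k ℤ.* N → Label z
    entry    : ∀ d → z ≡ ε d → Label z

  label : ∀ z → Label z
  label z with z %ℕ suc (2 * n) | z /ℕ suc (2 * n) | a≡a%ℕn+[a/ℕn]*n z (suc (2 * n)) | n%ℕd<d z (suc (2 * n))
  ... | zero  | q | e | _ = multiple q (trans e (ℤ.+-identityˡ _))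
  ... | suc r | q | e | s≤s r< = entry (+ r ℤ.+ (q ℤ.- + 1) ℤ.* P)
          (trans e (sym (trans (ε-up (q ℤ.- + 1) r<) (cong (λ x → + suc r ℤ.+ x ℤ.* N) (h q)))))
    where
    h : ∀ q → + 1 ℤ.+ (q ℤ.- + 1) ≡ q
    h = solve-∀

  ε≢ : ∀ d k → ε d ≢ k ℤ.* N
  ε≢ d k e with () ← proj₁ (euclid-unique (suc (2 * n)) _ 0 (+ 1 ℤ.+ d /ℕ (2 * n)) k (s≤s (n%ℕd<d d (2 * n))) z<s (trans (trans (sym (ε-def d)) e) (sym (ℤ.+-identityˡ (k ℤ.* N)))))

-- Generators as equivariant maps and as reflections.

≡ᵇ-true : ∀ {a b} → a ≡ b → (a ≡ᵇ b) ≡ true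
≡ᵇ-true {a} {b} e with a ≡ᵇ b | ℕ.≡⇒≡ᵇ a b e
... | true | _ = refl

≡ᵇ-false : ∀ {a b} → a ≢ b → (a ≡ᵇ b) ≡ false
≡ᵇ-false {a} {b} a≢b with a ≡ᵇ b in eq
... | false = refl
... | true  = contradiction (ℕ.≡ᵇ⇒≡ a b (subst T (sym eq) _)) a≢b

≤ᵇ-true : ∀ {a b} → a ≤ b → (a ≤ᵇ b) ≡ true
≤ᵇ-true {a} {b} e with a ≤ᵇ b | ℕ.≤⇒≤ᵇ e
... | true | _ = refl

≤ᵇ-false : ∀ {a b} → b < a → (a ≤ᵇ b) ≡ false
≤ᵇ-false {a} {b} b<a with a ≤ᵇ b in eq
... | false = refl
... | true  = contradiction (ℕ.≤ᵇ⇒≤ a b (subst T (sym eq) _)) (ℕ.<⇒≱ b<a)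

↦-same : ∀ g {a j} v → j ≡ a → (g [ a ↦ v ]) j ≡ v
↦-same g v e rewrite ≡ᵇ-true e = refl

↦-other : ∀ g {a j} v → j ≢ a → (g [ a ↦ v ]) j ≡ g j
↦-other g v e rewrite ≡ᵇ-false e = refl

module Generators (X : QuotientType) (n : ℕ) .{{_ : NonZero n}} where
  open Quotient X n renaming (N to Nℕ)
  open Index n

  -- A copy of the function `base` that is local to `extend`, so that statements can refer to it.
  ext : (ℕ → ℤ) → ℕ → ℤ
  ext g zero = + 0
  ext g (suc r) = if suc r ≤ᵇ n then g (suc r) else N ℤ.- g (Nℕ ∸ suc r)

  extend-eval : ∀ g r q → r < Nℕ → extend g (+ r ℤ.+ q ℤ.* N) ≡ ext g r ℤ.+ q ℤ.* N
  extend-eval g r q r< with (+ r ℤ.+ q ℤ.* N) %ℕ Nℕ | [r+qm]%m Nℕ r q r< | (+ r ℤ.+ q ℤ.* N) /ℕ Nℕ | [r+qm]/m Nℕ r q r<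
  extend-eval g zero q r< | _ | refl | _ | refl = refl
  extend-eval g (suc r) q r< | _ | refl | _ | refl = refl

  extend-0 : ∀ g k → extend g (k ℤ.* N) ≡ k ℤ.* N
  extend-0 g k = trans (cong (extend g) (sym (ℤ.+-identityˡ (k ℤ.* N)))) (trans (extend-eval g 0 k z<s) (ℤ.+-identityˡ (k ℤ.* N)))

  extend-up : ∀ g k t → t < n → extend g (+ suc t ℤ.+ k ℤ.* N) ≡ g (suc t) ℤ.+ k ℤ.* N
  extend-up g k t t<n = trans (extend-eval g (suc t) k (s≤s (ℕ.<-trans t<n n<2n)))
    (cong (λ b → (if b then g (suc t) else N ℤ.- g (Nℕ ∸ suc t)) ℤ.+ k ℤ.* N) (≤ᵇ-true t<n))

  extend-down : ∀ g k t → t < n → extend g (ℤ.- + suc t ℤ.+ k ℤ.* N) ≡ ℤ.- g (suc t) ℤ.+ k ℤ.* N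
  -- Modulo N the label -(t + 1) has the remainder u + 1 > n. So the reflected branch of `extend`
  -- applies, and N - (u + 1) gives t + 1 back.
  extend-down g k t t<n = trans (cong (extend g) e₁) (trans (extend-eval g (suc u) (k ℤ.- + 1) (s≤s u<2n))
    (trans (cong (λ b → (if b then g (suc u) else N ℤ.- g (Nℕ ∸ suc u)) ℤ.+ (k ℤ.- + 1) ℤ.* N) (≤ᵇ-false n<1+u))
    (trans (cong (λ x → N ℤ.- g x ℤ.+ (k ℤ.- + 1) ℤ.* N) e₂) (h (g (suc t)) k N))))
    where
    u = 2 * n ∸ suc t
    eq : suc t + u ≡ 2 * n
    eq = ℕ.m+[n∸m]≡n (ℕ.≤-trans t<n (ℕ.<⇒≤ n<2n))
    u<2n : u < 2 * n
    u<2n = subst (u <_) eq (ℕ.m<n+m u z<s)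
    n≤u : n ≤ u
    n≤u = ℕ.+-cancelˡ-≤ n n u (subst (_≤ n + u) (trans eq 2n≡n+n) (ℕ.+-monoˡ-≤ u t<n))
    n<1+u : n < suc u
    n<1+u = s≤s n≤u
    e₂ : Nℕ ∸ suc u ≡ suc t
    e₂ = trans (cong (_∸ u) (sym eq)) (ℕ.m+n∸n≡m (suc t) u)
    h : ∀ x k N → N ℤ.- x ℤ.+ (k ℤ.- + 1) ℤ.* N ≡ ℤ.- x ℤ.+ k ℤ.* N
    h = solve-∀
    h′ : ∀ s v k N → N ≡ + 1 ℤ.+ (s ℤ.+ v) → ℤ.- s ℤ.+ k ℤ.* N ≡ (+ 1 ℤ.+ v) ℤ.+ (k ℤ.- + 1) ℤ.* N
    h′ s v k _ refl = h″ s v k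
      where
      h″ : ∀ s v k → ℤ.- s ℤ.+ k ℤ.* (+ 1 ℤ.+ (s ℤ.+ v)) ≡ (+ 1 ℤ.+ v) ℤ.+ (k ℤ.- + 1) ℤ.* (+ 1 ℤ.+ (s ℤ.+ v))
      h″ = solve-∀
    e₁ : ℤ.- + suc t ℤ.+ k ℤ.* N ≡ + suc u ℤ.+ (k ℤ.- + 1) ℤ.* N
    e₁ = h′ (+ suc t) (+ u) k N (cong (λ x → + suc x) (sym eq))

  data Reduced (z : ℤ) : Set where
    mult  : ∀ k → z ≡ k ℤ.* N → Reduced z
    above : ∀ k t → t < n → z ≡ + suc t ℤ.+ k ℤ.* N → Reduced z
    below : ∀ k t → t < n → z ≡ ℤ.- + suc t ℤ.+ k ℤ.* N → Reduced z

  reduced : ∀ z → Reduced z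
  reduced z with label z
  ... | multiple k e = mult k e
  ... | entry d refl with view d
  ...   | up k t t<n refl   = above (+ 1 ℤ.+ k) t t<n (ε-up k (ℕ.<-trans t<n n<2n))
  ...   | down k t t<n refl = below (+ 1 ℤ.+ k) t t<n (ε-down k (ℕ.<-trans t<n n<2n))

  -- Commutation with the infinite dihedral group generated by z ↦ -z and z ↦ z + N. It holds for w,
  -- its inverse and all generators alike, and it reduces an equality of maps to the labels 1, ...,
  -- n.
  record Equivariant (t : ℤ → ℤ) : Set where
    field
      shift : ∀ c z → t (z ℤ.+ c ℤ.* N) ≡ t z ℤ.+ c ℤ.* N
      neg   : ∀ z → t (ℤ.- z) ≡ ℤ.- t z

    zero-fixed : t (+ 0) ≡ + 0
    zero-fixed = h (t (+ 0)) (neg (+ 0))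
      where
      h : ∀ x → x ≡ ℤ.- x → x ≡ + 0
      h (+ 0) _ = refl

    mult-fixed : ∀ k → t (k ℤ.* N) ≡ k ℤ.* N
    mult-fixed k = trans (cong t (sym (ℤ.+-identityˡ (k ℤ.* N))))
      (trans (shift k (+ 0)) (trans (cong (ℤ._+ k ℤ.* N) zero-fixed) (ℤ.+-identityˡ (k ℤ.* N))))

    reflect : ∀ c z → t (ℤ.- z ℤ.+ c ℤ.* N) ≡ ℤ.- t z ℤ.+ c ℤ.* N
    reflect c z = trans (shift c (ℤ.- z)) (cong (ℤ._+ c ℤ.* N) (neg z))

  open Equivariant

  ∘-equivariant : ∀ {t u} → Equivariant t → Equivariant u → Equivariant (t ∘ u)
  ∘-equivariant {t} {u} E F = record
    { shift = λ c z → trans (cong t (shift F c z)) (shift E c (u z))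
    ; neg   = λ z → trans (cong t (neg F z)) (neg E (u z)) }

  equivariant-≗ : ∀ {t u} → Equivariant t → Equivariant u → (∀ r → r < n → t (+ suc r) ≡ u (+ suc r)) → t ≗ u
  equivariant-≗ {t} {u} E F e z with reduced z
  ... | mult k refl = trans (mult-fixed E k) (sym (mult-fixed F k))
  ... | above k r r<n refl = trans (shift E k (+ suc r)) (trans (cong (ℤ._+ k ℤ.* N) (e r r<n)) (sym (shift F k (+ suc r))))
  ... | below k r r<n refl = trans (reflect E k (+ suc r)) (trans (cong (λ x → ℤ.- x ℤ.+ k ℤ.* N) (e r r<n)) (sym (reflect F k (+ suc r))))

  extend-equivariant : ∀ g → Equivariant (extend g)
  extend-equivariant g = record { shift = sh ; neg = ng }
    where
    h : ∀ x k c N → (x ℤ.+ k ℤ.* N) ℤ.+ c ℤ.* N ≡ x ℤ.+ (k ℤ.+ c) ℤ.* N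
    h = solve-∀
    h₀ : ∀ k c N → k ℤ.* N ℤ.+ c ℤ.* N ≡ (k ℤ.+ c) ℤ.* N
    h₀ = solve-∀
    sh : ∀ c z → extend g (z ℤ.+ c ℤ.* N) ≡ extend g z ℤ.+ c ℤ.* N
    sh c z with reduced z
    ... | mult k refl = trans (cong (extend g) (h₀ k c N)) (trans (extend-0 g (k ℤ.+ c))
            (trans (sym (h₀ k c N)) (cong (ℤ._+ c ℤ.* N) (sym (extend-0 g k)))))
    ... | above k r r<n refl = trans (cong (extend g) (h (+ suc r) k c N)) (trans (extend-up g (k ℤ.+ c) r r<n)
            (trans (sym (h (g (suc r)) k c N)) (cong (ℤ._+ c ℤ.* N) (sym (extend-up g k r r<n)))))
    ... | below k r r<n refl = trans (cong (extend g) (h (ℤ.- + suc r) k c N)) (trans (extend-down g (k ℤ.+ c) r r<n)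
            (trans (sym (h (ℤ.- g (suc r)) k c N)) (cong (ℤ._+ c ℤ.* N) (sym (extend-down g k r r<n)))))
    m₁ : ∀ x k N → ℤ.- (x ℤ.+ k ℤ.* N) ≡ ℤ.- x ℤ.+ (ℤ.- k) ℤ.* N
    m₁ = solve-∀
    m₂ : ∀ x k N → ℤ.- (ℤ.- x ℤ.+ k ℤ.* N) ≡ x ℤ.+ (ℤ.- k) ℤ.* N
    m₂ = solve-∀
    ng : ∀ z → extend g (ℤ.- z) ≡ ℤ.- extend g z
    ng z with reduced z
    ... | mult k refl = trans (cong (extend g) (ℤ.neg-distribˡ-* k N)) (trans (extend-0 g (ℤ.- k))
            (trans (sym (ℤ.neg-distribˡ-* k N)) (cong ℤ.-_ (sym (extend-0 g k)))))
    ... | above k r r<n refl = trans (cong (extend g) (m₁ (+ suc r) k N)) (trans (extend-down g (ℤ.- k) r r<n)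
            (trans (sym (m₁ (g (suc r)) k N)) (cong ℤ.-_ (sym (extend-up g k r r<n)))))
    ... | below k r r<n refl = trans (cong (extend g) (m₂ (+ suc r) k N)) (trans (extend-up g (ℤ.- k) r r<n)
            (trans (sym (m₂ (g (suc r)) k N)) (cong ℤ.-_ (sym (extend-down g k r r<n)))))

  +0* : ∀ x N → x ℤ.+ + 0 ℤ.* N ≡ x
  +0* = solve-∀

  extend-val : ∀ g r → r < n → extend g (+ suc r) ≡ g (suc r)
  extend-val g r r<n = trans (cong (extend g) (sym (+0* (+ suc r) N)))
    (trans (extend-up g (+ 0) r r<n) (+0* (g (suc r)) N))

  gC : ℕ → ℕ → ℤ
  gC i = if i ≡ᵇ 0 then s₀ variantC else if i ≡ᵇ n then sₙ variantC
         else +_ [ i ↦ + suc i ] [ suc i ↦ + i ]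

  -- The generators of C̃ₙ: sC i exchanges the adjacent positions d - 1 and d
  -- whenever d has folded residue i.
  abstract
    sC : ℕ → ℤ → ℤ
    sC i = extend (gC i)

    sC-def : ∀ i → sC i ≡ extend (gC i)
    sC-def i = refl

  gC-self : ∀ i → gC (suc i) (suc i) ≡ + suc (suc i)
  gC-self i with suc i ≡ᵇ n in eq
  ... | true = trans (↦-same +_ {n} (+ (n + 1)) i≡n) (cong +_ (trans (ℕ.+-comm n 1) (cong suc (sym i≡n))))
    where i≡n = ℕ.≡ᵇ⇒≡ (suc i) n (subst T (sym eq) _)
  ... | false = trans (↦-other (+_ [ suc i ↦ + suc (suc i) ]) {suc (suc i)} (+ suc i) (ℕ.<⇒≢ ℕ.≤-refl))
                      (↦-same +_ {suc i} (+ suc (suc i)) refl)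

  gC-next : ∀ i → suc i < n → gC (suc i) (suc (suc i)) ≡ + suc i
  gC-next i i<n rewrite ≡ᵇ-false (ℕ.<⇒≢ i<n) = ↦-same (+_ [ suc i ↦ + suc (suc i) ]) {suc (suc i)} (+ suc i) refl

  gC-fix : ∀ i r → suc r ≢ i → r ≢ i → gC i (suc r) ≡ + suc r
  gC-fix zero r _ r≢0 = ↦-other +_ {1} (ℤ.- + 1) (r≢0 ∘ ℕ.suc-injective)
  gC-fix (suc i) r p q with suc i ≡ᵇ n in eq
  ... | true = ↦-other +_ {n} (+ (n + 1)) (λ e → p (trans e (sym i≡n)))
    where i≡n = ℕ.≡ᵇ⇒≡ (suc i) n (subst T (sym eq) _)
  ... | false = trans (↦-other (+_ [ suc i ↦ + suc (suc i) ]) {suc (suc i)} (+ suc i) (q ∘ ℕ.suc-injective))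
                      (↦-other +_ {suc i} (+ suc (suc i)) p)

  abstract
    sC-equivariant : ∀ i → Equivariant (sC i)
    sC-equivariant i = extend-equivariant (gC i)

    private
      <2n : ∀ {t} → t < n → t < 2 * n
      <2n t<n = ℕ.<-trans t<n n<2n

      sC-εup : ∀ i k t → t < n → sC i (ε (+ t ℤ.+ k ℤ.* P)) ≡ gC i (suc t) ℤ.+ (+ 1 ℤ.+ k) ℤ.* N
      sC-εup i k t t<n = trans (cong (sC i) (ε-up k (<2n t<n))) (extend-up (gC i) (+ 1 ℤ.+ k) t t<n)
      sC-εdown : ∀ i k t → t < n → sC i (ε (ℤ.- + suc t ℤ.+ k ℤ.* P)) ≡ ℤ.- gC i (suc t) ℤ.+ (+ 1 ℤ.+ k) ℤ.* N
      sC-εdown i k t t<n = trans (cong (sC i) (ε-down k (<2n t<n))) (extend-down (gC i) (+ 1 ℤ.+ k) t t<n)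

    sC-up : ∀ i d → fr (+ 1 ℤ.+ d) ≡ i → sC i (ε d) ≡ ε (+ 1 ℤ.+ d)
    sC-up i d e with view d
    sC-up i d e | up k t t<n refl with trans (sym e) (trans (cong fr (+1-up (+ t) (k ℤ.* P))) (fr-up k t<n))
    ... | refl = trans (sC-εup (suc t) k t t<n) (trans (cong (ℤ._+ (+ 1 ℤ.+ k) ℤ.* N) (gC-self t))
                   (sym (trans (cong ε (+1-up (+ t) (k ℤ.* P))) (ε-up k (ℕ.≤-<-trans t<n n<2n)))))
    sC-up i d e | down k t t<n refl with trans (sym e) (trans (cong fr (+1-down (+ t) (k ℤ.* P))) (fr-down k (ℕ.<⇒≤ t<n)))
    sC-up i d e | down k zero t<n refl | refl = trans (sC-εdown 0 k 0 t<n)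
                   (sym (trans (cong ε (+1-down (+ 0) (k ℤ.* P))) (ε-up k (<2n 0<n))))
    sC-up i d e | down k (suc t) t<n refl | refl = trans (sC-εdown (suc t) k (suc t) t<n)
                   (trans (cong (λ x → ℤ.- x ℤ.+ (+ 1 ℤ.+ k) ℤ.* N) (gC-next t t<n))
                   (sym (trans (cong ε (+1-down (+ suc t) (k ℤ.* P))) (ε-down k (<2n (ℕ.<⇒≤ t<n))))))

    sC-down : ∀ i d → fr d ≡ i → sC i (ε d) ≡ ε (ℤ.- + 1 ℤ.+ d)
    sC-down i d e with view d
    sC-down i d e | up k t t<n refl with trans (sym e) (fr-up k (ℕ.<⇒≤ t<n))
    sC-down i d e | up k zero t<n refl | refl = trans (sC-εup 0 k 0 t<n)
                   (sym (trans (cong ε (-1-down (+ 0) (k ℤ.* P))) (ε-down k (<2n 0<n))))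
    sC-down i d e | up k (suc t) t<n refl | refl = trans (sC-εup (suc t) k (suc t) t<n)
                   (trans (cong (ℤ._+ (+ 1 ℤ.+ k) ℤ.* N) (gC-next t t<n))
                   (sym (trans (cong ε (-1-up (+ t) (k ℤ.* P))) (ε-up k (<2n (ℕ.<⇒≤ t<n))))))
    sC-down i d e | down k t t<n refl with trans (sym e) (fr-down k t<n)
    ... | refl = trans (sC-εdown (suc t) k t t<n) (trans (cong (λ x → ℤ.- x ℤ.+ (+ 1 ℤ.+ k) ℤ.* N) (gC-self t))
                   (sym (trans (cong ε (-1-down (+ suc t) (k ℤ.* P))) (ε-down k (ℕ.≤-<-trans t<n n<2n)))))

    sC-fix : ∀ i d → fr d ≢ i → fr (+ 1 ℤ.+ d) ≢ i → sC i (ε d) ≡ ε d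
    sC-fix i d p q with view d
    ... | up k t t<n refl = trans (sC-εup i k t t<n) (trans (cong (ℤ._+ (+ 1 ℤ.+ k) ℤ.* N)
            (gC-fix i t (q ∘ trans (trans (cong fr (+1-up (+ t) (k ℤ.* P))) (fr-up k t<n)))
                        (p ∘ trans (fr-up k (ℕ.<⇒≤ t<n)))))
            (sym (ε-up k (<2n t<n))))
    ... | down k t t<n refl = trans (sC-εdown i k t t<n) (trans (cong (λ x → ℤ.- x ℤ.+ (+ 1 ℤ.+ k) ℤ.* N)
            (gC-fix i t (p ∘ trans (fr-down k t<n))
                        (q ∘ trans (trans (cong fr (+1-down (+ t) (k ℤ.* P))) (fr-down k (ℕ.<⇒≤ t<n))))))
            (sym (ε-down k (<2n t<n))))

  abstract
    sC-involutive : ∀ i z → sC i (sC i z) ≡ z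
    sC-involutive i z with label z
    ... | multiple k refl = trans (cong (sC i) (extend-0 (gC i) k)) (extend-0 (gC i) k)
    ... | entry d refl with fr d ≟ i | fr (+ 1 ℤ.+ d) ≟ i
    ...   | yes p | _ = trans (cong (sC i) (sC-down i d p)) (trans (sC-up i (ℤ.- + 1 ℤ.+ d) (trans (cong fr (suc-pred d)) p)) (cong ε (suc-pred d)))
    ...   | no _  | yes q = trans (cong (sC i) (sC-up i d q)) (trans (sC-down i (+ 1 ℤ.+ d) q) (cong ε (pred-suc d)))
    ...   | no p  | no q = trans (cong (sC i) (sC-fix i d p q)) (sC-fix i d p q)

    sC-val : ∀ i r → r < n → sC i (+ suc r) ≡ gC i (suc r)
    sC-val i = extend-val (gC i)

  infix 4 _~_
  -- The orbit of p under the dihedral group with which equivariant maps commute.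
  data _~_ (p z : ℤ) : Set where
    straight : ∀ k → z ≡ p ℤ.+ k ℤ.* N → p ~ z
    mirrored : ∀ k → z ≡ ℤ.- p ℤ.+ k ℤ.* N → p ~ z

  ~-sym : ∀ {p z} → p ~ z → z ~ p
  ~-sym {p} (straight k refl) = straight (ℤ.- k) (h p k N)
    where
    h : ∀ p k N → p ≡ p ℤ.+ k ℤ.* N ℤ.+ (ℤ.- k) ℤ.* N
    h = solve-∀
  ~-sym {p} (mirrored k refl) = mirrored (k) (h p k N)
    where
    h : ∀ p k N → p ≡ ℤ.- (ℤ.- p ℤ.+ k ℤ.* N) ℤ.+ k ℤ.* N
    h = solve-∀

  ~-trans : ∀ {p z y} → p ~ z → z ~ y → p ~ y
  ~-trans {p} (straight k refl) (straight l refl) = straight (k ℤ.+ l) (h p k l N)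
    where
    h : ∀ p k l N → p ℤ.+ k ℤ.* N ℤ.+ l ℤ.* N ≡ p ℤ.+ (k ℤ.+ l) ℤ.* N
    h = solve-∀
  ~-trans {p} (straight k refl) (mirrored l refl) = mirrored (l ℤ.- k) (h p k l N)
    where
    h : ∀ p k l N → ℤ.- (p ℤ.+ k ℤ.* N) ℤ.+ l ℤ.* N ≡ ℤ.- p ℤ.+ (l ℤ.- k) ℤ.* N
    h = solve-∀
  ~-trans {p} (mirrored k refl) (straight l refl) = mirrored (k ℤ.+ l) (h p k l N)
    where
    h : ∀ p k l N → ℤ.- p ℤ.+ k ℤ.* N ℤ.+ l ℤ.* N ≡ ℤ.- p ℤ.+ (k ℤ.+ l) ℤ.* N
    h = solve-∀
  ~-trans {p} (mirrored k refl) (mirrored l refl) = straight (l ℤ.- k) (h p k l N)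
    where
    h : ∀ p k l N → ℤ.- (ℤ.- p ℤ.+ k ℤ.* N) ℤ.+ l ℤ.* N ≡ p ℤ.+ (l ℤ.- k) ℤ.* N
    h = solve-∀

  ~-map : ∀ {t p z} → Equivariant t → p ~ z → t p ~ t z
  ~-map {p = p} E (straight k refl) = straight (k) (shift E k p)
  ~-map {p = p} E (mirrored k refl) = mirrored (k) (reflect E k p)

  ~-agree : ∀ {t u p z} → Equivariant t → Equivariant u → t p ≡ u p → p ~ z → t z ≡ u z
  ~-agree {p = p} E F e (straight k refl) = trans (shift E k p) (trans (cong (ℤ._+ k ℤ.* N) e) (sym (shift F k p)))
  ~-agree {p = p} E F e (mirrored k refl) = trans (reflect E k p) (trans (cong (λ x → ℤ.- x ℤ.+ k ℤ.* N) e) (sym (reflect F k p)))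

  -- Stands in for the group-theoretic notion of a reflection: generators and their conjugates
  -- satisfy it, and the value at p alone determines such a map, by `reflection-unique`.
  record Reflection (t : ℤ → ℤ) (p : ℤ) : Set where
    field
      equivariant : Equivariant t
      involutive  : ∀ z → t (t z) ≡ z
      moves       : ∀ z → t z ≡ z ⊎ p ~ z ⊎ t p ~ z

  open Reflection

  reflection-resp : ∀ {t u p} → t ≗ u → Reflection t p → Reflection u p
  reflection-resp {t} {u} {p} e R = record
    { equivariant = record
        { shift = λ c z → trans (sym (e _)) (trans (shift (equivariant R) c z) (cong (ℤ._+ c ℤ.* N) (e z)))
        ; neg = λ z → trans (sym (e _)) (trans (neg (equivariant R) z) (cong ℤ.-_ (e z))) }
    ; involutive = λ z → trans (cong u (sym (e z))) (trans (sym (e (t z))) (involutive R z))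
    ; moves = λ z → [ (λ f → inj₁ (trans (sym (e z)) f)) , [ (λ q → inj₂ (inj₁ q)) , (λ q → inj₂ (inj₂ (subst (_~ z) (e p) q))) ]′ ]′ (moves R z) }

  -- A moved point x lies in the orbit of p or of t p. Applying t puts t x into the other one, so x
  -- can take over the role of p.
  reflection-at : ∀ {t p} x → Reflection t p → t x ≢ x → Reflection t x
  reflection-at {t} {p} x R tx≢x with moves R x
  ... | inj₁ e = contradiction e tx≢x
  ... | inj₂ (inj₁ p~x) = record
    { equivariant = equivariant R ; involutive = involutive R
    ; moves = λ z → [ inj₁ , [ (λ q → inj₂ (inj₁ (~-trans (~-sym p~x) q)))
                             , (λ q → inj₂ (inj₂ (~-trans (~-map (equivariant R) (~-sym p~x)) q))) ]′ ]′ (moves R z) }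
  ... | inj₂ (inj₂ tp~x) = record
    { equivariant = equivariant R ; involutive = involutive R
    ; moves = λ z → [ inj₁ , [ (λ q → inj₂ (inj₂ (~-trans (subst (t x ~_) (involutive R p) (~-map (equivariant R) (~-sym tp~x))) q)))
                             , (λ q → inj₂ (inj₁ (~-trans (~-sym tp~x) q))) ]′ ]′ (moves R z) }

  -- Agreement at p spreads along the orbit of p and, by involutivity, along that of t p = u p;
  -- elsewhere both maps are the identity.
  reflection-unique : ∀ {t u p} → Reflection t p → Reflection u p → t p ≡ u p → t ≗ u
  reflection-unique {t} {u} {p} R S e z with moves R z
  ... | inj₂ (inj₁ q) = ~-agree (equivariant R) (equivariant S) e q
  ... | inj₂ (inj₂ q) = ~-agree (equivariant R) (equivariant S) tp q
    where
    tp : t (t p) ≡ u (t p)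
    tp = trans (involutive R p) (sym (trans (cong u e) (involutive S p)))
  ... | inj₁ tz≡z with moves S z
  ...   | inj₁ uz≡z = trans tz≡z (sym uz≡z)
  ...   | inj₂ (inj₁ q) = ~-agree (equivariant R) (equivariant S) e q
  ...   | inj₂ (inj₂ q) = ~-agree (equivariant R) (equivariant S) tup q
    where
    tup : t (u p) ≡ u (u p)
    tup = trans (cong t (sym e)) (trans (involutive R p) (sym (involutive S p)))

  reflection-conj : ∀ {t u p} → Equivariant u → (∀ z → u (u z) ≡ z) → Reflection t p → Reflection (u ∘ t ∘ u) (u p)
  reflection-conj {t} {u} {p} E inv R = record
    { equivariant = ∘-equivariant E (∘-equivariant (equivariant R) E)
    ; involutive = λ z → trans (cong (u ∘ t) (inv (t (u z)))) (trans (cong u (involutive R (u z))) (inv z))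
    ; moves = λ z → [ (λ f → inj₁ (trans (cong u f) (inv z)))
                    , [ (λ q → inj₂ (inj₁ (subst (u p ~_) (inv z) (~-map E q))))
                      , (λ q → inj₂ (inj₂ (subst₂ _~_ (cong (u ∘ t) (sym (inv p))) (inv z) (~-map E q)))) ]′ ]′ (moves R (u z)) }

  -- A label that `sC i` moves: 1 goes to -1 under index 0, and i goes to i + 1 otherwise.
  pivot : ℕ → ℤ
  pivot zero    = + 1
  pivot (suc i) = + suc i

  abstract
    sC-reflection : ∀ i → i ≤ n → Reflection (sC i) (pivot i)
    sC-reflection i i≤n = record { equivariant = sC-equivariant i ; involutive = sC-involutive i ; moves = mv }
      where
      case : ∀ r → r < n → gC i (suc r) ≡ + suc r ⊎ pivot i ≡ + suc r ⊎ sC i (pivot i) ≡ + suc r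
      case r r<n with suc r ≟ i | r ≟ i
      ... | yes refl | _ = inj₂ (inj₁ refl)
      ... | no p | no q = inj₁ (gC-fix i r p q)
      case zero r<n | no p | yes refl = inj₂ (inj₁ refl)
      case (suc r) r<n | no p | yes refl = inj₂ (inj₂ (trans (extend-val (gC (suc r)) r (ℕ.<⇒≤ r<n)) (gC-self r)))
      mv : ∀ z → sC i z ≡ z ⊎ pivot i ~ z ⊎ sC i (pivot i) ~ z
      mv z with reduced z
      ... | mult k refl = inj₁ (extend-0 (gC i) k)
      ... | above k r r<n refl with case r r<n
      ...   | inj₁ e = inj₁ (trans (extend-up (gC i) k r r<n) (cong (ℤ._+ k ℤ.* N) e))
      ...   | inj₂ (inj₁ e) = inj₂ (inj₁ (straight k (cong (ℤ._+ k ℤ.* N) (sym e))))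
      ...   | inj₂ (inj₂ e) = inj₂ (inj₂ (straight k (cong (ℤ._+ k ℤ.* N) (sym e))))
      mv z | below k r r<n refl with case r r<n
      ...   | inj₁ e = inj₁ (trans (extend-down (gC i) k r r<n) (cong (λ x → ℤ.- x ℤ.+ k ℤ.* N) e))
      ...   | inj₂ (inj₁ e) = inj₂ (inj₁ (mirrored k (cong (λ x → ℤ.- x ℤ.+ k ℤ.* N) (sym e))))
      ...   | inj₂ (inj₂ e) = inj₂ (inj₂ (mirrored k (cong (λ x → ℤ.- x ℤ.+ k ℤ.* N) (sym e))))

  -- The pairs (A , B) such that s_B is the D-variant, which exchanges the
  -- positions D - 2, D - 1 with D, D + 1 for every content D of folded residue
  -- B; A is the folded residue next to B.
  data Special : ℕ → ℕ → Set where
    bottom : variant₀ X ≡ variantD → Special 1 0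
    top    : ∀ A → suc A ≡ n → variantₙ X ≡ variantD → Special A n

  sD : ℕ → ℕ → ℤ → ℤ
  sD A B = sC B ∘ sC A ∘ sC B

  data Kind (i : ℕ) (f : ℤ → ℤ) : Set where
    adjacent : f ≗ sC i → (∀ A → ¬ Special A i) → Kind i f
    double   : ∀ A → Special A i → f ≗ sD A i → Kind i f

  private
    gen : ℕ → ℕ → ℤ
    gen i = if i ≡ᵇ 0 then s₀ (variant₀ X) else if i ≡ᵇ n then sₙ (variantₙ X)
            else +_ [ i ↦ + suc i ] [ suc i ↦ + i ]

  module _ (2≤n : 2 ≤ n) where
    private
      n≢0 : n ≢ 0
      n≢0 e with () ← ℕ.n≮0 (subst (2 ≤_) e 2≤n)

      val : ∀ i r → r < n → sC i (+ suc r) ≡ gC i (suc r)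
      val = sC-val
      -val : ∀ i r {x} → r < n → gC i (suc r) ≡ x → sC i (ℤ.- + suc r) ≡ ℤ.- x
      -val i r r<n e = trans (neg (sC-equivariant i) (+ suc r)) (cong ℤ.-_ (trans (val i r r<n) e))

    -- By equivariance it suffices to follow the labels 1, ..., n. The three factors take 1 through
    -- -1 and -2 to -2, and 2 through 2 and 1 to -1; the other labels stay fixed.
    s₀D≗ : extend (s₀ variantD) ≗ sD 1 0
    s₀D≗ = equivariant-≗ (extend-equivariant (s₀ variantD))
      (∘-equivariant (sC-equivariant 0) (∘-equivariant (sC-equivariant 1) (sC-equivariant 0)))
      (λ r r<n → trans (extend-val (s₀ variantD) r r<n) (sym (go r r<n)))
      where
      go : ∀ r → r < n → sD 1 0 (+ suc r) ≡ s₀ variantD (suc r)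
      go 0 r<n = trans (cong (sC 0 ∘ sC 1) (val 0 0 r<n)) (trans (cong (sC 0) (-val 1 0 r<n (gC-self 0)))
                   (-val 0 1 2≤n refl))
      go 1 r<n = trans (cong (sC 0 ∘ sC 1) (val 0 1 r<n)) (trans (cong (sC 0) (trans (val 1 1 r<n) (gC-next 0 2≤n)))
                   (val 0 0 0<n))
      go (suc (suc r)) r<n = trans (cong (sC 0 ∘ sC 1) (val 0 (suc (suc r)) r<n))
        (trans (cong (sC 0) (trans (val 1 (suc (suc r)) r<n) (gC-fix 1 (suc (suc r)) (λ ()) (λ ()))))
          (val 0 (suc (suc r)) r<n))

    sₙD≗ : ∀ a → suc a ≡ n → extend (sₙ variantD) ≗ sD a n
    sₙD≗ zero e = contradiction 2≤n (subst (λ m → ¬ (2 ≤ m)) e λ { (s≤s ()) })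
    sₙD≗ (suc a) e = equivariant-≗ (extend-equivariant (sₙ variantD))
      (∘-equivariant (sC-equivariant n) (∘-equivariant (sC-equivariant (suc a)) (sC-equivariant n)))
      (λ r r<n → trans (extend-val (sₙ variantD) r r<n) (sym (go r r<n)))
      where
      n-1 : n ∸ 1 ≡ suc a
      n-1 = cong (_∸ 1) (sym e)
      gCn : gC n n ≡ + suc n
      gCn = subst (λ m → gC m m ≡ + suc m) e (gC-self (suc a))
      1+a<n : suc a < n
      1+a<n = ℕ.≤-reflexive e
      a<n : a < n
      a<n = ℕ.<⇒≤ 1+a<n
      -- Labels above n are followed through reflection: n + 1 = N - n and n + 2 = N - (n - 1).
      bar : ∀ i r {x} → r < n → gC i (suc r) ≡ x → sC i (N ℤ.- + suc r) ≡ N ℤ.- x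
      bar i r {x} r<n p = trans (cong (sC i) (h (+ suc r) N)) (trans (reflect (sC-equivariant i) (+ 1) (+ suc r))
          (trans (cong (λ y → ℤ.- y ℤ.+ + 1 ℤ.* N) (trans (val i r r<n) p)) (sym (h x N))))
        where
        h : ∀ x N → N ℤ.- x ≡ ℤ.- x ℤ.+ + 1 ℤ.* N
        h = solve-∀
      2n≡ : + suc n ≡ N ℤ.- + suc (suc a)
      2n≡ = trans (h (+ n)) (cong₂ (λ p q → + 1 ℤ.+ p ℤ.- q) (sym P≡) (cong +_ (sym e)))
        where
        h : ∀ m → + 1 ℤ.+ m ≡ + 1 ℤ.+ (m ℤ.+ m) ℤ.- m
        h = solve-∀
      2n≡′ : N ℤ.- + suc a ≡ + (n + 2)
      2n≡′ = trans (h N (+ suc a)) (trans (cong (λ x → + 1 ℤ.+ x) (sym 2n≡)) (cong +_ (ℕ.+-comm 2 n)))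
        where
        h : ∀ N x → N ℤ.- x ≡ + 1 ℤ.+ (N ℤ.- (+ 1 ℤ.+ x))
        h = solve-∀
      go : ∀ r → r < n → sD (suc a) n (+ suc r) ≡ sₙ variantD (suc r)
      go r r<n with suc r ≟ n | suc r ≟ n ∸ 1
      ... | yes p | _ rewrite ↦-same (+_ [ n ∸ 1 ↦ + (n + 1) ]) (+ (n + 2)) p =
        trans (cong (sC n ∘ sC (suc a)) (trans (cong (sC n) (cong +_ (trans p (sym e)))) (trans (val n (suc a) 1+a<n) (trans (cong (gC n) e) (trans gCn 2n≡)))))
          (trans (cong (sC n) (bar (suc a) (suc a) 1+a<n (gC-next a 1+a<n))) (trans (bar n a a<n (gC-fix n a (ℕ.<⇒≢ 1+a<n) (ℕ.<⇒≢ a<n))) 2n≡′))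
      ... | no p | yes q rewrite ↦-other (+_ [ n ∸ 1 ↦ + (n + 1) ]) (+ (n + 2)) p | ↦-same +_ (+ (n + 1)) q =
        trans (cong (sC n ∘ sC (suc a)) (trans (val n r r<n) (trans (gC-fix n r p (ℕ.<⇒≢ r<n)) (cong +_ 1+r))))
          (trans (cong (sC n) (trans (val (suc a) a a<n) (gC-self a))) (trans (val n (suc a) 1+a<n) (trans (cong (gC n) e) (trans gCn (cong +_ (ℕ.+-comm 1 n))))))
        where 1+r = trans q n-1
      ... | no p | no q rewrite ↦-other (+_ [ n ∸ 1 ↦ + (n + 1) ]) (+ (n + 2)) p | ↦-other +_ (+ (n + 1)) q =
        trans (cong (sC n ∘ sC (suc a)) val′) (trans (cong (sC n) val″) val′)
        where
        val′ = trans (val n r r<n) (gC-fix n r p (ℕ.<⇒≢ r<n))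
        val″ = trans (val (suc a) r r<n) (gC-fix (suc a) r (λ x → q (trans x (sym n-1))) (λ x → p (trans (cong suc x) e)))

    private
      gen-n : gen n ≡ sₙ (variantₙ X)
      gen-n rewrite ≡ᵇ-false n≢0 | ≡ᵇ-true {n} refl = refl

      gC-n : gC n ≡ sₙ variantC
      gC-n rewrite ≡ᵇ-false n≢0 | ≡ᵇ-true {n} refl = refl

      gen-inner : ∀ i → i ≢ 0 → i ≢ n → gen i ≡ gC i
      gen-inner i p q rewrite ≡ᵇ-false p | ≡ᵇ-false q = refl

      not-special : ∀ i → (i ≡ 0 → variant₀ X ≡ variantC) → (i ≡ n → variantₙ X ≡ variantC) → ∀ A → ¬ Special A i
      not-special .0 p q .1 (bottom v) with () ← trans (sym v) (p refl)
      not-special i p q A (top .A _ v) with () ← trans (sym v) (q refl)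

      kind₀ : ∀ v → variant₀ X ≡ v → Kind 0 (extend (gen 0))
      kind₀ variantC v = adjacent (λ z → trans (cong (λ u → extend (s₀ u) z) v) (cong (λ f → f z) (sym (sC-def 0)))) (not-special 0 (λ _ → v) (λ e → contradiction (sym e) n≢0))
      kind₀ variantD v = double 1 (bottom v) (λ z → trans (cong (λ u → extend (s₀ u) z) v) (s₀D≗ z))

      kindₙ : ∀ v → variantₙ X ≡ v → Kind n (extend (gen n))
      kindₙ variantC v = adjacent (λ z → trans (cong (λ g → extend g z) (trans gen-n (trans (cong sₙ v) (sym gC-n)))) (cong (λ f → f z) (sym (sC-def n))))
        (not-special n (λ e → contradiction e n≢0) (λ _ → v))
      kindₙ variantD v = double (n ∸ 1) (top (n ∸ 1) e v)
        (λ z → trans (cong (λ g → extend g z) (trans gen-n (cong sₙ v))) (sₙD≗ (n ∸ 1) e z))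
        where e = ℕ.m+[n∸m]≡n 0<n

    kindℕ : ∀ i → Kind i (extend (gen i))
    kindℕ i with i ≟ 0 | i ≟ n
    ... | yes refl | _ = kind₀ (variant₀ X) refl
    ... | no p | yes refl = kindₙ (variantₙ X) refl
    ... | no p | no q = adjacent (λ z → trans (cong (λ g → extend g z) (gen-inner i p q)) (cong (λ f → f z) (sym (sC-def i))))
            (not-special i (λ e → contradiction e p) (λ e → contradiction e q))

    kind : (i : Fin (suc n)) → Kind (toℕ i) (s i)
    kind i = kindℕ (toℕ i)

2x≢1+2y : ∀ x y → x ℤ.+ x ≢ + 1 ℤ.+ (y ℤ.+ y)
2x≢1+2y x y e = 0≢1 (proj₁ (euclid-unique 2 0 1 x y z<s (s≤s z<s) (trans (h₀ x) (trans e (h₁ y)))))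
  where
  0≢1 : 0 ≢ 1
  0≢1 ()
  h₀ : ∀ x → + 0 ℤ.+ x ℤ.* + 2 ≡ x ℤ.+ x
  h₀ = solve-∀
  h₁ : ∀ y → + 1 ℤ.+ (y ℤ.+ y) ≡ + 1 ℤ.+ y ℤ.* + 2
  h₁ = solve-∀

-- Positions around the centres of a D-variant.

module Lengths (X : QuotientType) (n : ℕ) .{{_ : NonZero n}} (rank : minRank X ≤ n) where
  open Quotient X n renaming (N to Nℕ)
  open Index n
  open Generators X n
  open Equivariant
  open Reflection

  2≤n : 2 ≤ n
  2≤n = ℕ.≤-trans (h X) rank
    where
    h : ∀ X → 2 ≤ minRank X
    h C̃/C = ℕ.≤-refl
    h B̃/B = ℕ.n≤1+n 2
    h B̃/D = ℕ.n≤1+n 2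
    h D̃/D = s≤s (s≤s z≤n)

  special⇒3≤n : ∀ {A B} → Special A B → 3 ≤ n
  special⇒3≤n sp = ℕ.≤-trans (h X (v X sp)) rank
    where
    v : ∀ X {A B} → Generators.Special X n A B → variant₀ X ≡ variantD ⊎ variantₙ X ≡ variantD
    v X (Generators.bottom e) = inj₁ e
    v X (Generators.top _ _ e) = inj₂ e
    h : ∀ X → variant₀ X ≡ variantD ⊎ variantₙ X ≡ variantD → 3 ≤ minRank X
    h C̃/C (inj₁ ())
    h C̃/C (inj₂ ())
    h B̃/B _ = ℕ.≤-refl
    h B̃/D _ = ℕ.≤-refl
    h D̃/D _ = ℕ.n≤1+n 3

  -- For (1, 0) this is n ≥ 2, and for (n - 1, n) the rank bound makes n - 1 positive. So A is no
  -- turning point of the folded residue.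
  special-inner : ∀ {A B} → Special A B → ∃[ t ] A ≡ suc t × suc t < n
  special-inner (bottom _) = 0 , refl , 2≤n
  special-inner sp@(top zero e _) with s≤s () ← subst (3 ≤_) (sym e) (special⇒3≤n sp)
  special-inner (top (suc t) e _) = t , refl , ℕ.≤-reflexive e

  special-A≢B : ∀ {A B} → Special A B → A ≢ B
  special-A≢B (bottom _) ()
  special-A≢B (top A e _) A≡n = ℕ.1+n≢n (trans e (sym A≡n))

  special-centre : ∀ {A B} → Special A B → ∀ D → fr D ≡ B → fr (+ 1 ℤ.+ D) ≡ A × fr (ℤ.- + 1 ℤ.+ D) ≡ A
  special-centre (bottom _) D e = fr≡0⇒ D e
  special-centre (top A eA _) D e with fr≡n⇒ D e
  ... | p , q = ℕ.suc-injective (trans p (sym eA)) , ℕ.suc-injective (trans q (sym eA))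

  -- Next to a content of residue A there is a centre on one side, and the other side leaves the
  -- pair. The contents of residue A or B thus fall into separate triples D - 1, D, D + 1.
  special-next : ∀ {A B} → Special A B → ∀ d → fr d ≡ A →
    (fr (+ 1 ℤ.+ d) ≡ B × fr (ℤ.- + 1 ℤ.+ d) ≢ A × fr (ℤ.- + 1 ℤ.+ d) ≢ B)
    ⊎ (fr (ℤ.- + 1 ℤ.+ d) ≡ B × fr (+ 1 ℤ.+ d) ≢ A × fr (+ 1 ℤ.+ d) ≢ B)
  special-next (bottom v) d e with fr-inner d 0 e 2≤n
  ... | inj₁ (p , q) = inj₂ (q , (λ x → case (trans (sym p) x)) , (λ x → case′ (trans (sym p) x)))
    where
    case : 2 ≢ 1
    case ()
    case′ : 2 ≢ 0
    case′ ()
  ... | inj₂ (p , q) = inj₁ (p , (λ x → case (trans (sym q) x)) , (λ x → case′ (trans (sym q) x)))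
    where
    case : 2 ≢ 1
    case ()
    case′ : 2 ≢ 0
    case′ ()
  special-next sp@(top zero eA _) d e with s≤s () ← subst (3 ≤_) (sym eA) (special⇒3≤n sp)
  special-next (top (suc t) eA _) d e with fr-inner d t e (ℕ.≤-reflexive eA)
  ... | inj₁ (p , q) = inj₁ (trans p eA , (λ x → ℕ.1+n≢n (sym (trans (sym q) x))) , (λ x → ℕ.<⇒≢ (ℕ.<⇒≤ (ℕ.≤-reflexive eA)) (trans (sym q) x)))
  ... | inj₂ (p , q) = inj₂ (trans q eA , (λ x → ℕ.1+n≢n (sym (trans (sym p) x))) , (λ x → ℕ.<⇒≢ (ℕ.<⇒≤ (ℕ.≤-reflexive eA)) (trans (sym p) x)))

  -- Centres are multiples of half a period. Hence the reflection of positions about D - 1/2 is the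
  -- mirror of the abacus followed by a shift by whole periods, which equivariant maps respect.
  special-double : ∀ {A B} → Special A B → ∀ D → fr D ≡ B → ∃[ c ] D ℤ.+ D ≡ c ℤ.* P
  special-double (bottom _) D e with fr≡0 D e
  ... | k , refl = k ℤ.+ k , sym (ℤ.*-distribʳ-+ P k k)
  special-double (top A _ _) D e with fr≡n D e
  ... | k , refl = + 1 ℤ.+ (k ℤ.+ k) , trans (h (+ n) k P) (trans (cong (ℤ._+ (k ℤ.+ k) ℤ.* P) (sym P≡)) (h′ k P))
    where
    h : ∀ m k P → (m ℤ.+ k ℤ.* P) ℤ.+ (m ℤ.+ k ℤ.* P) ≡ (m ℤ.+ m) ℤ.+ (k ℤ.+ k) ℤ.* P
    h = solve-∀
    h′ : ∀ k P → P ℤ.+ (k ℤ.+ k) ℤ.* P ≡ (+ 1 ℤ.+ (k ℤ.+ k)) ℤ.* P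
    h′ = solve-∀

  private
    -2+≡ : ∀ D → ℤ.- + 1 ℤ.+ (ℤ.- + 1 ℤ.+ D) ≡ ℤ.- + 2 ℤ.+ D
    -2+≡ = solve-∀
    2+≡ : ∀ D → + 1 ℤ.+ (+ 1 ℤ.+ D) ≡ + 2 ℤ.+ D
    2+≡ = solve-∀
    1-2≡ : ∀ D → + 1 ℤ.+ (ℤ.- + 2 ℤ.+ D) ≡ ℤ.- + 1 ℤ.+ D
    1-2≡ = solve-∀

  module Double {A B} (sp : Special A B) where
    A≢B = special-A≢B sp

    outer₊ : ∀ D → fr D ≡ B → fr (+ 2 ℤ.+ D) ≢ A × fr (+ 2 ℤ.+ D) ≢ B
    outer₊ D e with special-next sp (+ 1 ℤ.+ D) (proj₁ (special-centre sp D e))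
    ... | inj₂ (_ , p , q) = (p ∘ trans (cong fr (2+≡ D))) , (q ∘ trans (cong fr (2+≡ D)))
    ... | inj₁ (_ , _ , q) = contradiction (trans (cong fr (pred-suc D)) e) q

    outer₋ : ∀ D → fr D ≡ B → fr (ℤ.- + 2 ℤ.+ D) ≢ A × fr (ℤ.- + 2 ℤ.+ D) ≢ B
    outer₋ D e with special-next sp (ℤ.- + 1 ℤ.+ D) (proj₂ (special-centre sp D e))
    ... | inj₁ (_ , p , q) = (p ∘ trans (cong fr (-2+≡ D))) , (q ∘ trans (cong fr (-2+≡ D)))
    ... | inj₂ (_ , _ , q) = contradiction (trans (cong fr (suc-pred D)) e) q

    module _ (D : ℤ) (e : fr D ≡ B) where
      private
        frA₊ = proj₁ (special-centre sp D e)
        frA₋ = proj₂ (special-centre sp D e)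
        frO₊ = outer₊ D e
        frO₋ = outer₋ D e

      sD₀ : sD A B (ε (ℤ.- + 2 ℤ.+ D)) ≡ ε D
      sD₀ = trans (cong (sC B ∘ sC A) (sC-fix B _ (proj₂ frO₋) (λ x → A≢B (trans (sym frA₋) (trans (cong fr (sym (1-2≡ D))) x)))))
        (trans (cong (sC B) (trans (sC-up A (ℤ.- + 2 ℤ.+ D) (trans (cong fr (1-2≡ D)) frA₋)) (cong ε (1-2≡ D))))
          (trans (sC-up B (ℤ.- + 1 ℤ.+ D) (trans (cong fr (suc-pred D)) e)) (cong ε (suc-pred D))))

      sD₁ : sD A B (ε (ℤ.- + 1 ℤ.+ D)) ≡ ε (+ 1 ℤ.+ D)
      sD₁ = trans (cong (sC B ∘ sC A) (trans (sC-up B (ℤ.- + 1 ℤ.+ D) (trans (cong fr (suc-pred D)) e)) (cong ε (suc-pred D))))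
        (trans (cong (sC B) (sC-up A D frA₊))
          (sC-fix B (+ 1 ℤ.+ D) (λ x → A≢B (trans (sym frA₊) x)) (proj₂ frO₊ ∘ trans (cong fr (sym (2+≡ D))))))

    sD-involutive : ∀ z → sD A B (sD A B z) ≡ z
    sD-involutive z = trans (cong (sC B ∘ sC A) (sC-involutive B _)) (trans (cong (sC B) (sC-involutive A _)) (sC-involutive B z))

    module _ (D : ℤ) (e : fr D ≡ B) where
      sD₂ : sD A B (ε D) ≡ ε (ℤ.- + 2 ℤ.+ D)
      sD₂ = trans (cong (sD A B) (sym (sD₀ D e))) (sD-involutive _)

      sD₃ : sD A B (ε (+ 1 ℤ.+ D)) ≡ ε (ℤ.- + 1 ℤ.+ D)
      sD₃ = trans (cong (sD A B) (sym (sD₁ D e))) (sD-involutive _)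

    data Position (d : ℤ) : Set where
      pos₀ : ∀ D → fr D ≡ B → d ≡ ℤ.- + 2 ℤ.+ D → Position d
      pos₁ : ∀ D → fr D ≡ B → d ≡ ℤ.- + 1 ℤ.+ D → Position d
      pos₂ : ∀ D → fr D ≡ B → d ≡ D → Position d
      pos₃ : ∀ D → fr D ≡ B → d ≡ + 1 ℤ.+ D → Position d
      still : sD A B (ε d) ≡ ε d → Position d

    position : ∀ d → Position d
    position d with fr d ≟ B | fr (+ 1 ℤ.+ d) ≟ B
    ... | yes p | _ = pos₂ d p refl
    ... | no _  | yes p = pos₁ (+ 1 ℤ.+ d) p (sym (pred-suc d))
    ... | no p  | no q with fr d ≟ A | fr (+ 1 ℤ.+ d) ≟ A
    ...   | yes r | _ with special-next sp d r
    ...     | inj₁ (x , _) = contradiction x q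
    ...     | inj₂ (x , _) = pos₃ (ℤ.- + 1 ℤ.+ d) x (sym (suc-pred d))
    position d | no p | no q | no _ | yes r with special-next sp (+ 1 ℤ.+ d) r
    ...     | inj₁ (x , _) = pos₀ (+ 1 ℤ.+ (+ 1 ℤ.+ d)) x (h d)
      where
      h : ∀ d → d ≡ ℤ.- + 2 ℤ.+ (+ 1 ℤ.+ (+ 1 ℤ.+ d))
      h = solve-∀
    ...     | inj₂ (x , _) = contradiction (trans (cong fr (sym (pred-suc d))) x) p
    position d | no p | no q | no r | no t = still
      (trans (cong (sC B ∘ sC A) (sC-fix B d p q)) (trans (cong (sC B) (sC-fix A d r t)) (sC-fix B d p q)))

-- Pairs of positions inverted by a single generator.

module Exchange (X : QuotientType) (n : ℕ) .{{_ : NonZero n}} (rank : minRank X ≤ n) where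
  open Quotient X n renaming (N to Nℕ)
  open Index n
  open Generators X n
  open Lengths X n rank
  open Equivariant
  open Reflection

  in-range : ∀ {x y} c → x ℤ.≤ y → y ℤ.< + c ℤ.+ x → ∃[ j ] j < c × y ≡ + j ℤ.+ x
  in-range {x} {y} c x≤y y<c+x with ≤⇒∃ x≤y
  ... | j , refl = j , ℤ.drop‿+<+ (<-via y<c+x (h (+ c) x (+ j))) , refl
    where
    h : ∀ c x j → (c ℤ.+ x) ℤ.- (j ℤ.+ x) ≡ c ℤ.- j
    h = solve-∀

  -- The equation excluded here says that p and q are symmetric about D - 1/2, the axis between the
  -- positions D - 1 and D. Pairs with this symmetry can be inverted by a D-variant without being
  -- exchanged.
  Generic : ℤ → ℤ → Set
  Generic p q = ∀ {A B} D → Special A B → fr D ≡ B → + 1 ℤ.+ (p ℤ.+ q) ≢ D ℤ.+ D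

  shift≢ : ∀ {x y} m → x ≡ y → x ℤ.- y ≢ + suc m ℤ.- + 0
  shift≢ m p e with () ← ≡-via {x′ = + suc m} {+ 0} p e

  1+-cancel : ∀ {x y} → + 1 ℤ.+ x ≡ + 1 ℤ.+ y → x ≡ y
  1+-cancel {x} {y} e = ≡-via e (h x y)
    where
    h : ∀ x y → (+ 1 ℤ.+ x) ℤ.- (+ 1 ℤ.+ y) ≡ x ℤ.- y
    h = solve-∀

  sC-near : ∀ i d d′ → sC i (ε d) ≡ ε d′ → ℤ.- + 1 ℤ.+ d ℤ.≤ d′ × d′ ℤ.≤ + 1 ℤ.+ d
  sC-near i d d′ e with fr d ≟ i | fr (+ 1 ℤ.+ d) ≟ i
  ... | yes p | _ with refl ← ε-injective (trans (sym e) (sC-down i d p)) = ℤ.≤-refl , ℤ.+-monoˡ-≤ d ℤ.-≤+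
  ... | no _ | yes p with refl ← ε-injective (trans (sym e) (sC-up i d p)) = ℤ.+-monoˡ-≤ d ℤ.-≤+ , ℤ.≤-refl
  ... | no p | no q with refl ← ε-injective (trans (sym e) (sC-fix i d p q)) = ≤-via {ℤ.- + 1} {+ 0} ℤ.-≤+ (h d) , ≤-via {+ 0} {+ 1} (+≤+ z≤n) (h′ d)
    where
    h : ∀ d → + 0 ℤ.- (ℤ.- + 1) ≡ d ℤ.- (ℤ.- + 1 ℤ.+ d)
    h = solve-∀
    h′ : ∀ d → + 1 ℤ.- + 0 ≡ (+ 1 ℤ.+ d) ℤ.- d
    h′ = solve-∀

  -- Positions move by at most one, so p′ ≤ p + 1 ≤ q ≤ q′ + 1 ≤ p′ and equality holds throughout.
  inversion-adjacent : ∀ i {p q p′ q′} → p ℤ.< q → sC i (ε p) ≡ ε p′ → sC i (ε q) ≡ ε q′ → q′ ℤ.< p′ → p′ ≡ q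
  inversion-adjacent i {p} {q} {p′} {q′} p<q ep eq q′<p′ = ℤ.≤-antisym p′≤q q≤p′
    where
    p′≤q : p′ ℤ.≤ q
    p′≤q = ℤ.≤-trans (proj₂ (sC-near i p p′ ep)) (<⇒1+≤ p<q)
    q≤1+q′ : q ℤ.≤ + 1 ℤ.+ q′
    q≤1+q′ = ≤-via (proj₁ (sC-near i q q′ eq)) (h q q′)
      where
      h : ∀ q q′ → q′ ℤ.- (ℤ.- + 1 ℤ.+ q) ≡ (+ 1 ℤ.+ q′) ℤ.- q
      h = solve-∀
    q≤p′ : q ℤ.≤ p′
    q≤p′ = ℤ.≤-trans q≤1+q′ (<⇒1+≤ q′<p′)

  module _ {A B} (sp : Special A B) where
    open Double sp

    private
      up2 : ∀ d → d ℤ.≤ + 2 ℤ.+ d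
      up2 d = ℤ.i≤j+i d (+ 2)

    sD-down-or-not : ∀ q q′ → sD A B (ε q) ≡ ε q′ →
      q ℤ.≤ q′ ⊎ (∃[ D ] fr D ≡ B × (q ≡ D ⊎ q ≡ + 1 ℤ.+ D) × q′ ≡ ℤ.- + 2 ℤ.+ q)
    sD-down-or-not q q′ e with position q
    ... | still f with refl ← ε-injective (trans (sym e) f) = inj₁ ℤ.≤-refl
    ... | pos₀ D f refl with refl ← ε-injective (trans (sym e) (sD₀ D f)) = inj₁ (≤-via (up2 D) (h D))
      where
      h : ∀ D → (+ 2 ℤ.+ D) ℤ.- D ≡ D ℤ.- (ℤ.- + 2 ℤ.+ D)
      h = solve-∀
    ... | pos₁ D f refl with refl ← ε-injective (trans (sym e) (sD₁ D f)) = inj₁ (≤-via (up2 D) (h D))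
      where
      h : ∀ D → (+ 2 ℤ.+ D) ℤ.- D ≡ (+ 1 ℤ.+ D) ℤ.- (ℤ.- + 1 ℤ.+ D)
      h = solve-∀
    ... | pos₂ D f refl with refl ← ε-injective (trans (sym e) (sD₂ D f)) = inj₂ (D , f , inj₁ refl , refl)
    ... | pos₃ D f refl with refl ← ε-injective (trans (sym e) (sD₃ D f)) = inj₂ (D , f , inj₂ refl , h D)
      where
      h : ∀ D → ℤ.- + 1 ℤ.+ D ≡ ℤ.- + 2 ℤ.+ (+ 1 ℤ.+ D)
      h = solve-∀

    private
      not-1 : ∀ D D′ → fr D ≡ B → fr D′ ≡ B → D′ ≢ + 1 ℤ.+ D
      not-1 D _ f f′ refl = A≢B (trans (sym (proj₁ (special-centre sp D f))) f′)
      not-2 : ∀ D D′ → fr D ≡ B → fr D′ ≡ B → D′ ≢ + 2 ℤ.+ D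
      not-2 D _ f f′ refl = proj₂ (outer₊ D f) f′

      lo : ∀ q q′ → sD A B (ε q) ≡ ε q′ → ℤ.- + 2 ℤ.+ q ℤ.≤ q′
      lo q q′ e with sD-down-or-not q q′ e
      ... | inj₁ q≤q′ = ℤ.≤-trans (≤-via (ℤ.i≤j+i q (+ 2)) (h q)) q≤q′
        where
        h : ∀ q → (+ 2 ℤ.+ q) ℤ.- q ≡ q ℤ.- (ℤ.- + 2 ℤ.+ q)
        h = solve-∀
      ... | inj₂ (_ , _ , _ , refl) = ℤ.≤-refl

      move₁ : ∀ D x → D ≡ + 1 ℤ.+ x → x ≡ ℤ.- + 1 ℤ.+ D
      move₁ D x refl = sym (pred-suc x)

    -- An inversion of the D-variant other than the pair that it exchanges is
    -- symmetric about the centre, which genericity excludes.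
    inversion-double : ∀ {p q p′ q′} → p ℤ.< q → Generic p q → sD A B (ε p) ≡ ε p′ → sD A B (ε q) ≡ ε q′ → q′ ℤ.< p′ → p′ ≡ q
    inversion-double {p} {q} {p′} {q′} p<q gen ep eq q′<p′ with position p | sD-down-or-not q q′ eq
    -- Here p moves down by two. No position moves further down, so q stays above it.
    ... | pos₂ D f refl | _ with refl ← ε-injective (trans (sym ep) (sD₂ D f)) =
      ⊥-elim (ℤ.<⇒≱ q′<p′ (ℤ.≤-trans (ℤ.+-monoʳ-≤ (ℤ.- + 2) (ℤ.<⇒≤ p<q)) (lo q q′ eq)))
    ... | pos₃ D f refl | _ with refl ← ε-injective (trans (sym ep) (sD₃ D f)) =
      ⊥-elim (ℤ.<⇒≱ q′<p′ (ℤ.≤-trans (subst (ℤ._≤ ℤ.- + 2 ℤ.+ q) (h D) (ℤ.+-monoʳ-≤ (ℤ.- + 2) (ℤ.<⇒≤ p<q))) (lo q q′ eq)))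
      where
      h : ∀ D → ℤ.- + 2 ℤ.+ (+ 1 ℤ.+ D) ≡ ℤ.- + 1 ℤ.+ D
      h = solve-∀
    ... | still f | inj₁ q≤q′ with refl ← ε-injective (trans (sym ep) f) = ⊥-elim (ℤ.<⇒≱ (ℤ.<-trans p<q (ℤ.≤-<-trans q≤q′ q′<p′)) ℤ.≤-refl)
    ... | still f | inj₂ (D , fD , w , refl) with refl ← ε-injective (trans (sym ep) f) = ⊥-elim (go w)
      where
      q≡ : q ≡ + 1 ℤ.+ p
      q≡ with in-range 1 (<⇒1+≤ p<q) (<-via q′<p′ (h p q))
        where
        h : ∀ p q → p ℤ.- (ℤ.- + 2 ℤ.+ q) ≡ + 1 ℤ.+ (+ 1 ℤ.+ p) ℤ.- q
        h = solve-∀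
      ... | zero , _ , e = trans e (ℤ.+-identityˡ _)
      ... | suc _ , s≤s () , _
      go : q ≡ D ⊎ q ≡ + 1 ℤ.+ D → ⊥
      go (inj₁ refl) = shift≢ 1 (trans (ε-injective (trans (sym (sD₁ D fD)) (trans (cong (sD A B ∘ ε) (sym (move₁ D p q≡))) f))) (move₁ D p q≡)) (h D)
        where
        h : ∀ D → (+ 1 ℤ.+ D) ℤ.- (ℤ.- + 1 ℤ.+ D) ≡ + 2 ℤ.- + 0
        h = solve-∀
      go (inj₂ refl) with refl ← 1+-cancel {D} {p} q≡ = shift≢ 1 (sym (ε-injective (trans (sym (sD₂ D fD)) f))) (h D)
        where
        h : ∀ D → D ℤ.- (ℤ.- + 2 ℤ.+ D) ≡ + 2 ℤ.- + 0
        h = solve-∀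
    ... | pos₀ D f refl | inj₁ q≤q′ with refl ← ε-injective (trans (sym ep) (sD₀ D f)) =
      ⊥-elim (go (in-range 1 (<⇒1+≤ p<q) (<-via (ℤ.≤-<-trans q≤q′ q′<p′) (h q D))))
      where
      h : ∀ q D → D ℤ.- q ≡ + 1 ℤ.+ (+ 1 ℤ.+ (ℤ.- + 2 ℤ.+ D)) ℤ.- q
      h = solve-∀
      h₀ : ∀ D → + 0 ℤ.+ (+ 1 ℤ.+ (ℤ.- + 2 ℤ.+ D)) ≡ ℤ.- + 1 ℤ.+ D
      h₀ = solve-∀
      go : ∃[ j ] j < 1 × q ≡ + j ℤ.+ (+ 1 ℤ.+ (ℤ.- + 2 ℤ.+ D)) → ⊥
      go (suc _ , s≤s () , _)
      go (zero , _ , e) = ℤ.<⇒≱ q′<p′ (subst (D ℤ.≤_) q′≡ (ℤ.i≤j+i D (+ 1)))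
        where
        q′≡ : + 1 ℤ.+ D ≡ q′
        q′≡ = ε-injective (trans (sym (sD₁ D f)) (trans (cong (sD A B ∘ ε) (sym (trans e (h₀ D)))) eq))
    ... | pos₀ D f refl | inj₂ (D′ , f′ , inj₁ refl , refl) with refl ← ε-injective (trans (sym ep) (sD₀ D f)) =
      go (in-range 3 (<⇒1+≤ p<q) (<-via q′<p′ (h D D′)))
      where
      h : ∀ D D′ → D ℤ.- (ℤ.- + 2 ℤ.+ D′) ≡ + 3 ℤ.+ (+ 1 ℤ.+ (ℤ.- + 2 ℤ.+ D)) ℤ.- D′
      h = solve-∀
      h₀ : ∀ D → D ≡ + 1 ℤ.+ (+ 0 ℤ.+ (+ 1 ℤ.+ (ℤ.- + 2 ℤ.+ D)))
      h₀ = solve-∀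
      h₁ : ∀ D → D ≡ + 1 ℤ.+ (+ 1 ℤ.+ (ℤ.- + 2 ℤ.+ D))
      h₁ = solve-∀
      h₂ : ∀ D → + 2 ℤ.+ (+ 1 ℤ.+ (ℤ.- + 2 ℤ.+ D)) ≡ + 1 ℤ.+ D
      h₂ = solve-∀
      go : ∃[ j ] j < 3 × D′ ≡ + j ℤ.+ (+ 1 ℤ.+ (ℤ.- + 2 ℤ.+ D)) → D ≡ D′
      go (0 , _ , e) = ⊥-elim (not-1 D′ D f′ f (trans (h₀ D) (cong (λ x → + 1 ℤ.+ x) (sym e))))
      go (1 , _ , e) = trans (h₁ D) (sym e)
      go (2 , _ , e) = ⊥-elim (not-1 D D′ f f′ (trans e (h₂ D)))
      go (suc (suc (suc _)) , s≤s (s≤s (s≤s ())) , _)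
    ... | pos₀ D f refl | inj₂ (D′ , f′ , inj₂ refl , refl) with refl ← ε-injective (trans (sym ep) (sD₀ D f)) =
      ⊥-elim (go (in-range 3 (≤-via (<⇒1+≤ p<q) (h′ D D′)) (<-via q′<p′ (h D D′))))
      where
      h : ∀ D D′ → D ℤ.- (ℤ.- + 2 ℤ.+ (+ 1 ℤ.+ D′)) ≡ + 3 ℤ.+ (ℤ.- + 2 ℤ.+ D) ℤ.- D′
      h = solve-∀
      h′ : ∀ D D′ → (+ 1 ℤ.+ D′) ℤ.- (+ 1 ℤ.+ (ℤ.- + 2 ℤ.+ D)) ≡ D′ ℤ.- (ℤ.- + 2 ℤ.+ D)
      h′ = solve-∀
      h₀ : ∀ D → D ≡ + 2 ℤ.+ (+ 0 ℤ.+ (ℤ.- + 2 ℤ.+ D))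
      h₀ = solve-∀
      h₁ : ∀ D → D ≡ + 1 ℤ.+ (+ 1 ℤ.+ (ℤ.- + 2 ℤ.+ D))
      h₁ = solve-∀
      h₂ : ∀ D → + 1 ℤ.+ (ℤ.- + 2 ℤ.+ D ℤ.+ (+ 1 ℤ.+ (+ 2 ℤ.+ (ℤ.- + 2 ℤ.+ D)))) ≡ D ℤ.+ D
      h₂ = solve-∀
      go : ∃[ j ] j < 3 × D′ ≡ + j ℤ.+ (ℤ.- + 2 ℤ.+ D) → ⊥
      go (0 , _ , e) = not-2 D′ D f′ f (trans (h₀ D) (cong (λ x → + 2 ℤ.+ x) (sym e)))
      go (1 , _ , e) = not-1 D′ D f′ f (trans (h₁ D) (cong (λ x → + 1 ℤ.+ x) (sym e)))
      -- Now D′ = D, and (p, q) = (D - 2, D + 1) is one of the two symmetric pairs.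
      go (2 , _ , e) = gen D sp f (trans (cong (λ x → + 1 ℤ.+ (ℤ.- + 2 ℤ.+ D ℤ.+ (+ 1 ℤ.+ x))) e) (h₂ D))
      go (suc (suc (suc _)) , s≤s (s≤s (s≤s ())) , _)
    ... | pos₁ D f refl | inj₁ q≤q′ with refl ← ε-injective (trans (sym ep) (sD₁ D f)) =
      ⊥-elim (go (in-range 1 (<⇒1+≤ p<q) (<-via (ℤ.≤-<-trans q≤q′ q′<p′) (h q D))))
      where
      h : ∀ q D → (+ 1 ℤ.+ D) ℤ.- q ≡ + 1 ℤ.+ (+ 1 ℤ.+ (ℤ.- + 1 ℤ.+ D)) ℤ.- q
      h = solve-∀
      h₀ : ∀ D → + 0 ℤ.+ (+ 1 ℤ.+ (ℤ.- + 1 ℤ.+ D)) ≡ D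
      h₀ = solve-∀
      h₂ : ∀ D → D ℤ.- (ℤ.- + 2 ℤ.+ D) ≡ + 2 ℤ.- + 0
      h₂ = solve-∀
      go : ∃[ j ] j < 1 × q ≡ + j ℤ.+ (+ 1 ℤ.+ (ℤ.- + 1 ℤ.+ D)) → ⊥
      go (suc _ , s≤s () , _)
      go (zero , _ , e) = ℤ.<⇒≱ (<-via {+ 0} {+ 2} (+<+ z<s) (sym (h₂ D))) (subst₂ ℤ._≤_ q≡D q′≡ q≤q′)
        where
        q≡D : q ≡ D
        q≡D = trans e (h₀ D)
        q′≡ : q′ ≡ ℤ.- + 2 ℤ.+ D
        q′≡ = ε-injective (trans (sym eq) (trans (cong (sD A B ∘ ε) q≡D) (sD₂ D f)))
    ... | pos₁ D f refl | inj₂ (D′ , f′ , inj₁ refl , refl) with refl ← ε-injective (trans (sym ep) (sD₁ D f)) =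
      ⊥-elim (go (in-range 3 (subst (ℤ._≤ D′) (suc-pred D) (<⇒1+≤ p<q)) (<-via q′<p′ (h D D′))))
      where
      h : ∀ D D′ → (+ 1 ℤ.+ D) ℤ.- (ℤ.- + 2 ℤ.+ D′) ≡ + 3 ℤ.+ D ℤ.- D′
      h = solve-∀
      h₀ : ∀ D → + 1 ℤ.+ (ℤ.- + 1 ℤ.+ D ℤ.+ (+ 0 ℤ.+ D)) ≡ D ℤ.+ D
      h₀ = solve-∀
      go : ∃[ j ] j < 3 × D′ ≡ + j ℤ.+ D → ⊥
      -- Again D′ = D, and (p, q) = (D - 1, D) is the other symmetric pair.
      go (0 , _ , e) = gen D sp f (trans (cong (λ x → + 1 ℤ.+ (ℤ.- + 1 ℤ.+ D ℤ.+ x)) e) (h₀ D))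
      go (1 , _ , e) = not-1 D D′ f f′ e
      go (2 , _ , e) = not-2 D D′ f f′ e
      go (suc (suc (suc _)) , s≤s (s≤s (s≤s ())) , _)
    ... | pos₁ D f refl | inj₂ (D′ , f′ , inj₂ refl , refl) with refl ← ε-injective (trans (sym ep) (sD₁ D f)) =
      go (in-range 3 (≤-via (<⇒1+≤ p<q) (h′ D D′)) (<-via q′<p′ (h D D′)))
      where
      h : ∀ D D′ → (+ 1 ℤ.+ D) ℤ.- (ℤ.- + 2 ℤ.+ (+ 1 ℤ.+ D′)) ≡ + 3 ℤ.+ (ℤ.- + 1 ℤ.+ D) ℤ.- D′
      h = solve-∀
      h′ : ∀ D D′ → (+ 1 ℤ.+ D′) ℤ.- (+ 1 ℤ.+ (ℤ.- + 1 ℤ.+ D)) ≡ D′ ℤ.- (ℤ.- + 1 ℤ.+ D)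
      h′ = solve-∀
      h₀ : ∀ D → D ≡ + 1 ℤ.+ (+ 0 ℤ.+ (ℤ.- + 1 ℤ.+ D))
      h₀ = solve-∀
      h₂ : ∀ D → + 2 ℤ.+ (ℤ.- + 1 ℤ.+ D) ≡ + 1 ℤ.+ D
      h₂ = solve-∀
      go : ∃[ j ] j < 3 × D′ ≡ + j ℤ.+ (ℤ.- + 1 ℤ.+ D) → + 1 ℤ.+ D ≡ + 1 ℤ.+ D′
      go (0 , _ , e) = ⊥-elim (not-1 D′ D f′ f (trans (h₀ D) (cong (λ x → + 1 ℤ.+ x) (sym e))))
      go (1 , _ , e) = cong (λ x → + 1 ℤ.+ x) (sym (trans e (suc-pred D)))
      go (2 , _ , e) = ⊥-elim (not-1 D D′ f f′ (trans e (h₂ D)))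
      go (suc (suc (suc _)) , s≤s (s≤s (s≤s ())) , _)

-- Words, the exchange condition and lengths.

double-injective : ∀ x y → x ℤ.+ x ≡ y ℤ.+ y → x ≡ y
double-injective x y e = proj₂ (euclid-unique 2 0 0 x y z<s z<s (trans (h x) (trans e (sym (h y)))))
  where
  h : ∀ x → + 0 ℤ.+ x ℤ.* + 2 ≡ x ℤ.+ x
  h = solve-∀

least : ∀ {Q : ℕ → Set} → (∀ k → Dec (Q k)) → ∀ k → Q k → ∃[ m ] Q m × (∀ j → Q j → m ≤ j)
least {Q} Q? k q with search k
  where
  search : ∀ k → (∀ j → j < k → ¬ Q j) ⊎ (∃[ m ] Q m × (∀ j → Q j → m ≤ j))
  search zero = inj₁ λ _ ()
  search (suc k) with search k
  ... | inj₂ found = inj₂ found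
  ... | inj₁ none with Q? k
  ...   | yes q = inj₂ (k , q , λ j qj → ℕ.≮⇒≥ λ j<k → none j j<k qj)
  ...   | no ¬q = inj₁ λ j j<1+k qj → [ (λ j<k → none j j<k qj) , (λ { refl → ¬q qj }) ]′ (ℕ.m≤n⇒m<n∨m≡n (s≤s⁻¹ j<1+k))
... | inj₂ found = found
... | inj₁ none = k , q , λ j qj → ℕ.≮⇒≥ λ j<k → none j j<k qj

module Words (X : QuotientType) (n : ℕ) .{{_ : NonZero n}} (rank : minRank X ≤ n) where
  open Quotient X n renaming (N to Nℕ)
  open Index n
  open Generators X n
  open Lengths X n rank
  open Exchange X n rank
  open Equivariant
  open Reflection

  s-reflection : ∀ i → ∃[ p ] Reflection (s i) p
  s-reflection i with kind 2≤n i
  ... | adjacent e _ = pivot (toℕ i) , reflection-resp (λ z → sym (e z)) (sC-reflection (toℕ i) (s≤s⁻¹ (toℕ<n i)))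
  ... | double A sp e = _ , reflection-resp (λ z → sym (e z))
          (reflection-conj (sC-equivariant (toℕ i)) (sC-involutive (toℕ i)) (sC-reflection A A≤n))
    where
    A≤n : A ≤ n
    A≤n with special-inner sp
    ... | t , refl , t<n = ℕ.<⇒≤ t<n

  s-equivariant : ∀ i → Equivariant (s i)
  s-equivariant i = equivariant (proj₂ (s-reflection i))

  s-involutive : ∀ i z → s i (s i z) ≡ z
  s-involutive i = involutive (proj₂ (s-reflection i))

  inversion : ∀ i {p q p′ q′} → p ℤ.< q → Generic p q → s i (ε p) ≡ ε p′ → s i (ε q) ≡ ε q′ → q′ ℤ.< p′ → p′ ≡ q
  inversion i p<q gen ep eq l with kind 2≤n i
  ... | adjacent e _ = inversion-adjacent (toℕ i) p<q (trans (sym (e _)) ep) (trans (sym (e _)) eq) l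
  ... | double A sp e = inversion-double sp p<q gen (trans (sym (e _)) ep) (trans (sym (e _)) eq) l

  image : ∀ {t} → Equivariant t → (∀ z → t (t z) ≡ z) → ∀ d → ∃[ d′ ] t (ε d) ≡ ε d′
  image {t} E inv d with label (t (ε d))
  ... | entry d′ e = d′ , e
  ... | multiple k e = contradiction (trans (sym (inv (ε d))) (trans (cong t e) (mult-fixed E k))) (ε≢ d k)

  ε-about : ∀ p c → ε (ℤ.- (+ 1 ℤ.+ p) ℤ.+ c ℤ.* P) ≡ ℤ.- ε p ℤ.+ (+ 2 ℤ.+ c) ℤ.* N
  ε-about p c = trans (ε-shift c (ℤ.- (+ 1 ℤ.+ p))) (trans (cong (ℤ._+ c ℤ.* N) (ε-mirror p)) (h (ε p) c N))
    where
    h : ∀ x c N → + 2 ℤ.* N ℤ.- x ℤ.+ c ℤ.* N ≡ ℤ.- x ℤ.+ (+ 2 ℤ.+ c) ℤ.* N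
    h = solve-∀

  -- Symmetry about a centre says that the label of q′ is the negative of that of p′ up to a
  -- multiple of N. The involution `s i` carries this relation back to p and q, with the same
  -- centre.
  generic-map : ∀ i {p q p′ q′} → Generic p q → s i (ε p) ≡ ε p′ → s i (ε q) ≡ ε q′ → Generic p′ q′
  generic-map i {p} {q} {p′} {q′} gen ep eq D sp f e with special-double sp D f
  ... | c , DD = gen D sp f (trans (cong (λ x → + 1 ℤ.+ (p ℤ.+ x)) q≡) (trans (h p (c ℤ.* P)) (sym DD)))
    where
    h : ∀ p x → + 1 ℤ.+ (p ℤ.+ (ℤ.- (+ 1 ℤ.+ p) ℤ.+ x)) ≡ x
    h = solve-∀
    h′ : ∀ p q → q ≡ ℤ.- (+ 1 ℤ.+ p) ℤ.+ (+ 1 ℤ.+ (p ℤ.+ q))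
    h′ = solve-∀
    q′≡ : q′ ≡ ℤ.- (+ 1 ℤ.+ p′) ℤ.+ c ℤ.* P
    q′≡ = trans (h′ p′ q′) (cong (λ x → ℤ.- (+ 1 ℤ.+ p′) ℤ.+ x) (trans e DD))
    flip : ∀ {d d′} → s i (ε d) ≡ ε d′ → s i (ε d′) ≡ ε d
    flip {d} x = trans (cong (s i) (sym x)) (s-involutive i (ε d))
    q≡ : q ≡ ℤ.- (+ 1 ℤ.+ p) ℤ.+ c ℤ.* P
    q≡ = ε-injective (trans (sym (flip eq)) (trans (cong (s i) (trans (cong ε q′≡) (ε-about p′ c)))
      (trans (reflect (s-equivariant i) (+ 2 ℤ.+ c) (ε p′)) (trans (cong (λ x → ℤ.- x ℤ.+ (+ 2 ℤ.+ c) ℤ.* N) (flip ep)) (sym (ε-about p c))))))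

  -- Followed along the word, the images of p < q end up reversed; the letter at
  -- which they cross can be deleted.
  exchange : ∀ is {t p q w a b} → Reflection t (ε p) → t (ε p) ≡ ε q → p ℤ.< q → Generic p q →
    w ≗ product is → w a ≡ ε p → w b ≡ ε q → b ℤ.< a →
    ∃[ js ] suc (length js) ≡ length is × t ∘ w ≗ product js
  exchange [] R tp p<q gen e wa wb b<a =
    contradiction b<a (ℤ.<-asym (subst₂ ℤ._<_ (trans (sym wa) (e _)) (trans (sym wb) (e _)) (ε-mono-< p<q)))
  exchange (i ∷ is) {t} {p} {q} {w} {a} {b} R tp p<q gen e wa wb b<a =
    let p′ , ep = image (s-equivariant i) (s-involutive i) p
        q′ , eq = image (s-equivariant i) (s-involutive i) q
    in step p′ q′ ep eq (ℤ.<-cmp p′ q′)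
    where
    step : ∀ p′ q′ → s i (ε p) ≡ ε p′ → s i (ε q) ≡ ε q′ → Tri (p′ ℤ.< q′) (p′ ≡ q′) (q′ ℤ.< p′) →
      ∃[ js ] suc (length js) ≡ suc (length is) × t ∘ w ≗ product js
    step p′ q′ ep eq (tri≈ _ refl _) = contradiction (ε-injective (trans (sym (s-involutive i (ε p)))
      (trans (cong (s i) (trans ep (sym eq))) (s-involutive i (ε q))))) (ℤ.<⇒≢ p<q)
    -- The pair crosses at this letter. By `inversion` the letter exchanges p and q, so it is t
    -- itself and cancels.
    step p′ q′ ep eq (tri> _ _ q′<p′) = is , refl , λ z → trans (t≗s (w z)) (trans (cong (s i) (e z)) (s-involutive i (product is z)))
      where
      p′≡q : p′ ≡ q
      p′≡q = inversion i p<q gen ep eq q′<p′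
      t≗s : t ≗ s i
      t≗s = reflection-unique R (reflection-at (ε p) (proj₂ (s-reflection i))
              (λ x → ℤ.<⇒≢ p<q (trans (ε-injective (trans (sym x) ep)) p′≡q))) (trans tp (sym (trans ep (cong ε p′≡q))))
    -- Not yet crossed: conjugation by the letter transports t and the pair to the rest of the word.
    step p′ q′ ep eq (tri< p′<q′ _ _) = i ∷ proj₁ rest , cong suc (proj₁ (proj₂ rest)) ,
        λ z → trans (cong t (e z)) (trans (sym (s-involutive i (t (s i (product is z))))) (cong (s i) (proj₂ (proj₂ rest) z)))
      where
      strip : ∀ {c x x′} → w c ≡ ε x → s i (ε x) ≡ ε x′ → product is c ≡ ε x′
      strip {c} wc ex = trans (sym (s-involutive i (product is c))) (trans (cong (s i) (trans (sym (e c)) wc)) ex)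
      conjugate : Reflection (s i ∘ t ∘ s i) (ε p′)
      conjugate = subst (Reflection (s i ∘ t ∘ s i)) ep (reflection-conj (s-equivariant i) (s-involutive i) R)
      rest : ∃[ js ] suc (length js) ≡ length is × (s i ∘ t ∘ s i) ∘ product is ≗ product js
      rest = exchange is {s i ∘ t ∘ s i} {p′} {q′} {product is} {a} {b} conjugate
        (trans (cong (s i ∘ t) (trans (cong (s i) (sym ep)) (s-involutive i (ε p)))) (trans (cong (s i) tp) eq))
        p′<q′ (generic-map i gen ep eq) (λ _ → refl) (strip wa ep) (strip wb eq) b<a

  HasLength-unique : ∀ {w k l} → HasLength w k → HasLength w l → k ≡ l
  HasLength-unique ((is , ki , ei) , mi) ((js , kj , ej) , mj) =
    ℕ.≤-antisym (ℕ.≤-trans (mi js ej) (ℕ.≤-reflexive kj)) (ℕ.≤-trans (mj is ei) (ℕ.≤-reflexive ki))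

  -- If b < a, the exchange condition would delete a letter from a shortest word of u and leave a
  -- word for v that is shorter than u.
  no-inversion : ∀ i {u v p q a b} → u <ℓ v → v ≗ s i ∘ u → s i (ε p) ≡ ε q → p ℤ.< q → Generic p q →
    u a ≡ ε p → u b ≡ ε q → a ℤ.≤ b
  no-inversion i {u} {v} {p} (k , l , ((is , is≡k , u≗) , _) , (_ , minimal) , k<l) v≗ sp p<q gen ua ub = ℤ.≮⇒≥ λ b<a →
    let js , len , sw≗ = exchange is (reflection-at (ε p) (proj₂ (s-reflection i))
                           (λ x → ℤ.<⇒≢ p<q (ε-injective (trans (sym x) sp)))) sp p<q gen u≗ ua ub b<a
    in ℕ.<⇒≱ k<l (ℕ.≤-trans (minimal js (λ z → trans (v≗ z) (sw≗ z))) (ℕ.≤-trans (ℕ.n≤1+n _) (ℕ.≤-reflexive (trans len is≡k))))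

  adjacent-order : ∀ i {u v a b} → u <ℓ v → v ≗ s i ∘ u → s i ≗ sC (toℕ i) → (∀ A → ¬ Special A (toℕ i)) →
    ∀ d → fr d ≡ toℕ i → u a ≡ ε (ℤ.- + 1 ℤ.+ d) → u b ≡ ε d → a ℤ.≤ b
  adjacent-order i l v≗ e ns d f = no-inversion i l v≗
    (trans (e _) (trans (sC-up (toℕ i) (ℤ.- + 1 ℤ.+ d) (trans (cong fr (suc-pred d)) f)) (cong ε (suc-pred d))))
    (<-via {ℤ.- + 1} {+ 0} ℤ.-<+ (h d)) gen
    where
    h : ∀ d → + 0 ℤ.- (ℤ.- + 1) ≡ d ℤ.- (ℤ.- + 1 ℤ.+ d)
    h = solve-∀
    h′ : ∀ d → + 1 ℤ.+ (ℤ.- + 1 ℤ.+ d ℤ.+ d) ≡ d ℤ.+ d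
    h′ = solve-∀
    gen : Generic (ℤ.- + 1 ℤ.+ d) d
    -- The only axis of this pair belongs to d itself, and d is no centre since `toℕ i` is not the B
    -- of a special pair.
    gen {A} D sp g x = ns A (subst (Special A) (trans (sym g) (trans (cong fr (sym (double-injective d D (trans (sym (h′ d)) x)))) f)) sp)

  double-order : ∀ i {u v a b A} → u <ℓ v → v ≗ s i ∘ u → Special A (toℕ i) → s i ≗ sD A (toℕ i) →
    ∀ D → fr D ≡ toℕ i →
    (u a ≡ ε (ℤ.- + 2 ℤ.+ D) → u b ≡ ε D → a ℤ.≤ b)
    × (u a ≡ ε (ℤ.- + 1 ℤ.+ D) → u b ≡ ε (+ 1 ℤ.+ D) → a ℤ.≤ b)
  double-order i l v≗ sp e D f =
      -- Genericity by parity: for both exchanged pairs 1 + p + q is odd, namely 2D - 1 and 2D + 1,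
      -- whereas twice a centre is even.
      no-inversion i l v≗ (trans (e _) (sD₀ D f)) (<-via {ℤ.- + 2} {+ 0} ℤ.-<+ (h₀ D)) (λ D′ _ _ x → 2x≢1+2y D′ (ℤ.- + 1 ℤ.+ D) (trans (sym x) (g₀ D)))
    , no-inversion i l v≗ (trans (e _) (sD₁ D f)) (<-via {ℤ.- + 2} {+ 0} ℤ.-<+ (h₁ D)) (λ D′ _ _ x → 2x≢1+2y D′ D (trans (sym x) (g₁ D)))
    where
    open Double sp
    h₀ : ∀ d → + 0 ℤ.- (ℤ.- + 2) ≡ d ℤ.- (ℤ.- + 2 ℤ.+ d)
    h₀ = solve-∀
    h₁ : ∀ d → + 0 ℤ.- (ℤ.- + 2) ≡ (+ 1 ℤ.+ d) ℤ.- (ℤ.- + 1 ℤ.+ d)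
    h₁ = solve-∀
    g₀ : ∀ D → + 1 ℤ.+ (ℤ.- + 2 ℤ.+ D ℤ.+ D) ≡ + 1 ℤ.+ (ℤ.- + 1 ℤ.+ D ℤ.+ (ℤ.- + 1 ℤ.+ D))
    g₀ = solve-∀
    g₁ : ∀ D → + 1 ℤ.+ (ℤ.- + 1 ℤ.+ D ℤ.+ (+ 1 ℤ.+ D)) ≡ + 1 ℤ.+ (D ℤ.+ D)
    g₁ = solve-∀

  product-equivariant : ∀ is → Equivariant (product is)
  product-equivariant [] = record { shift = λ _ _ → refl ; neg = λ _ → refl }
  product-equivariant (i ∷ is) = ∘-equivariant (s-equivariant i) (product-equivariant is)

  -- Tries every first letter and, for the empty word, compares with the identity on 1, ..., n,
  -- which suffices by equivariance. Decidability is what lets `least` produce a minimal length.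
  word? : ∀ k {f} → Equivariant f → Dec (∃[ is ] (length is ≡ k × f ≗ product is))
  word? zero {f} E = map′ (λ a → [] , refl , equivariant-≗ E (product-equivariant []) (λ r r<n → a r<n))
    (λ { ([] , _ , e) _ → e _ }) (ℕ.allUpTo? (λ r → f (+ suc r) ℤ.≟ + suc r) n)
  word? (suc k) {f} E = map′
    (λ { (i , is , l , e) → i ∷ is , cong suc l , λ z → trans (sym (s-involutive i (f z))) (cong (s i) (e z)) })
    (λ { (i ∷ is , l , e) → i , is , ℕ.suc-injective l , λ z → trans (cong (s i) (e z)) (s-involutive i (product is z)) })
    (any? (λ i → word? k (∘-equivariant (s-equivariant i) E)))

  hasLength : ∀ {f} → Equivariant f → ∀ js → f ≗ product js → ∃[ k ] HasLength f k
  hasLength E js e with least (λ k → word? k E) (length js) (js , refl , e)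
  ... | k , w , m = k , w , λ is x → m (length is) (is , refl , x)

  -- With ℓ the length, ℓ(s_i w) < ℓ(w) ≤ ℓ(w v) ≤ ℓ(s_i w v) + 1; the last step prefixes one
  -- letter.
  descent-minimal : ∀ i {w} → Equivariant w → w ∈ W̃/W → (s i ∘ w) <ℓ w → ∀ v → v ∈ W → (s i ∘ w) ≤ℓ (s i ∘ w ∘ v)
  descent-minimal i {w} E (_ , minimal) (k , l , Lsw , Lw , k<l) v v∈W@(vs , v≗) with minimal v v∈W
  ... | k₂ , l₂ , Lw₂ , ((is , is≡l₂ , wv≗) , min₂) , k₂≤l₂ with hasLength Eswv (i ∷ is) (λ z → cong (s i) (wv≗ z))
    where
    Ev : Equivariant v
    Ev = record
      { shift = λ c z → trans (v≗ _) (trans (shift (product-equivariant (map Fin.suc vs)) c z) (cong (ℤ._+ c ℤ.* N) (sym (v≗ z))))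
      ; neg = λ z → trans (v≗ _) (trans (neg (product-equivariant (map Fin.suc vs)) z) (cong ℤ.-_ (sym (v≗ z)))) }
    Eswv : Equivariant (s i ∘ w ∘ v)
    Eswv = ∘-equivariant (s-equivariant i) (∘-equivariant E Ev)
  ... | l′ , Lswv@((is′ , is′≡l′ , e) , _) = k , l′ , Lsw , Lswv , s≤s⁻¹ (ℕ.≤-trans k<l (ℕ.≤-trans (ℕ.≤-reflexive (HasLength-unique Lw Lw₂))
      (ℕ.≤-trans k₂≤l₂ (ℕ.≤-trans (min₂ (i ∷ is′) (λ z → trans (sym (s-involutive i (w (v z)))) (cong (s i) (e z)))) (ℕ.≤-reflexive (cong suc is′≡l′))))))

-- Heights and how generators change them.

bit : Bool → ℕ
bit true  = 1
bit false = 0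

does-true : ∀ {A : Set} (A? : Dec A) → does A? ≡ true → A
does-true (yes a) _ = a

module Count (b : ℤ → Bool) (K : ℤ) (high : ∀ d → K ℤ.≤ d → b d ≡ false) where
  private
    count : ℤ → ℕ → ℕ
    count d zero    = 0
    count d (suc m) = bit (b d) + count (+ 1 ℤ.+ d) m

    pos : ℤ → ℕ
    pos (+ m)    = m
    pos -[1+ _ ] = 0

  β : ℤ → ℕ
  β d = count d (pos (K ℤ.- d))

  β-high : ∀ d → K ℤ.≤ d → β d ≡ 0
  β-high d K≤d with K ℤ.- d | ℤ.i≤j⇒i-j≤0 K≤d
  ... | + zero   | _ = refl
  ... | -[1+ _ ] | _ = refl
  ... | + suc _  | +≤+ ()

  β-step : ∀ d → β d ≡ bit (b d) + β (+ 1 ℤ.+ d)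
  β-step d with d ℤ.<? K
  ... | no d≮K = trans (β-high d K≤d) (sym (cong₂ _+_ (cong bit (high d K≤d)) (β-high (+ 1 ℤ.+ d) (ℤ.≤-trans K≤d (ℤ.i≤j+i d (+ 1))))))
    where K≤d = ℤ.≮⇒≥ d≮K
  ... | yes d<K = cong (count d) pos-suc
    where
    h : ∀ K d → K ℤ.- d ≡ + 1 ℤ.+ (K ℤ.- (+ 1 ℤ.+ d))
    h = solve-∀
    pos-suc : pos (K ℤ.- d) ≡ suc (pos (K ℤ.- (+ 1 ℤ.+ d)))
    pos-suc with K ℤ.- (+ 1 ℤ.+ d) in eq | ℤ.i≤j⇒0≤j-i (<⇒1+≤ d<K)
    ... | + m | _ = cong pos (trans (h K d) (cong (λ x → + 1 ℤ.+ x) eq))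

-- The recurrence fixes a height up to a constant. So a candidate for a new height need only satisfy
-- it and agree at one position, which is taken so far to the right that both sides vanish.
steps-unique : ∀ {b : ℤ → Bool} {f h : ℤ → ℕ} → (∀ d → f d ≡ bit (b d) + f (+ 1 ℤ.+ d)) →
  (∀ d → h d ≡ bit (b d) + h (+ 1 ℤ.+ d)) → ∀ c → f c ≡ h c → f ≗ h
steps-unique {b} {f} {h} sf sh c e = ℤ-ind-from (λ d → f d ≡ h d) c e
  (λ d p → ℕ.+-cancelˡ-≡ (bit (b d)) _ _ (trans (sym (sf d)) (trans p (sh d))))
  (λ d p → trans (sf d) (trans (cong (λ m → bit (b d) + m) p) (sym (sh d))))

module Abacus (X : QuotientType) (n : ℕ) .{{_ : NonZero n}} (rank : minRank X ≤ n) where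
  open Quotient X n renaming (N to Nℕ)
  open Index n
  open Generators X n
  open Lengths X n rank
  open Equivariant

  -- g is the inverse of w; for threshold T the ones are the positions of the
  -- labels w z with z ≤ N + T. Threshold 0 gives the beads.
  bead : ℤ → (ℤ → ℤ) → ℤ → Bool
  bead T g d = does (g (ε d) ℤ.≤? N ℤ.+ T)

  private
    -- Over a full period this sum dominates every single displacement, and by equivariance then
    -- every displacement on ℤ.
    deviation : (ℤ → ℤ) → ℕ → ℕ
    deviation g zero    = 0
    deviation g (suc m) = deviation g m + ℤ.∣ + m ℤ.- g (+ m) ∣

    deviation-≥ : ∀ g m r → r < m → ℤ.∣ + r ℤ.- g (+ r) ∣ ≤ deviation g m
    deviation-≥ g (suc m) r (s≤s r≤m) with ℕ.m≤n⇒m<n∨m≡n r≤m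
    ... | inj₁ r<m  = ℕ.≤-trans (deviation-≥ g m r r<m) (ℕ.m≤m+n _ _)
    ... | inj₂ refl = ℕ.m≤n+m _ (deviation g m)

    ≤∣∣ : ∀ x → x ℤ.≤ + ℤ.∣ x ∣
    ≤∣∣ (+ m)    = ℤ.≤-refl
    ≤∣∣ -[1+ m ] = ℤ.-≤+

    deviation-bound : ∀ {g} → Equivariant g → ∀ z → z ℤ.- g z ℤ.≤ + deviation g Nℕ
    deviation-bound {g} E z = subst (λ x → x ℤ.- g x ℤ.≤ + deviation g Nℕ) (sym e)
        (subst (ℤ._≤ + deviation g Nℕ) (sym (trans (cong (λ x → + r ℤ.+ q ℤ.* N ℤ.- x) (shift E q (+ r))) (h (+ r) (q ℤ.* N) (g (+ r)))))
          (ℤ.≤-trans (≤∣∣ (+ r ℤ.- g (+ r))) (+≤+ (deviation-≥ g Nℕ r (n%ℕd<d z Nℕ)))))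
      where
      r = z %ℕ Nℕ
      q = z /ℕ Nℕ
      e : z ≡ + r ℤ.+ q ℤ.* N
      e = a≡a%ℕn+[a/ℕn]*n z Nℕ
      h : ∀ r y x → r ℤ.+ y ℤ.- (x ℤ.+ y) ≡ r ℤ.- x
      h = solve-∀

    ε-≥ : ∀ m → + m ℤ.≤ ε (+ m)
    ε-≥ zero = subst (+ 0 ℤ.≤_) (sym (trans (cong ε (sym (ℤ.+-identityˡ (+ 0 ℤ.* P)))) (ε-up (+ 0) (ℕ.<-trans 0<n n<2n)))) (+≤+ z≤n)
    ε-≥ (suc m) = ℤ.≤-trans (ℤ.+-monoʳ-≤ (+ 1) (ε-≥ m)) (<⇒1+≤ (ε-step (+ m)))

  -- From here on there are no ones: d exceeds N + T by more than the deviation, ε d is at least d,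
  -- and `g` lowers a label by at most the deviation.
  bound : ℕ → (ℤ → ℤ) → ℕ
  bound T g = suc (Nℕ + T) + deviation g Nℕ

  abstract
    bead-high : ∀ T {g} → Equivariant g → ∀ d → + bound T g ℤ.≤ d → bead (+ T) g d ≡ false
    bead-high T {g} E (+ m) (+≤+ K≤m) = dec-false (g (ε (+ m)) ℤ.≤? N ℤ.+ + T) (ℤ.<⇒≱ (1+≤⇒<
      (≤-via (ℤ.+-mono-≤ (ℤ.+-mono-≤ (deviation-bound E (ε (+ m))) (ε-≥ m)) (+≤+ K≤m)) (h (ε (+ m)) (g (ε (+ m))) (+ m) (+ deviation g Nℕ) N (+ T)))))
      where
      h : ∀ e x m v N T → v ℤ.+ e ℤ.+ m ℤ.- (e ℤ.- x ℤ.+ m ℤ.+ (+ 1 ℤ.+ (N ℤ.+ T) ℤ.+ v)) ≡ x ℤ.- (+ 1 ℤ.+ (N ℤ.+ T))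
      h = solve-∀

  module Row (T : ℕ) {g : ℤ → ℤ} (E : Equivariant g) = Count (bead (+ T) g) (+ bound T g) (bead-high T E)

  module _ (T : ℕ) where
    abstract
      height : ∀ {g} → Equivariant g → ℤ → ℕ
      height E = Row.β T E

      height-high : ∀ {g} (E : Equivariant g) d → + bound T g ℤ.≤ d → height E d ≡ 0
      height-high E = Row.β-high T E

      height-step : ∀ {g} (E : Equivariant g) d → height E d ≡ bit (bead (+ T) g d) + height E (+ 1 ℤ.+ d)
      height-step E = Row.β-step T E

    height-zero : ∀ {g h} (E : Equivariant g) (F : Equivariant h) → ∃[ c ] height E c ≡ 0 × height F c ≡ 0 × bead (+ T) g (ℤ.- + 1 ℤ.+ c) ≡ false × height E (+ 1 ℤ.+ c) ≡ 0
    -- The successor keeps the position c - 1 beyond the bounds as well, since its bit enters the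
    -- height after a swap.
    height-zero {g} {h} E F = + suc m , height-high E _ (+≤+ (ℕ.≤-trans p (ℕ.n≤1+n m))) , height-high F _ (+≤+ (ℕ.≤-trans q (ℕ.n≤1+n m)))
        , bead-high T E _ (+≤+ p) , height-high E _ (+≤+ (ℕ.≤-trans p (ℕ.m≤n+m m 2)))
      where
      m = bound T g + bound T h
      p = ℕ.m≤m+n (bound T g) (bound T h)
      q = ℕ.m≤n+m (bound T h) (bound T g)

    height-cong : ∀ {g h} (E : Equivariant g) (F : Equivariant h) → g ≗ h → height E ≗ height F
    height-cong {g} {h} E F g≗h with height-zero E F
    ... | c , p , q , _ = steps-unique (height-step E)
          (λ d → trans (height-step F d) (cong (λ x → bit (does (x ℤ.≤? N ℤ.+ + T)) + height F (+ 1 ℤ.+ d)) (sym (g≗h (ε d)))))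
          c (trans p (sym q))

    module Swap {g} (E : Equivariant g) (i : ℕ) where
      E′ : Equivariant (g ∘ sC i)
      E′ = ∘-equivariant E (sC-equivariant i)

      b b′ : ℤ → Bool
      b  = bead (+ T) g
      b′ = bead (+ T) (g ∘ sC i)

      private
        b-cong : ∀ {x y} → x ≡ y → does (g x ℤ.≤? N ℤ.+ + T) ≡ does (g y ℤ.≤? N ℤ.+ + T)
        b-cong refl = refl

      bead-down : ∀ d → fr d ≡ i → b′ d ≡ b (ℤ.- + 1 ℤ.+ d)
      bead-down d e = b-cong (sC-down i d e)

      bead-up : ∀ d → fr (+ 1 ℤ.+ d) ≡ i → b′ d ≡ b (+ 1 ℤ.+ d)
      bead-up d e = b-cong (sC-up i d e)

      bead-fix : ∀ d → fr d ≢ i → fr (+ 1 ℤ.+ d) ≢ i → b′ d ≡ b d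
      bead-fix d p q = b-cong (sC-fix i d p q)

      private
        -- The candidate for the new height. An exchange of d - 1 and d matters to the count from d
        -- on, for which the bit of d - 1 replaces that of d; every other count contains both
        -- positions or neither.
        f : ℤ → ℕ
        f d with fr d ≟ i
        ... | yes _ = bit (b (ℤ.- + 1 ℤ.+ d)) + height E (+ 1 ℤ.+ d)
        ... | no _  = height E d

        f-on : ∀ d → fr d ≡ i → f d ≡ bit (b (ℤ.- + 1 ℤ.+ d)) + height E (+ 1 ℤ.+ d)
        f-on d p with fr d ≟ i
        ... | yes _ = refl
        ... | no ¬p = contradiction p ¬p

        f-off : ∀ d → fr d ≢ i → f d ≡ height E d
        f-off d ¬p with fr d ≟ i
        ... | yes p = contradiction p ¬p
        ... | no _ = refl

        f-step : ∀ d → f d ≡ bit (b′ d) + f (+ 1 ℤ.+ d)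
        f-step d = go (fr d ≟ i) (fr (+ 1 ℤ.+ d) ≟ i)
          where
          +-swap : ∀ x y z → x + (y + z) ≡ y + (x + z)
          +-swap x y z = trans (sym (ℕ.+-assoc x y z)) (trans (cong (_+ z) (ℕ.+-comm x y)) (ℕ.+-assoc y x z))
          go : Dec (fr d ≡ i) → Dec (fr (+ 1 ℤ.+ d) ≡ i) → f d ≡ bit (b′ d) + f (+ 1 ℤ.+ d)
          go (yes p) _ = trans (f-on d p) (cong₂ _+_ (cong bit (sym (bead-down d p))) (sym (f-off (+ 1 ℤ.+ d) (fr-consecutive d p))))
          go (no p) (yes q) = trans (f-off d p) (trans (height-step E d) (trans (cong (λ x → bit (b d) + x) (height-step E (+ 1 ℤ.+ d)))
            (trans (+-swap (bit (b d)) (bit (b (+ 1 ℤ.+ d))) _)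
              (sym (cong₂ _+_ (cong bit (bead-up d q)) (trans (f-on (+ 1 ℤ.+ d) q) (cong (λ x → bit (b x) + height E (+ 1 ℤ.+ (+ 1 ℤ.+ d))) (pred-suc d))))))))
          go (no p) (no q) = trans (f-off d p) (trans (height-step E d) (sym (cong₂ _+_ (cong bit (bead-fix d p q)) (f-off (+ 1 ℤ.+ d) q))))

        height-f : height E′ ≗ f
        height-f with height-zero E E′
        ... | c , p , q , r , u = steps-unique (height-step E′) f-step c (trans q (sym (go (fr c ≟ i))))
          where
          go : Dec (fr c ≡ i) → f c ≡ 0
          go (yes x) = trans (f-on c x) (cong₂ _+_ (cong bit r) u)
          go (no x) = trans (f-off c x) p

      height-on : ∀ d → fr d ≡ i → height E′ d ≡ bit (b (ℤ.- + 1 ℤ.+ d)) + height E (+ 1 ℤ.+ d)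
      height-on d p = trans (height-f d) (f-on d p)

      height-off : ∀ d → fr d ≢ i → height E′ d ≡ height E d
      height-off d p = trans (height-f d) (f-off d p)

    module Swap₂ {g} (E : Equivariant g) {A B} (sp : Special A B) where
      open Double sp
      private
        module S₁ = Swap E B
        module S₂ = Swap S₁.E′ A
        module S₃ = Swap S₂.E′ B

      E′ : Equivariant (g ∘ sD A B)
      E′ = S₃.E′

      b : ℤ → Bool
      b = bead (+ T) g

      height-off : ∀ d → fr d ≢ A → fr d ≢ B → height E′ d ≡ height E d
      height-off d p q = trans (S₃.height-off d q) (trans (S₂.height-off d p) (S₁.height-off d q))

      module _ (D : ℤ) (e : fr D ≡ B) where
        private
          b₀ = b (ℤ.- + 2 ℤ.+ D)
          b₁ = b (ℤ.- + 1 ℤ.+ D)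
          b₃ = b (+ 1 ℤ.+ D)
          M = height E (+ 2 ℤ.+ D)
          frA₊ = proj₁ (special-centre sp D e)
          frA₋ = proj₂ (special-centre sp D e)
          +2≡ : + 1 ℤ.+ (+ 1 ℤ.+ D) ≡ + 2 ℤ.+ D
          +2≡ = h D
            where
            h : ∀ D → + 1 ℤ.+ (+ 1 ℤ.+ D) ≡ + 2 ℤ.+ D
            h = solve-∀
          -2+ : ℤ.- + 1 ℤ.+ (ℤ.- + 1 ℤ.+ D) ≡ ℤ.- + 2 ℤ.+ D
          -2+ = h D
            where
            h : ∀ D → ℤ.- + 1 ℤ.+ (ℤ.- + 1 ℤ.+ D) ≡ ℤ.- + 2 ℤ.+ D
            h = solve-∀
          1-2+ : + 1 ℤ.+ (ℤ.- + 2 ℤ.+ D) ≡ ℤ.- + 1 ℤ.+ D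
          1-2+ = h D
            where
            h : ∀ D → + 1 ℤ.+ (ℤ.- + 2 ℤ.+ D) ≡ ℤ.- + 1 ℤ.+ D
            h = solve-∀
          A≢ : ∀ {d} → fr d ≡ A → fr d ≢ B
          A≢ p q = A≢B (trans (sym p) q)
          bD : S₁.b′ D ≡ b₁
          bD = S₁.bead-down D e
          b-2 : S₁.b′ (ℤ.- + 2 ℤ.+ D) ≡ b₀
          b-2 = S₁.bead-fix _ (proj₂ (outer₋ D e)) (A≢ (trans (cong fr 1-2+) frA₋))
          H+1 : height S₂.E′ (+ 1 ℤ.+ D) ≡ bit b₁ + M
          H+1 = trans (S₂.height-on (+ 1 ℤ.+ D) frA₊) (cong₂ _+_ (cong bit (trans (cong S₁.b′ (pred-suc D)) bD))
                  (trans (cong (height S₁.E′) +2≡) (S₁.height-off _ (proj₂ (outer₊ D e)))))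

        height-D+1 : height E′ (+ 1 ℤ.+ D) ≡ bit b₁ + M
        height-D+1 = trans (S₃.height-off _ (A≢ frA₊)) H+1

        height-D : height E′ D ≡ bit b₀ + (bit b₁ + M)
        height-D = trans (S₃.height-on D e) (cong₂ _+_ (cong bit (trans (S₂.bead-down _ frA₋) (trans (cong S₁.b′ -2+) b-2))) H+1)

        height-D-1 : height E′ (ℤ.- + 1 ℤ.+ D) ≡ bit b₀ + (bit b₁ + (bit b₃ + M))
        height-D-1 = trans (S₃.height-off _ (A≢ frA₋)) (trans (S₂.height-on _ frA₋)
          (cong₂ _+_ (cong bit (trans (cong S₁.b′ -2+) b-2)) (trans (cong (height S₁.E′) (suc-pred D)) (trans (S₁.height-on D e)
            (cong (λ x → bit b₁ + x) (trans (height-step E (+ 1 ℤ.+ D)) (cong (λ x → bit b₃ + height E x) +2≡)))))))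

-- Cardinalities and the reading of the abacus.

cardinality-unique : ∀ {Q R : ℤ → Set} {k l} → (∀ z → Q z → R z) → (∀ z → R z → Q z) →
  HasCardinality Q k → HasCardinality R l → k ≡ l
cardinality-unique Q⊆R R⊆Q (xs , ux , refl , mx) (ys , uy , refl , my) =
  ↭-length (∼bag⇒↭ (unique∧set⇒bag ux uy λ {z} → mk⇔
    (λ p → Equivalence.from (my z) (Q⊆R z (Equivalence.to (mx z) p)))
    (λ p → Equivalence.from (mx z) (R⊆Q z (Equivalence.to (my z) p)))))

cardinality-resp : ∀ {Q R : ℤ → Set} {k} → (∀ z → Q z → R z) → (∀ z → R z → Q z) →
  HasCardinality Q k → HasCardinality R k
cardinality-resp Q⊆R R⊆Q (xs , ux , l , m) =
  xs , ux , l , λ z → mk⇔ (Q⊆R z ∘ Equivalence.to (m z)) (Equivalence.from (m z) ∘ R⊆Q z)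

cardinality-map : ∀ {Q : ℤ → Set} {k} (f f⁻¹ : ℤ → ℤ) → (∀ z → f⁻¹ (f z) ≡ z) → (∀ z → f (f⁻¹ z) ≡ z) →
  HasCardinality Q k → HasCardinality (Q ∘ f⁻¹) k
cardinality-map {Q} f f⁻¹ inv inv′ (xs , ux , l , m) =
  map f xs , Unique.map⁺ (λ {x} {y} e → trans (sym (inv x)) (trans (cong f⁻¹ e) (inv y))) ux , trans (length-map f xs) l ,
  λ z → mk⇔
    (λ p → let x , x∈ , e = ∈-map⁻ f p in subst Q (sym (trans (cong f⁻¹ e) (inv x))) (Equivalence.to (m x) x∈))
    (λ q → subst (λ y → y ∈ₗ map f xs) (inv′ z) (∈-map⁺ f (Equivalence.from (m (f⁻¹ z)) q)))

module Shape (X : QuotientType) (n : ℕ) .{{_ : NonZero n}} (rank : minRank X ≤ n) where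
  open Quotient X n renaming (N to Nℕ)
  open Index n
  open Generators X n
  open Lengths X n rank
  open Abacus X n rank
  open Equivariant

  record Inverse (w g : ℤ → ℤ) : Set where
    field
      equivariant  : Equivariant w
      equivariant⁻ : Equivariant g
      w∘g : ∀ z → w (g z) ≡ z
      g∘w : ∀ z → g (w z) ≡ z

  inverse : ∀ {w} → Mirrored w → ∃[ g ] Inverse w g
  inverse {w} M = g , record
      { equivariant = E
      ; equivariant⁻ = record
          { shift = λ c z → trans (cong (λ y → g (y ℤ.+ c ℤ.* N)) (sym (wg z))) (trans (cong g (sym (shift E c (g z)))) (gw _))
          ; neg = λ z → trans (cong (λ y → g (ℤ.- y)) (sym (wg z))) (trans (cong g (sym (neg E (g z)))) (gw _)) }
      ; w∘g = wg ; g∘w = gw }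
    where
    open Mirrored M
    g : ℤ → ℤ
    g z = proj₁ (proj₂ bijective z)
    wg : ∀ z → w (g z) ≡ z
    wg z = proj₂ (proj₂ bijective z) refl
    gw : ∀ z → g (w z) ≡ z
    gw z = proj₁ bijective (wg (w z))
    h : ∀ z c N → z ℤ.+ (+ 1 ℤ.+ c) ℤ.* N ≡ z ℤ.+ c ℤ.* N ℤ.+ N
    h = solve-∀
    E : Equivariant w
    E = record
      { shift = λ c z → ℤ-ind (λ c → w (z ℤ.+ c ℤ.* N) ≡ w z ℤ.+ c ℤ.* N)
          (trans (cong w (+0* z N)) (sym (+0* (w z) N)))
          (λ c p → trans (cong w (h z c N)) (trans (periodic _) (trans (cong (ℤ._+ N) p) (sym (h (w z) c N)))))
          (λ c p → +ʳ-cancel N (trans (sym (periodic _)) (trans (cong w (sym (h z c N))) (trans p (h (w z) c N))))) c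
      ; neg = odd }

  ∘-inverse : ∀ {t w g} → Equivariant t → (∀ z → t (t z) ≡ z) → Inverse w g → Inverse (t ∘ w) (g ∘ t)
  ∘-inverse {t} {w} {g} E inv I = record
    { equivariant = ∘-equivariant E (Inverse.equivariant I)
    ; equivariant⁻ = ∘-equivariant (Inverse.equivariant⁻ I) E
    ; w∘g = λ z → trans (cong t (Inverse.w∘g I (t z))) (inv z)
    ; g∘w = λ z → trans (cong g (inv (w z))) (Inverse.g∘w I z) }

  Above : ℕ → (ℤ → ℤ) → ℤ → ℤ → Set
  Above T g lo z = ∃[ q ] z ≡ ε q × lo ℤ.≤ q × bead (+ T) g q ≡ true

  abstract
    card-above : ∀ T {g} (E : Equivariant g) lo → HasCardinality (Above T g lo) (height T E lo)
    card-above T {g} E lo = go ℤ.∣ + bound T g ℤ.- lo ∣ lo (≤-via (ℤ.i≤j⇒i-j≤0 (≤∣∣ (+ bound T g ℤ.- lo))) (h (+ bound T g) lo (+ ℤ.∣ + bound T g ℤ.- lo ∣)))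
      where
      ≤∣∣ : ∀ x → x ℤ.≤ + ℤ.∣ x ∣
      ≤∣∣ (+ m)    = ℤ.≤-refl
      ≤∣∣ -[1+ m ] = ℤ.-≤+
      h : ∀ K lo m → + 0 ℤ.- (K ℤ.- lo ℤ.- m) ≡ m ℤ.+ lo ℤ.- K
      h = solve-∀
      go : ∀ m lo → + bound T g ℤ.≤ + m ℤ.+ lo → HasCardinality (Above T g lo) (height T E lo)
      go zero lo K≤ = [] , AllPairs.[] , sym (height-high T E lo K≤lo) , λ z → mk⇔ (λ ())
          λ (q , _ , lo≤q , t) → case (trans (sym t) (bead-high T E q (ℤ.≤-trans K≤lo lo≤q)))
        where
        K≤lo : + bound T g ℤ.≤ lo
        K≤lo = subst (+ bound T g ℤ.≤_) (ℤ.+-identityˡ lo) K≤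
        case : ∀ {A : Set} → true ≡ false → A
        case ()
      go (suc m) lo K≤ with go m (+ 1 ℤ.+ lo) (subst (+ bound T g ℤ.≤_) (h′ (+ m) lo) K≤)
        where
        h′ : ∀ m lo → + 1 ℤ.+ m ℤ.+ lo ≡ m ℤ.+ (+ 1 ℤ.+ lo)
        h′ = solve-∀
      ... | xs , u , l , mem with bead (+ T) g lo in eq
      ...   | false = xs , u , trans l (sym (trans (height-step T E lo) (cong (λ b → bit b + height T E (+ 1 ℤ.+ lo)) eq))) ,
              λ z → mk⇔ (λ p → let q , e , l , t = Equivalence.to (mem z) p in q , e , ℤ.≤-trans (ℤ.i≤j+i lo (+ 1)) l , t)
                        (λ (q , e , l , t) → Equivalence.from (mem z) (q , e , strict q l t , t))
        where
        strict : ∀ q → lo ℤ.≤ q → bead (+ T) g q ≡ true → + 1 ℤ.+ lo ℤ.≤ q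
        strict q l t = <⇒1+≤ (ℤ.≤∧≢⇒< l λ { refl → contradiction (trans (sym t) eq) λ () })
      ...   | true = ε lo ∷ xs , All.tabulate fresh AllPairs.∷ u , trans (cong suc l) (sym (trans (height-step T E lo) (cong (λ b → bit b + height T E (+ 1 ℤ.+ lo)) eq))) ,
              λ z → mk⇔ (to z) (from z)
        where
        fresh : ∀ {x} → x ∈ₗ xs → ε lo ≢ x
        fresh {x} x∈ refl with Equivalence.to (mem x) x∈
        ... | q , e , 1+lo≤q , _ = ℤ.<⇒≢ (1+≤⇒< 1+lo≤q) (ε-injective e)
        to : ∀ z → z ∈ₗ ε lo ∷ xs → Above T g lo z
        to z (here e) = lo , e , ℤ.≤-refl , eq
        to z (there p) = let q , e , l , t = Equivalence.to (mem z) p in q , e , ℤ.≤-trans (ℤ.i≤j+i lo (+ 1)) l , t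
        from : ∀ z → Above T g lo z → z ∈ₗ ε lo ∷ xs
        from z (q , e , l , t) with lo ℤ.≟ q
        ... | yes refl = here e
        ... | no lo≢q = there (Equivalence.from (mem z) (q , e , <⇒1+≤ (ℤ.≤∧≢⇒< l lo≢q) , t))

  -- `𝒞` admits every integer e. A multiple k N lies between two consecutive positions, and the
  -- later one, (k - 1) P, cuts the entries in the same way.
  cut : ∀ e → ∃[ p ] (∀ q → p ℤ.≤ q → e ℤ.≤ ε q) × (∀ q → e ℤ.≤ ε q → p ℤ.≤ q)
  cut e with label e
  ... | entry p refl = p , (λ q → ε-mono-≤) , (λ q → ε-cancel-≤)
  ... | multiple k refl = p , (λ q l → ℤ.≤-trans (ℤ.<⇒≤ kN<) (ε-mono-≤ l))
          , λ q l → subst (ℤ._≤ q) (suc-pred p) (<⇒1+≤ (ε-cancel-< (ℤ.<-≤-trans <kN l)))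
    where
    p = (k ℤ.- + 1) ℤ.* P
    h : ∀ x k N → x ℤ.+ (+ 1 ℤ.+ (k ℤ.- + 1)) ℤ.* N ≡ x ℤ.+ k ℤ.* N
    h = solve-∀
    kN< : k ℤ.* N ℤ.< ε p
    kN< = subst₂ ℤ._<_ (ℤ.+-identityˡ (k ℤ.* N)) (sym (trans (cong ε (sym (ℤ.+-identityˡ p))) (trans (ε-up (k ℤ.- + 1) (ℕ.<-trans 0<n n<2n)) (h (+ 1) k N))))
              (ℤ.+-monoˡ-< (k ℤ.* N) {+ 0} {+ 1} (+<+ z<s))
    <kN : ε (ℤ.- + 1 ℤ.+ p) ℤ.< k ℤ.* N
    <kN = subst₂ ℤ._<_ (sym (trans (ε-down (k ℤ.- + 1) (ℕ.<-trans 0<n n<2n)) (h (ℤ.- + 1) k N))) (ℤ.+-identityˡ (k ℤ.* N))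
              (ℤ.+-monoˡ-< (k ℤ.* N) {ℤ.- + 1} {+ 0} ℤ.-<+)

  module _ {w g : ℤ → ℤ} (I : Inverse w g) where
    open Inverse I renaming (equivariant to E; equivariant⁻ to F)

    g-entry : ∀ q k → g (ε q) ≢ k ℤ.* N
    g-entry q k e = ε≢ q k (trans (sym (w∘g (ε q))) (trans (cong w e) (mult-fixed E k)))

    -- The inverse takes the mirror image 2N - z to 2N - g z. Exactly one of x and 2N - x is at most
    -- N unless x = N, and `g` takes no entry to a multiple of N.
    bead-mirror : ∀ q → bead (+ 0) g (ℤ.- (+ 1 ℤ.+ q)) ≡ not (bead (+ 0) g q)
    bead-mirror q = trans (cong (λ x → does (x ℤ.≤? N ℤ.+ + 0)) g-mirror) (go (x ℤ.≤? N ℤ.+ + 0))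
      where
      x = g (ε q)
      h : ∀ x N → + 2 ℤ.* N ℤ.- x ≡ ℤ.- x ℤ.+ + 2 ℤ.* N
      h = solve-∀
      g-mirror : g (ε (ℤ.- (+ 1 ℤ.+ q))) ≡ + 2 ℤ.* N ℤ.- x
      g-mirror = trans (cong g (trans (ε-mirror q) (h (ε q) N))) (trans (reflect F (+ 2) (ε q)) (sym (h x N)))
      go : (x≤N : Dec (x ℤ.≤ N ℤ.+ + 0)) → does (+ 2 ℤ.* N ℤ.- x ℤ.≤? N ℤ.+ + 0) ≡ not (does x≤N)
      go (yes p) = dec-false (+ 2 ℤ.* N ℤ.- x ℤ.≤? N ℤ.+ + 0) λ r → g-entry q (+ 1) (trans (ℤ.≤-antisym p (≤-via r (h₁ x N))) (h₂ N))
        where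
        h₁ : ∀ x N → N ℤ.+ + 0 ℤ.- (+ 2 ℤ.* N ℤ.- x) ≡ x ℤ.- (N ℤ.+ + 0)
        h₁ = solve-∀
        h₂ : ∀ N → N ℤ.+ + 0 ≡ + 1 ℤ.* N
        h₂ = solve-∀
      go (no p) = dec-true (+ 2 ℤ.* N ℤ.- x ℤ.≤? N ℤ.+ + 0) (≤-via (ℤ.<⇒≤ (ℤ.≰⇒> p)) (h₁ x N))
        where
        h₁ : ∀ x N → x ℤ.- (N ℤ.+ + 0) ≡ N ℤ.+ + 0 ℤ.- (+ 2 ℤ.* N ℤ.- x)
        h₁ = solve-∀

    -- Seen through the inverse, the bead w j - m N is the entry that `g` takes to j - m N. One
    -- comparison with N thus replaces the two witnesses j and m.
    Bead⇒ : ∀ e → Bead w e → ∃[ q ] e ≡ ε q × bead (+ 0) g q ≡ true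
    Bead⇒ e (j , m , 1≤j , j≤2n , refl) with label (w (+ j) ℤ.- + (m * Nℕ))
    ... | multiple k x = contradiction 1≤j (ℕ.<⇒≱ (subst (_< 1) (sym j≡0) z<s))
      where
      wj : w (+ j) ≡ (k ℤ.+ + m) ℤ.* N
      wj = trans (h (w (+ j)) (+ (m * Nℕ))) (trans (cong₂ ℤ._+_ x (ℤ.pos-* m Nℕ)) (sym (ℤ.*-distribʳ-+ N k (+ m))))
        where
        h : ∀ x y → x ≡ x ℤ.- y ℤ.+ y
        h = solve-∀
      j≡0 : j ≡ 0
      j≡0 = proj₁ (euclid-unique Nℕ j 0 (+ 0) (k ℤ.+ + m) (s≤s j≤2n) z<s (trans (+0* (+ j) N)
              (trans (sym (g∘w (+ j))) (trans (cong g wj) (trans (mult-fixed F (k ℤ.+ + m)) (sym (ℤ.+-identityˡ _)))))))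
    ... | entry q x = q , x , dec-true (g (ε q) ℤ.≤? N ℤ.+ + 0) (subst (ℤ._≤ N ℤ.+ + 0) (sym gεq) (≤-via (ℤ.+-mono-≤ (+≤+ (ℕ.m≤n⇒m≤1+n j≤2n)) (ℤ.neg-mono-≤ {+ 0} {+ (m * Nℕ)} (+≤+ z≤n))) (h N (+ j) (+ (m * Nℕ)))))
      where
      h : ∀ N j y → N ℤ.+ ℤ.- + 0 ℤ.- (j ℤ.+ ℤ.- y) ≡ N ℤ.+ + 0 ℤ.- (j ℤ.- y)
      h = solve-∀
      -m : ∀ x → x ℤ.- + (m * Nℕ) ≡ x ℤ.+ (ℤ.- + m) ℤ.* N
      -m x = trans (cong (λ y → x ℤ.- y) (ℤ.pos-* m Nℕ)) (h′ x (+ m) N)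
        where
        h′ : ∀ x m N → x ℤ.- m ℤ.* N ≡ x ℤ.+ (ℤ.- m) ℤ.* N
        h′ = solve-∀
      gεq : g (ε q) ≡ + j ℤ.- + (m * Nℕ)
      gεq = trans (cong g (trans (sym x) (-m (w (+ j))))) (trans (shift F (ℤ.- + m) (w (+ j)))
              (trans (cong (ℤ._+ (ℤ.- + m) ℤ.* N) (g∘w (+ j))) (sym (-m (+ j)))))

    Bead⇐ : ∀ q → bead (+ 0) g q ≡ true → Bead w (ε q)
    Bead⇐ q t = go (y %ℕ Nℕ) (y /ℕ Nℕ) (a≡a%ℕn+[a/ℕn]*n y Nℕ) (n%ℕd<d y Nℕ)
      where
      y = g (ε q)
      y≤N : y ℤ.≤ N ℤ.+ + 0
      y≤N = does-true (y ℤ.≤? N ℤ.+ + 0) t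
      go : ∀ r c → y ≡ + r ℤ.+ c ℤ.* N → r < Nℕ → Bead w (ε q)
      go zero c e _ = contradiction (trans e (ℤ.+-identityˡ _)) (g-entry q c)
      go (suc r) (+ suc c) e _ = contradiction y≤N (ℤ.<⇒≱ (subst (N ℤ.+ + 0 ℤ.<_) (sym e)
          (<-via (ℤ.+-mono-<-≤ {+ 0} {+ suc r} {+ 0} {+ c ℤ.* N} (+<+ z<s) (subst (+ 0 ℤ.≤_) (ℤ.pos-* c Nℕ) (+≤+ z≤n))) (h (+ suc r) (+ c) N))))
        where
        h : ∀ r c N → r ℤ.+ c ℤ.* N ℤ.- (+ 0 ℤ.+ + 0) ≡ r ℤ.+ (+ 1 ℤ.+ c) ℤ.* N ℤ.- (N ℤ.+ + 0)
        h = solve-∀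
      go (suc r) (+ zero) e r< = suc r , 0 , s≤s z≤n , s≤s⁻¹ r< , trans (sym (w∘g (ε q))) (trans (cong w (trans e (+0* (+ suc r) N))) (sym (ℤ.+-identityʳ _)))
      go (suc r) -[1+ c ] e r< = suc r , suc c , s≤s z≤n , s≤s⁻¹ r< ,
          trans (sym (w∘g (ε q))) (trans (cong w e) (trans (shift E -[1+ c ] (+ suc r)) (cong (λ x → w (+ suc r) ℤ.+ x) (trans (sym (ℤ.neg-distribˡ-* (+ suc c) N)) (cong ℤ.-_ (sym (ℤ.pos-* (suc c) Nℕ)))))))

    Gap⇒ : ∀ e → Gap w e → ∃[ q ] e ≡ ε q × bead (+ 0) g q ≡ false
    Gap⇒ e (N∤e , ¬bead) with label e
    ... | multiple k refl = contradiction (∣⇒∣ᵤ (divides k refl)) N∤e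
    ... | entry q refl with bead (+ 0) g q in eq
    ...   | true  = contradiction (Bead⇐ q eq) ¬bead
    ...   | false = q , refl , eq

    Gap⇐ : ∀ q → bead (+ 0) g q ≡ false → Gap w (ε q)
    Gap⇐ q f = (λ d → case (∣ᵤ⇒∣ d)) , λ b → case′ (Bead⇒ (ε q) b)
      where
      case : N ∣ₛ ε q → ⊥
      case (divides k e) = ε≢ q k e
      case′ : ¬ (∃[ q′ ] ε q ≡ ε q′ × bead (+ 0) g q′ ≡ true)
      case′ (q′ , e , t) with refl ← ε-injective e with () ← trans (sym f) t

    h₀ : ℤ → ℕ
    h₀ = height 0 F

    -- By `bead-mirror` the left side counts the gaps before p, so the abacus is balanced: gaps
    -- before p minus beads from p on is p. This turns bounds on rows into bounds on columns.
    h₀-mirror : ∀ p → + h₀ (ℤ.- p) ≡ + h₀ p ℤ.+ p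
    h₀-mirror = ℤ-ind (λ p → + h₀ (ℤ.- p) ≡ + h₀ p ℤ.+ p) (sym (ℤ.+-identityʳ _))
        (λ p e → trans (cong +_ (step-down p)) (trans (cong (λ x → + bit (not (b p)) ℤ.+ x) (trans e (cong (λ x → + x ℤ.+ p) (height-step 0 F p)))) (sum p)))
        (λ p e → ≡-via (trans (sym (cong +_ (step-down p))) (trans e (sym (sum p))))
                   (trans (k (+ bit (not (b p))) (+ h₀ (ℤ.- p)) (+ (bit (b p) + h₀ (+ 1 ℤ.+ p)) ℤ.+ p)) (cong (λ x → + h₀ (ℤ.- p) ℤ.- (+ x ℤ.+ p)) (sym (height-step 0 F p)))))
      where
      b = bead (+ 0) g
      neg-suc : ∀ p → + 1 ℤ.+ ℤ.- (+ 1 ℤ.+ p) ≡ ℤ.- p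
      neg-suc = solve-∀
      k : ∀ c x y → c ℤ.+ x ℤ.- (c ℤ.+ y) ≡ x ℤ.- y
      k = solve-∀
      step-down : ∀ p → h₀ (ℤ.- (+ 1 ℤ.+ p)) ≡ bit (not (b p)) + h₀ (ℤ.- p)
      step-down p = trans (height-step 0 F (ℤ.- (+ 1 ℤ.+ p))) (cong₂ _+_ (cong bit (bead-mirror p)) (cong h₀ (neg-suc p)))
      sum : ∀ p → + bit (not (b p)) ℤ.+ (+ (bit (b p) + h₀ (+ 1 ℤ.+ p)) ℤ.+ p) ≡ + h₀ (+ 1 ℤ.+ p) ℤ.+ (+ 1 ℤ.+ p)
      sum p with b p
      ... | true  = l (+ h₀ (+ 1 ℤ.+ p)) p
        where
        l : ∀ x p → + 0 ℤ.+ (+ 1 ℤ.+ x ℤ.+ p) ≡ x ℤ.+ (+ 1 ℤ.+ p)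
        l = solve-∀
      ... | false = l (+ h₀ (+ 1 ℤ.+ p)) p
        where
        l : ∀ x p → + 1 ℤ.+ (x ℤ.+ p) ≡ x ℤ.+ (+ 1 ℤ.+ p)
        l = solve-∀

    beads-from : ∀ e p → (∀ q → p ℤ.≤ q → e ℤ.≤ ε q) → (∀ q → e ℤ.≤ ε q → p ℤ.≤ q) → HasCardinality (λ z → Bead w z × e ℤ.≤ z) (h₀ p)
    beads-from e p to from = cardinality-resp
      (λ { _ (q , refl , l , t) → Bead⇐ q t , to q l })
      (λ z (b , l) → let q , x , t = Bead⇒ z b in q , x , from q (subst (e ℤ.≤_) x l) , t)
      (card-above 0 F p)

    gaps-below : ∀ e p → (∀ q → p ℤ.≤ q → e ℤ.≤ ε q) → (∀ q → e ℤ.≤ ε q → p ℤ.≤ q) → HasCardinality (λ z → Gap w z × z ℤ.< e) (h₀ (ℤ.- p))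
    gaps-below e p to from = cardinality-resp ⇒ ⇐ (cardinality-map (λ z → + 2 ℤ.* N ℤ.- z) (λ z → + 2 ℤ.* N ℤ.- z) (invol N) (invol N) (card-above 0 F (ℤ.- p)))
      where
      invol : ∀ N z → + 2 ℤ.* N ℤ.- (+ 2 ℤ.* N ℤ.- z) ≡ z
      invol = solve-∀
      ⇒ : ∀ z → Above 0 g (ℤ.- p) (+ 2 ℤ.* N ℤ.- z) → Gap w z × z ℤ.< e
      ⇒ z (q , x , l , t) = subst (λ y → Gap w y × y ℤ.< e) (sym z≡)
          (Gap⇐ q′ (trans (bead-mirror q) (cong not t)) , ℤ.≰⇒> λ e≤ → ℤ.<⇒≱ (<-via {q′} {+ 1 ℤ.+ q′} (1+≤⇒< ℤ.≤-refl) refl) (ℤ.≤-trans (≤-via l (j p q)) (from q′ e≤)))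
        where
        q′ = ℤ.- (+ 1 ℤ.+ q)
        z≡ : z ≡ ε q′
        z≡ = trans (sym (invol N z)) (trans (cong (λ y → + 2 ℤ.* N ℤ.- y) x) (sym (ε-mirror q)))
        j : ∀ p q → q ℤ.- (ℤ.- p) ≡ p ℤ.- (+ 1 ℤ.+ ℤ.- (+ 1 ℤ.+ q))
        j = solve-∀
      ⇐ : ∀ z → Gap w z × z ℤ.< e → Above 0 g (ℤ.- p) (+ 2 ℤ.* N ℤ.- z)
      ⇐ z (gap , z<e) with Gap⇒ z gap
      ... | q , refl , f = ℤ.- (+ 1 ℤ.+ q) , sym (ε-mirror q) , ℤ.neg-mono-≤ (<⇒1+≤ (ℤ.≰⇒> λ p≤q → ℤ.<⇒≱ z<e (to q p≤q))) , trans (bead-mirror q) (cong not f)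

-- Diagrams through heights, and the parity conditions.

ct : Box → ℤ
ct x = + col x ℤ.- + row x

-- Two bits and their negations add up to 2, so both sums have the same parity.
even-flip : ∀ b₀ b₁ M → 2 ∣ bit (not b₁) + (bit (not b₀) + M) → 2 ∣ bit b₀ + (bit b₁ + M)
even-flip true  true  M p = ∣m∣n⇒∣m+n ∣-refl p
even-flip true  false M p = p
even-flip false true  M p = p
even-flip false false M p = ∣m+n∣m⇒∣n p ∣-refl

module Diagrams (X : QuotientType) (n : ℕ) .{{_ : NonZero n}} (rank : minRank X ≤ n) where
  open Quotient X n renaming (N to Nℕ)
  open Index n
  open Generators X n
  open Lengths X n rank
  open Abacus X n rank
  open Shape X n rank
  open Words X n rank using (s-equivariant; s-involutive)
  open Equivariant

  module _ {T : ℕ} {g : ℤ → ℤ} (F : Equivariant g) where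
    height-antitone : ∀ {d d′} → d ℤ.≤ d′ → height T F d′ ≤ height T F d
    height-antitone {d} l with ≤⇒∃ l
    ... | m , refl = go m
      where
      go : ∀ m → height T F (+ m ℤ.+ d) ≤ height T F d
      go zero = ℕ.≤-reflexive (cong (height T F) (ℤ.+-identityˡ d))
      go (suc m) = ℕ.≤-trans (ℕ.m≤n+m (height T F (+ suc m ℤ.+ d)) (bit (bead (+ T) g (+ m ℤ.+ d))))
        (ℕ.≤-trans (ℕ.≤-reflexive (trans (cong (λ x → bit (bead (+ T) g (+ m ℤ.+ d)) + height T F x) (ℤ.+-assoc (+ 1) (+ m) d)) (sym (height-step T F (+ m ℤ.+ d))))) (go m))

  module _ {w g : ℤ → ℤ} (I : Inverse w g) where
    open Inverse I renaming (equivariant to E; equivariant⁻ to F)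

    private
      h₀m : ∀ p → + h₀ I (ℤ.- p) ≡ + h₀ I p ℤ.+ p
      h₀m = h₀-mirror I

    -- The rectangle at the content of x is the decisive one. A rectangle cut at p ≥ ct x gives the
    -- bound through its number of rows, and one cut at p < ct x through its number of columns,
    -- translated by `h₀-mirror`.
    𝒞⇔ : ∀ x → x ∈ 𝒞 w ⇔ row x ≤ h₀ I (ct x)
    𝒞⇔ x = mk⇔ to from
      where
      from : row x ≤ h₀ I (ct x) → x ∈ 𝒞 w
      from r≤ = ε (ct x) , h₀ I (ct x) , h₀ I (ℤ.- ct x) , beads-from I (ε (ct x)) (ct x) (λ _ → ε-mono-≤) (λ _ → ε-cancel-≤)
        , gaps-below I (ε (ct x)) (ct x) (λ _ → ε-mono-≤) (λ _ → ε-cancel-≤) , r≤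
        , ℤ.drop‿+≤+ (subst₂ ℤ._≤_ (k (+ row x) (+ col x)) (sym (h₀m (ct x))) (ℤ.+-monoˡ-≤ (ct x) (+≤+ r≤)))
        where
        k : ∀ r c → r ℤ.+ (c ℤ.- r) ≡ c
        k = solve-∀
      to : x ∈ 𝒞 w → row x ≤ h₀ I (ct x)
      to (e , y , z , cy , cz , r≤y , c≤z) with cut e
      ... | p , up-p , down-p with ct x ℤ.≤? p
      ...   | yes l = ℕ.≤-trans r≤h (height-antitone F l)
        where
        r≤h = ℕ.≤-trans r≤y (ℕ.≤-reflexive (cardinality-unique (λ _ q → q) (λ _ q → q) cy (beads-from I e p up-p down-p)))
      ...   | no ¬l = ℤ.drop‿+≤+ (≤-via (ℤ.≤-trans (+≤+ (ℕ.≤-trans c≤h (height-antitone F (ℤ.neg-mono-≤ (ℤ.<⇒≤ (ℤ.≰⇒> ¬l)))))) (ℤ.≤-reflexive (h₀m (ct x))))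
              (k (+ row x) (+ col x) (+ h₀ I (ct x))))
        where
        c≤h = ℕ.≤-trans c≤z (ℕ.≤-reflexive (cardinality-unique (λ _ q → q) (λ _ q → q) cz (gaps-below I e p up-p down-p)))
        k : ∀ r c h → h ℤ.+ (c ℤ.- r) ℤ.- c ≡ h ℤ.- r
        k = solve-∀

    𝒞-partition : IsPartition (𝒞 w)
    -- On contents d ≥ 0 rows are at most h 0, and d is below the bound past which heights vanish;
    -- their sum bounds the column. Negative contents follow by mirroring.
    𝒞-partition = (h₀ I (+ 0) + bound 0 g , bounded)
        , λ { x y r≤ c≤ (e , p , q , cp , cq , ry , cy) → e , p , q , cp , cq , ℕ.≤-trans r≤ ry , ℕ.≤-trans c≤ cy }
      where
      K = bound 0 g
      small : ∀ d → 1 ≤ h₀ I d → d ℤ.< + K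
      small d 1≤ = ℤ.≰⇒> λ K≤d → ℕ.<⇒≱ 1≤ (ℕ.≤-reflexive (height-high 0 F d K≤d))
      cap : ∀ d r → 1 ≤ r → r ≤ h₀ I d → + 0 ℤ.≤ d → r ≤ h₀ I (+ 0) + K × (∀ c → + c ≡ + r ℤ.+ d → c ≤ h₀ I (+ 0) + K)
      cap d r 1≤r r≤ 0≤d = ℕ.≤-trans r≤h (ℕ.m≤m+n _ K)
          , λ c e → ℤ.drop‿+≤+ (subst (ℤ._≤ _) (sym e) (ℤ.+-mono-≤ (+≤+ r≤h) (ℤ.<⇒≤ (small d (ℕ.≤-trans 1≤r r≤)))))
        where
        r≤h = ℕ.≤-trans r≤ (height-antitone F 0≤d)
      bounded : ∀ x → x ∈ 𝒞 w → row x ≤ h₀ I (+ 0) + K × col x ≤ h₀ I (+ 0) + K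
      bounded x x∈ with + 0 ℤ.≤? ct x
      ... | yes 0≤ = let p , q = cap (ct x) (row x) (s≤s z≤n) r≤ 0≤ in p , q (col x) (k (+ row x) (+ col x))
        where
        r≤ = Equivalence.to (𝒞⇔ x) x∈
        k : ∀ r c → c ≡ r ℤ.+ (c ℤ.- r)
        k = solve-∀
      ... | no 0≰ = let p , q = cap (ℤ.- ct x) (col x) (s≤s z≤n) c≤ (ℤ.neg-mono-≤ (ℤ.<⇒≤ (ℤ.≰⇒> 0≰))) in q (row x) (k (+ row x) (+ col x)) , p
        where
        k : ∀ r c → r ≡ c ℤ.+ ℤ.- (c ℤ.- r)
        k = solve-∀
        k′ : ∀ r c → r ℤ.+ (c ℤ.- r) ≡ c
        k′ = solve-∀
        c≤ : col x ≤ h₀ I (ℤ.- ct x)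
        c≤ = ℤ.drop‿+≤+ (subst₂ ℤ._≤_ (k′ (+ row x) (+ col x)) (sym (h₀m (ct x))) (ℤ.+-monoˡ-≤ (ct x) (+≤+ (Equivalence.to (𝒞⇔ x) x∈))))

    Crossing : ℕ → ℤ → Set
    Crossing T z = z ℤ.≤ + T × + suc T ℤ.≤ w z

    -- Adding N turns a crossing z into the label w z + N, at a position from T on, which `g` takes
    -- to z + N, at most N + T. The threshold is made for this: T = 0 gives `Even₀` and T = n gives
    -- `Evenₙ`.
    crossing-card : ∀ T → T ≤ n → HasCardinality (Crossing T) (height T F (+ T))
    crossing-card T T≤n = cardinality-resp ⇒ ⇐ (cardinality-map (λ e → g e ℤ.- N) (λ z → w (z) ℤ.+ N) inv₁ inv₂ (card-above T F (+ T)))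
      where
      -N : ∀ x N → x ℤ.- N ≡ x ℤ.+ -[1+ 0 ] ℤ.* N
      -N = solve-∀
      +N : ∀ x N → x ℤ.+ N ≡ x ℤ.+ + 1 ℤ.* N
      +N = solve-∀
      +-N : ∀ x N → x ℤ.+ -[1+ 0 ] ℤ.* N ℤ.+ N ≡ x
      +-N = solve-∀
      inv₁ : ∀ e → w (g e ℤ.- N) ℤ.+ N ≡ e
      inv₁ e = trans (cong (λ x → w x ℤ.+ N) (-N (g e) N)) (trans (cong (ℤ._+ N) (trans (shift E -[1+ 0 ] (g e)) (cong (ℤ._+ -[1+ 0 ] ℤ.* N) (w∘g e)))) (+-N e N))
      gw+N : ∀ z → g (w z ℤ.+ N) ≡ z ℤ.+ N
      gw+N z = trans (cong g (+N (w z) N)) (trans (shift F (+ 1) (w z)) (trans (cong (ℤ._+ + 1 ℤ.* N) (g∘w z)) (sym (+N z N))))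
      inv₂ : ∀ z → g (w z ℤ.+ N) ℤ.- N ≡ z
      inv₂ z = trans (cong (ℤ._- N) (gw+N z)) (k z N)
        where
        k : ∀ z N → z ℤ.+ N ℤ.- N ≡ z
        k = solve-∀
      εT : ε (+ T) ≡ + suc T ℤ.+ N
      εT = trans (cong ε (sym (+0* (+ T) P))) (trans (ε-up (+ 0) (ℕ.≤-<-trans T≤n n<2n)) (k (+ suc T) N))
        where
        k : ∀ x N → x ℤ.+ (+ 1 ℤ.+ + 0) ℤ.* N ≡ x ℤ.+ N
        k = solve-∀
      cancel-N : ∀ x y N → y ℤ.- x ≡ y ℤ.+ N ℤ.- (x ℤ.+ N)
      cancel-N = solve-∀
      comm-N : ∀ x T N → T ℤ.- x ≡ N ℤ.+ T ℤ.- (x ℤ.+ N)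
      comm-N = solve-∀
      ⇒ : ∀ z → Above T g (+ T) (w z ℤ.+ N) → Crossing T z
      ⇒ z (q , e , T≤q , t) =
          ≤-via (subst (ℤ._≤ N ℤ.+ + T) (trans (cong g (sym e)) (gw+N z)) (does-true (g (ε q) ℤ.≤? N ℤ.+ + T) t)) (sym (comm-N z (+ T) N))
        , ≤-via (subst₂ ℤ._≤_ εT (sym e) (ε-mono-≤ T≤q)) (sym (cancel-N (+ suc T) (w z) N))
      ⇐ : ∀ z → Crossing T z → Above T g (+ T) (w z ℤ.+ N)
      ⇐ z (z≤T , T<wz) with label (w z ℤ.+ N)
      ... | entry q e = q , e , ε-cancel-≤ (subst₂ ℤ._≤_ (sym εT) e (ℤ.+-monoˡ-≤ N T<wz))
              , dec-true (g (ε q) ℤ.≤? N ℤ.+ + T) (subst (ℤ._≤ N ℤ.+ + T) (sym (trans (cong g (sym e)) (gw+N z))) (≤-via z≤T (comm-N z (+ T) N)))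
      -- In this case z and w z are the same multiple of N, so z does not cross.
      ... | multiple k e = contradiction z≤T (ℤ.<⇒≱ (subst (+ T ℤ.<_) (+ʳ-cancel N (trans e (sym z+N))) (1+≤⇒< T<wz)))
        where
        z+N : z ℤ.+ N ≡ k ℤ.* N
        z+N = trans (sym (gw+N z)) (trans (cong g e) (mult-fixed F k))

    even⇒ : ∀ T → T ≤ n → HasEvenCardinality (Crossing T) → 2 ∣ height T F (+ T)
    even⇒ T T≤n (k , c , 2∣k) = subst (2 ∣_) (cardinality-unique (λ _ q → q) (λ _ q → q) c (crossing-card T T≤n)) 2∣k

    even⇐ : ∀ T → T ≤ n → 2 ∣ height T F (+ T) → HasEvenCardinality (Crossing T)
    even⇐ T T≤n 2∣ = _ , crossing-card T T≤n , 2∣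

    bead-about₀ : ∀ q → bead (+ 0) g (ℤ.- + 1 ℤ.- q) ≡ not (bead (+ 0) g q)
    bead-about₀ q = trans (cong (bead (+ 0) g) (k q)) (bead-mirror I q)
      where
      k : ∀ q → ℤ.- + 1 ℤ.- q ≡ ℤ.- (+ 1 ℤ.+ q)
      k = solve-∀

    -- Here the mirror acts on values as x ↦ 3N - x. As 2(N + n) = 3N - 1 is odd, exactly one of x
    -- and 3N - x is at most N + n.
    bead-aboutₙ : ∀ q → bead (+ n) g (P ℤ.+ ℤ.- (+ 1 ℤ.+ q)) ≡ not (bead (+ n) g q)
    bead-aboutₙ q = trans (cong (λ x → does (x ℤ.≤? N ℤ.+ + n)) g-mirror) (go (x ℤ.≤? N ℤ.+ + n))
      where
      x = g (ε q)
      k₀ : ∀ q P → P ℤ.+ ℤ.- (+ 1 ℤ.+ q) ≡ ℤ.- (+ 1 ℤ.+ q) ℤ.+ + 1 ℤ.* P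
      k₀ = solve-∀
      k₁ : ∀ x N → + 2 ℤ.* N ℤ.- x ℤ.+ + 1 ℤ.* N ≡ ℤ.- x ℤ.+ + 3 ℤ.* N
      k₁ = solve-∀
      N≡ : N ≡ + 1 ℤ.+ (+ n ℤ.+ + n)
      N≡ = cong (λ x → + 1 ℤ.+ x) P≡
      g-mirror : g (ε (P ℤ.+ ℤ.- (+ 1 ℤ.+ q))) ≡ ℤ.- x ℤ.+ + 3 ℤ.* N
      g-mirror = trans (cong g (trans (cong ε (k₀ q P)) (trans (ε-shift (+ 1) (ℤ.- (+ 1 ℤ.+ q)))
                   (trans (cong (ℤ._+ + 1 ℤ.* N) (ε-mirror q)) (k₁ (ε q) N))))) (reflect F (+ 3) (ε q))
      diff : ∀ {N} m x → N ≡ + 1 ℤ.+ (m ℤ.+ m) → ℤ.- x ℤ.+ + 3 ℤ.* N ℤ.- (+ 1 ℤ.+ (N ℤ.+ m)) ≡ N ℤ.+ m ℤ.- x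
      diff m x refl = k m x
        where
        k : ∀ m x → ℤ.- x ℤ.+ + 3 ℤ.* (+ 1 ℤ.+ (m ℤ.+ m)) ℤ.- (+ 1 ℤ.+ (+ 1 ℤ.+ (m ℤ.+ m) ℤ.+ m)) ≡ + 1 ℤ.+ (m ℤ.+ m) ℤ.+ m ℤ.- x
        k = solve-∀
      diff′ : ∀ {N} m x → N ≡ + 1 ℤ.+ (m ℤ.+ m) → x ℤ.- (+ 1 ℤ.+ (N ℤ.+ m)) ≡ N ℤ.+ m ℤ.- (ℤ.- x ℤ.+ + 3 ℤ.* N)
      diff′ m x refl = k m x
        where
        k : ∀ m x → x ℤ.- (+ 1 ℤ.+ (+ 1 ℤ.+ (m ℤ.+ m) ℤ.+ m)) ≡ + 1 ℤ.+ (m ℤ.+ m) ℤ.+ m ℤ.- (ℤ.- x ℤ.+ + 3 ℤ.* (+ 1 ℤ.+ (m ℤ.+ m)))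
        k = solve-∀
      go : (d : Dec (x ℤ.≤ N ℤ.+ + n)) → does (ℤ.- x ℤ.+ + 3 ℤ.* N ℤ.≤? N ℤ.+ + n) ≡ not (does d)
      go (yes p) = dec-false (ℤ.- x ℤ.+ + 3 ℤ.* N ℤ.≤? N ℤ.+ + n) (ℤ.<⇒≱ (1+≤⇒< (≤-via p (sym (diff (+ n) x N≡)))))
      go (no p) = dec-true (ℤ.- x ℤ.+ + 3 ℤ.* N ℤ.≤? N ℤ.+ + n) (≤-via (<⇒1+≤ (ℤ.≰⇒> p)) (diff′ (+ n) x N≡))

    bead-centre : ∀ {A B} → Special A B → ∀ q r → q ℤ.+ r ≡ + B ℤ.+ + B ℤ.- + 1 → bead (+ B) g q ≡ not (bead (+ B) g r)
    bead-centre (bottom _) q r e = trans (cong (bead (+ 0) g) (≡-via e (k q r))) (bead-about₀ r)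
      where
      k : ∀ q r → q ℤ.+ r ℤ.- (+ 0 ℤ.+ + 0 ℤ.- + 1) ≡ q ℤ.- (ℤ.- + 1 ℤ.- r)
      k = solve-∀
    bead-centre (top _ _ _) q r e = trans (cong (bead (+ n) g) (≡-via (trans e (cong (ℤ._- + 1) (sym P≡))) (k q r P))) (bead-aboutₙ r)
      where
      k : ∀ q r P → q ℤ.+ r ℤ.- (P ℤ.- + 1) ≡ q ℤ.- (P ℤ.+ ℤ.- (+ 1 ℤ.+ r))
      k = solve-∀

    B≤n : ∀ {A B} → Special A B → B ≤ n
    B≤n (bottom _) = z≤n
    B≤n (top _ _ _) = ℕ.≤-refl

    fr-B : ∀ {B} → B ≤ n → fr (+ B) ≡ B
    fr-B {B} B≤n = trans (cong fr (sym (+0* (+ B) P))) (fr-up (+ 0) B≤n)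

    separate : ∀ {A B A′ B′} → Special A B → Special A′ B′ → B ≢ B′ → B ≢ A′
    separate (bottom _) sp′ _ refl with special-inner sp′
    ... | _ , () , _
    separate (top _ _ _) sp′ _ refl with special-inner sp′
    ... | _ , e , l = ℕ.<⇒≢ l (sym e)

    -- Only the D-variant with the same B changes the height at B. It puts the bits of B - 2 and B -
    -- 1 in the place of those of B and B + 1, which by mirroring are their negations, so the parity
    -- survives.
    even-generator : ∀ {A B} → Special A B → (i : Fin (suc n)) (F′ : Equivariant (g ∘ s i)) →
      2 ∣ height B F (+ B) → 2 ∣ height B F′ (+ B)
    even-generator {A} {B} sp i F′ 2∣ with kind 2≤n i
    ... | adjacent e ns = subst (2 ∣_) (sym (trans (height-cong B F′ S.E′ (λ z → cong g (e z)) (+ B))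
            (S.height-off (+ B) λ x → ns A (subst (Special A) (trans (sym (fr-B (B≤n sp))) x) sp)))) 2∣
      where module S = Swap B F (toℕ i)
    ... | double A′ sp′ e with B ≟ toℕ i
    ...   | no B≢ = subst (2 ∣_) (sym (trans (height-cong B F′ S.E′ (λ z → cong g (e z)) (+ B))
              (S.height-off (+ B) (separate sp sp′ B≢ ∘ trans (sym (fr-B (B≤n sp)))) (B≢ ∘ trans (sym (fr-B (B≤n sp))))))) 2∣
      where module S = Swap₂ B F sp′
    ...   | yes refl = subst (2 ∣_) (sym (trans (height-cong B F′ S.E′ (λ z → cong g (e z)) (+ B)) (S.height-D (+ B) (fr-B (B≤n sp)))))
              (even-flip (b (ℤ.- + 2 ℤ.+ + B)) (b (ℤ.- + 1 ℤ.+ + B)) (height B F (+ 2 ℤ.+ + B)) (subst (2 ∣_) old 2∣))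
      where
      module S = Swap₂ B F sp′
      b = bead (+ B) g
      k₁ : ∀ D → D ℤ.+ (ℤ.- + 1 ℤ.+ D) ≡ D ℤ.+ D ℤ.- + 1
      k₁ = solve-∀
      k₂ : ∀ D → + 1 ℤ.+ D ℤ.+ (ℤ.- + 2 ℤ.+ D) ≡ D ℤ.+ D ℤ.- + 1
      k₂ = solve-∀
      k₃ : ∀ D → + 1 ℤ.+ (+ 1 ℤ.+ D) ≡ + 2 ℤ.+ D
      k₃ = solve-∀
      old : height B F (+ B) ≡ bit (not (b (ℤ.- + 1 ℤ.+ + B))) + (bit (not (b (ℤ.- + 2 ℤ.+ + B))) + height B F (+ 2 ℤ.+ + B))
      old = trans (height-step B F (+ B)) (cong₂ _+_ (cong bit (bead-centre sp (+ B) _ (k₁ (+ B))))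
              (trans (height-step B F (+ 1 ℤ.+ + B)) (cong₂ _+_ (cong bit (bead-centre sp (+ 1 ℤ.+ + B) _ (k₂ (+ B)))) (cong (height B F) (k₃ (+ B))))))

  W̃-closed : ∀ i {w} → w ∈ W̃ → (s i ∘ w) ∈ W̃
  W̃-closed i {w} (M , e₀ , eₙ) = record
      { bijective = (λ {x} {y} p → proj₁ bijective (trans (sym (s-involutive i (w x))) (trans (cong (s i) p) (s-involutive i (w y)))))
                  , λ z → proj₁ (proj₂ bijective (s i z)) , λ { refl → trans (cong (s i) (proj₂ (proj₂ bijective (s i z)) refl)) (s-involutive i z) }
      ; periodic = λ z → trans (cong (s i) (periodic z)) (trans (cong (s i) (+N (w z))) (trans (shift (s-equivariant i) (+ 1) (w z)) (sym (+N (s i (w z))))))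
      ; odd = λ z → trans (cong (s i) (odd z)) (neg (s-equivariant i) (w z)) }
    , (λ v → step 0 (bottom v) (e₀ v)) , λ v → step n (top (n ∸ 1) (ℕ.m+[n∸m]≡n 0<n) v) (eₙ v)
    where
    open Mirrored M
    I = proj₂ (inverse M)
    I′ = ∘-inverse (s-equivariant i) (s-involutive i) I
    +N : ∀ x → x ℤ.+ N ≡ x ℤ.+ + 1 ℤ.* N
    +N x = cong (λ y → x ℤ.+ y) (sym (ℤ.*-identityˡ N))
    step : ∀ B {A} → Special A B → HasEvenCardinality (Crossing I B) → HasEvenCardinality (Crossing I′ B)
    step B sp c = even⇐ I′ B (B≤n I sp) (even-generator I sp i (Inverse.equivariant⁻ I′) (even⇒ I B (B≤n I sp) c))

-- Adjacent boxes, and the reduction to local facts.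

data Edge : Box → Box → Set where
  right : ∀ {r j} → Edge (r , j) (r , suc j)
  left  : ∀ {r j} → Edge (r , suc j) (r , j)
  down  : ∀ {r j} → Edge (r , j) (suc r , j)
  up    : ∀ {r j} → Edge (suc r , j) (r , j)

∣-∣≡1 : ∀ a b → ∣ a - b ∣ ≡ 1 → b ≡ suc a ⊎ a ≡ suc b
∣-∣≡1 zero    b       e = inj₁ e
∣-∣≡1 (suc a) zero    e = inj₂ e
∣-∣≡1 (suc a) (suc b) e = [ (λ p → inj₁ (cong suc p)) , (λ p → inj₂ (cong suc p)) ]′ (∣-∣≡1 a b e)

∣1+n-n∣≡1 : ∀ a → ∣ suc a - a ∣ ≡ 1
∣1+n-n∣≡1 zero    = refl
∣1+n-n∣≡1 (suc a) = ∣1+n-n∣≡1 a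

∣n-1+n∣≡1 : ∀ a → ∣ a - suc a ∣ ≡ 1
∣n-1+n∣≡1 zero    = refl
∣n-1+n∣≡1 (suc a) = ∣n-1+n∣≡1 a

edge : ∀ {x y} → ShareEdge x y → Edge x y
edge {a , b} {c , d} (inj₁ (refl , e)) with ∣-∣≡1 b d e
... | inj₁ refl = right
... | inj₂ refl = left
edge {a , b} {c , d} (inj₂ (refl , e)) with ∣-∣≡1 a c e
... | inj₁ refl = down
... | inj₂ refl = up

shareEdge : ∀ {x y} → Edge x y → ShareEdge x y
shareEdge (right {j = j}) = inj₁ (refl , ∣n-1+n∣≡1 j)
shareEdge (left {j = j})  = inj₁ (refl , ∣1+n-n∣≡1 j)
shareEdge (down {r = r})  = inj₂ (refl , ∣n-1+n∣≡1 r)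
shareEdge (up {r = r})    = inj₂ (refl , ∣1+n-n∣≡1 r)

shareEdge-swap : ∀ {x y} → ShareEdge x y → ShareEdge (swap x) (swap y)
shareEdge-swap (inj₁ e) = inj₂ e
shareEdge-swap (inj₂ e) = inj₁ e

ct-right : ∀ r j → ct (r , suc j) ≡ + 1 ℤ.+ ct (r , j)
ct-right r j = ℤ.+-assoc (+ 1) (+ suc j) (ℤ.- + suc r)

ct-down : ∀ r j → ct (suc r , j) ≡ ℤ.- + 1 ℤ.+ ct (r , j)
ct-down r j = h (+ suc j) (+ suc r)
  where
  h : ∀ j r → j ℤ.- (+ 1 ℤ.+ r) ≡ ℤ.- + 1 ℤ.+ (j ℤ.- r)
  h = solve-∀

ct-swap : ∀ x → ct (swap x) ≡ ℤ.- ct x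
ct-swap x = h (+ row x) (+ col x)
  where
  h : ∀ r c → r ℤ.- c ≡ ℤ.- (c ℤ.- r)
  h = solve-∀

ct-edge : ∀ {x y} → Edge x y → ct y ≡ + 1 ℤ.+ ct x ⊎ ct y ≡ ℤ.- + 1 ℤ.+ ct x
ct-edge (right {r} {j}) = inj₁ (ct-right r j)
ct-edge (left {r} {j})  = inj₂ (trans (sym (h (ct (r , j)))) (cong (λ x → ℤ.- + 1 ℤ.+ x) (sym (ct-right r j))))
  where
  h : ∀ d → ℤ.- + 1 ℤ.+ (+ 1 ℤ.+ d) ≡ d
  h = solve-∀
ct-edge (down {r} {j})  = inj₂ (ct-down r j)
ct-edge (up {r} {j})    = inj₁ (trans (sym (h (ct (r , j)))) (cong (λ x → + 1 ℤ.+ x) (sym (ct-down r j))))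
  where
  h : ∀ d → + 1 ℤ.+ (ℤ.- + 1 ℤ.+ d) ≡ d
  h = solve-∀

module _ {S : Pred Box 0ℓ} where
  private
    Path : Box → Box → Set
    Path = Star (λ u v → ShareEdge u v × v ∈ S)

    path-⊆ : ∀ {x y} → x ∈ S → Path x y → y ∈ S
    path-⊆ x∈S done = x∈S
    path-⊆ _ ((_ , v∈S) ◅ path) = path-⊆ v∈S path

    path-closed : ∀ {x y} (Q : Pred Box 0ℓ) → (∀ {y z} → y ∈ Q → ShareEdge y z → z ∈ S → z ∈ Q) → x ∈ Q → Path x y → y ∈ Q
    path-closed Q step x∈Q done = x∈Q
    path-closed Q step x∈Q ((e , v∈S) ◅ path) = path-closed Q step (step x∈Q e v∈S) path

  component-⊆ : ∀ {x} → Component S x ⊆ S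
  component-⊆ (x∈S , path) = path-⊆ x∈S path

  component-extend : ∀ {x y z} → y ∈ Component S x → ShareEdge y z → z ∈ S → z ∈ Component S x
  component-extend (x∈S , path) e z∈S = x∈S , path ◅◅ ((e , z∈S) ◅ done)

  component-closed : ∀ {x} (Q : Pred Box 0ℓ) → x ∈ Q → (∀ {y z} → y ∈ Q → ShareEdge y z → z ∈ S → z ∈ Q) → Component S x ⊆ Q
  component-closed Q x∈Q step (_ , path) = path-closed Q step x∈Q path

component-swap : ∀ {S : Pred Box 0ℓ} → (∀ z → z ∈ S → swap z ∈ S) → ∀ {x y} → y ∈ Component S x → swap y ∈ Component S (swap x)
component-swap {S} sym-S {x} (x∈S , path) = sym-S x x∈S , go path
  where
  Path : Box → Box → Set
  Path = Star (λ u v → ShareEdge u v × v ∈ S)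
  go : ∀ {x y} → Path x y → Path (swap x) (swap y)
  go done = done
  go (_◅_ {j = v} (e , v∈S) path) = (shareEdge-swap e , sym-S v v∈S) ◅ go path

ascend : ∀ {S : Pred Box 0ℓ} → (∀ r j → (suc r , j) ∈ S → (r , j) ∈ S) → (∀ r j → (r , suc j) ∈ S → (r , j) ∈ S) →
  ∀ x y → row x ≤ row y → col x ≤ col y → y ∈ S → x ∈ S
ascend {S} upS leftS (a , b) (c , d) (s≤s a≤c) (s≤s b≤d) y∈S with ℕ.m≤n⇒∃[o]m+o≡n a≤c | ℕ.m≤n⇒∃[o]m+o≡n b≤d
... | k , refl | l , refl = go-left l (go-up k y∈S)
  where
  go-up : ∀ k {j} → (a + k , j) ∈ S → (a , j) ∈ S
  go-up zero {j} p = subst (λ r → (r , j) ∈ S) (ℕ.+-identityʳ a) p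
  go-up (suc k) {j} p = go-up k (upS (a + k) j (subst (λ r → (r , j) ∈ S) (ℕ.+-suc a k) p))
  go-left : ∀ l → (a , b + l) ∈ S → (a , b) ∈ S
  go-left zero p = subst (λ j → (a , j) ∈ S) (ℕ.+-identityʳ b) p
  go-left (suc l) p = go-left l (leftS a (b + l) (subst (λ j → (a , j) ∈ S) (ℕ.+-suc b l) p))

-- The closure properties of an addable, respectively removable, component of R
-- that are used; they are invariant under transposition.
record AddLike (μ R K : Pred Box 0ℓ) : Set where
  field
    within   : ∀ {x} → x ∈ K → x ∈ R
    closed   : ∀ {x y} → x ∈ K → ShareEdge x y → y ∈ R → y ∈ K
    disjoint : ∀ {x} → x ∈ K → x ∉ μ
    leftward : ∀ r j → (r , suc j) ∈ K → (r , j) ∈ μ ⊎ (r , j) ∈ K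
    upward   : ∀ r j → (suc r , j) ∈ K → (r , j) ∈ μ ⊎ (r , j) ∈ K

record RemoveLike (μ R K : Pred Box 0ℓ) : Set where
  field
    within    : ∀ {x} → x ∈ K → x ∈ R
    closed    : ∀ {x y} → x ∈ K → ShareEdge x y → y ∈ R → y ∈ K
    inside    : ∀ {x} → x ∈ K → x ∈ μ
    -- Doubly negated, as `Removable` only speaks about the boxes of the diagram outside the
    -- component.
    rightward : ∀ r j → (r , j) ∈ K → (r , suc j) ∈ μ → ¬ ((r , suc j) ∉ K)
    downward  : ∀ r j → (r , j) ∈ K → (suc r , j) ∈ μ → ¬ ((suc r , j) ∉ K)

module Transformation (X : QuotientType) (n : ℕ) .{{_ : NonZero n}} (k : ℕ) (μ μ′ : Diagram)
  (μ? : ∀ x → Dec (x ∈ μ)) (μ′? : ∀ x → Dec (x ∈ μ′)) (part : IsPartition μ) (part′ : IsPartition μ′) where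
  open Quotient X n

  R : Pred Box 0ℓ
  R x = HasResidue μ x k

  addable⇒ : ∀ {y} → Addable μ ((k -component) μ y) → AddLike μ R ((k -component) μ y)
  addable⇒ (disj , _ , lower) = record
    { within = component-⊆
    ; closed = component-extend
    ; disjoint = disj _
    ; leftward = λ r j p → lower (r , j) (r , suc j) ℕ.≤-refl (ℕ.n≤1+n _) (inj₂ p)
    ; upward = λ r j p → lower (r , j) (suc r , j) (ℕ.n≤1+n _) ℕ.≤-refl (inj₂ p) }

  removable⇒ : ∀ {y} → Removable μ ((k -component) μ y) → RemoveLike μ R ((k -component) μ y)
  removable⇒ (ins , _ , lower) = record
    { within = component-⊆
    ; closed = component-extend
    ; inside = ins
    ; rightward = λ r j p q ¬K → proj₂ (lower (r , j) (r , suc j) ℕ.≤-refl (ℕ.n≤1+n _) (q , ¬K)) p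
    ; downward = λ r j p q ¬K → proj₂ (lower (r , j) (suc r , j) (ℕ.n≤1+n _) ℕ.≤-refl (q , ¬K)) p }

  -- The component of a new box stays among the new boxes. It is addable: a box left of or above one
  -- of its boxes lies in `μ′`, so it is old or else a new neighbour and thus in the component. The
  -- last hypothesis keeps every other addable component inside `μ′`.
  adds : μ ⊆ μ′ → (∀ {x} → x ∈ μ′ → x ∉ μ → x ∈ R) →
    (∀ {x y} → x ∈ μ′ → x ∉ μ → ShareEdge x y → y ∈ R → y ∈ μ′ × y ∉ μ) →
    (∀ {K} → AddLike μ R K → K ⊆ μ′) → μ′ ≐ addAll k μ
  adds μ⊆μ′ new⊆R new-closed like⊆ = to , from
    where
    to : μ′ ⊆ addAll k μ
    to {x} x∈μ′ with μ? x
    ... | yes x∈μ = inj₁ x∈μ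
    ... | no x∉μ = inj₂ (x , ((λ z z∈C → proj₂ (C⊆ z∈C)) , (bound , bounded) , lower) , x∈R , done)
      where
      x∈R = new⊆R x∈μ′ x∉μ
      C = (k -component) μ x
      C⊆ : ∀ {z} → z ∈ C → z ∈ μ′ × z ∉ μ
      C⊆ = component-closed (λ z → z ∈ μ′ × z ∉ μ) (x∈μ′ , x∉μ) (λ (p , q) → new-closed p q)
      bound = proj₁ (proj₁ part′)
      ⊆μ′ : ∀ z → z ∈ (μ ∪ C) → z ∈ μ′
      ⊆μ′ z = [ μ⊆μ′ , (λ z∈C → proj₁ (C⊆ z∈C)) ]′
      bounded : ∀ z → z ∈ (μ ∪ C) → row z ≤ bound × col z ≤ bound
      bounded z p = proj₂ (proj₁ part′) z (⊆μ′ z p)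
      back : ∀ {y z} → Edge y z → row z ≤ row y → col z ≤ col y → y ∈ (μ ∪ C) → z ∈ (μ ∪ C)
      back {y} {z} e r≤ c≤ (inj₁ p) = inj₁ (proj₂ part z y r≤ c≤ p)
      back {y} {z} e r≤ c≤ (inj₂ p) with μ? z
      ... | yes z∈μ = inj₁ z∈μ
      ... | no z∉μ = inj₂ (component-extend p (shareEdge e) (new⊆R (proj₂ part′ z y r≤ c≤ (proj₁ (C⊆ p))) z∉μ))
      lower : ∀ u v → row u ≤ row v → col u ≤ col v → v ∈ (μ ∪ C) → u ∈ (μ ∪ C)
      lower = ascend (λ r j → back up (ℕ.n≤1+n _) ℕ.≤-refl) (λ r j → back left ℕ.≤-refl (ℕ.n≤1+n _))
    from : addAll k μ ⊆ μ′
    from (inj₁ x∈μ) = μ⊆μ′ x∈μ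
    from (inj₂ (y , add , x∈C)) = like⊆ (addable⇒ add) x∈C

  removes : μ′ ⊆ μ → (∀ {x} → x ∈ μ → x ∉ μ′ → x ∈ R) →
    (∀ {x y} → x ∈ μ → x ∉ μ′ → ShareEdge x y → y ∈ R → y ∈ μ × y ∉ μ′) →
    (∀ {K} → RemoveLike μ R K → ∀ {x} → x ∈ K → x ∉ μ′) → μ′ ≐ removeAll k μ
  removes μ′⊆μ old⊆R old-closed like∉ = to , from
    where
    to : μ′ ⊆ removeAll k μ
    to x∈μ′ = μ′⊆μ x∈μ′ , λ (y , rem , x∈C) → like∉ (removable⇒ rem) x∈C x∈μ′
    from : removeAll k μ ⊆ μ′
    from {x} (x∈μ , kept) with μ′? x
    ... | yes x∈μ′ = x∈μ′
    ... | no x∉μ′ = contradiction (x , ((λ {z} z∈C → proj₁ (C⊆ {z} z∈C)) , (proj₁ (proj₁ part) , λ z p → proj₂ (proj₁ part) z (proj₁ p)) , lower) , x∈R , done) kept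
      where
      x∈R = old⊆R x∈μ x∉μ′
      C = (k -component) μ x
      C⊆ : ∀ {z} → z ∈ C → z ∈ μ × z ∉ μ′
      C⊆ = component-closed (λ z → z ∈ μ × z ∉ μ′) (x∈μ , x∉μ′) (λ (p , q) → old-closed p q)
      forth : ∀ {y z} → Edge z y → row z ≤ row y → col z ≤ col y → y ∈ μ × y ∉ C → z ∈ μ × z ∉ C
      forth {y} {z} e r≤ c≤ (y∈μ , y∉C) = proj₂ part z y r≤ c≤ y∈μ , λ z∈C →
        y∉C (component-extend z∈C (shareEdge e) (old⊆R y∈μ λ y∈μ′ → proj₂ (C⊆ z∈C) (proj₂ part′ z y r≤ c≤ y∈μ′)))
      lower : ∀ u v → row u ≤ row v → col u ≤ col v → v ∈ μ × v ∉ C → u ∈ μ × u ∉ C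
      lower = ascend (λ r j → forth down (ℕ.n≤1+n _) ℕ.≤-refl) (λ r j → forth right ℕ.≤-refl (ℕ.n≤1+n _))

-- Finite tables for the four bits around a centre.

-- Four consecutive positions around a content D of folded residue B carry
-- the bits b₀ b₁ b₂ b₃. Relative to the height at D + 2, old q is the height at
-- D - 1 + q, new q the height after the D-variant of s_B, and newA q the one after s_A.
old : Bool → Bool → Bool → ℕ → ℕ
old b₁ b₂ b₃ 0 = bit b₁ + (bit b₂ + bit b₃)
old b₁ b₂ b₃ 1 = bit b₂ + bit b₃
old b₁ b₂ b₃ 2 = bit b₃
old b₁ b₂ b₃ _ = 0

new : Bool → Bool → Bool → ℕ → ℕ
new b₀ b₁ b₃ 0 = bit b₀ + (bit b₁ + bit b₃)
new b₀ b₁ b₃ 1 = bit b₀ + bit b₁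
new b₀ b₁ b₃ _ = bit b₁

newA : Bool → Bool → Bool → ℕ → ℕ
newA b₀ b₂ b₃ 0 = bit b₀ + (bit b₂ + bit b₃)
newA b₀ b₂ b₃ 1 = bit b₂ + bit b₃
newA b₀ b₂ b₃ _ = bit b₂

flag : Bool → Bool → Bool → Bool → ℕ → Bool
flag b₀ b₁ b₂ b₃ 0 = b₀
flag b₀ b₁ b₂ b₃ 1 = b₁
flag b₀ b₁ b₂ b₃ 2 = b₂
flag b₀ b₁ b₂ b₃ _ = b₃

-- `bandResidues` as decidable tables: for a row of which p band cells lie in the diagram, `resA`
-- marks the offsets q of the outer residue and `resB` those of the central one.
resA resB : ℕ → ℕ → Bool
resA 0 0 = true
resA 1 0 = true
resA 2 2 = true
resA 3 2 = true
resA _ _ = false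
resB 0 0 = true
resB 0 1 = true
resB 1 1 = true
resB 1 2 = true
resB 2 0 = true
resB 2 1 = true
resB 3 1 = true
resB 3 2 = true
resB _ _ = false

bandResidues⇒ : ∀ {a b k q} p → (q , k) ∈ₗ bandResidues a b p → (k ≡ a × resA p q ≡ true) ⊎ (k ≡ b × resB p q ≡ true)
bandResidues⇒ 0 (here refl) = inj₁ (refl , refl)
bandResidues⇒ 0 (there (here refl)) = inj₂ (refl , refl)
bandResidues⇒ 0 (there (there (here refl))) = inj₂ (refl , refl)
bandResidues⇒ 1 (here refl) = inj₁ (refl , refl)
bandResidues⇒ 1 (there (here refl)) = inj₂ (refl , refl)
bandResidues⇒ 1 (there (there (here refl))) = inj₂ (refl , refl)
bandResidues⇒ 2 (here refl) = inj₂ (refl , refl)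
bandResidues⇒ 2 (there (here refl)) = inj₂ (refl , refl)
bandResidues⇒ 2 (there (there (here refl))) = inj₁ (refl , refl)
bandResidues⇒ 3 (here refl) = inj₂ (refl , refl)
bandResidues⇒ 3 (there (here refl)) = inj₁ (refl , refl)
bandResidues⇒ 3 (there (there (here refl))) = inj₂ (refl , refl)

resA⇒ : ∀ {a b} p q → resA p q ≡ true → (q , a) ∈ₗ bandResidues a b p
resA⇒ 0 0 _ = here refl
resA⇒ 1 0 _ = here refl
resA⇒ 2 2 _ = there (there (here refl))
resA⇒ 3 2 _ = there (here refl)

resB⇒ : ∀ {a b} p q → resB p q ≡ true → (q , b) ∈ₗ bandResidues a b p
resB⇒ 0 0 _ = there (here refl)
resB⇒ 0 1 _ = there (there (here refl))
resB⇒ 1 1 _ = there (here refl)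
resB⇒ 1 2 _ = there (there (here refl))
resB⇒ 2 0 _ = here refl
resB⇒ 2 1 _ = there (here refl)
resB⇒ 3 1 _ = here refl
resB⇒ 3 2 _ = there (there (here refl))

private
  allBool? : ∀ {Q : Bool → Set} → (∀ b → Dec (Q b)) → Dec (∀ b → Q b)
  allBool? Q? = map′ (λ (p , q) → λ { true → p ; false → q }) (λ f → f true , f false) (Q? true ×-dec Q? false)

  ∀bits? : ∀ {Q : Bool → Bool → Bool → Bool → Set} → (∀ b₀ b₁ b₂ b₃ → Dec (Q b₀ b₁ b₂ b₃)) → Dec (∀ b₀ b₁ b₂ b₃ → Q b₀ b₁ b₂ b₃)
  ∀bits? Q? = allBool? λ b₀ → allBool? λ b₁ → allBool? λ b₂ → allBool? λ b₃ → Q? b₀ b₁ b₂ b₃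

  ∀<? : ∀ m {Q : ℕ → Set} → (∀ k → Dec (Q k)) → Dec (∀ k → k < m → Q k)
  ∀<? m Q? = map′ (λ f k k<m → f {k} k<m) (λ f {k} k<m → f k k<m) (ℕ.allUpTo? Q? m)

  ∃<? : ∀ m {Q : ℕ → Set} → (∀ k → Dec (Q k)) → Dec (∃[ k ] k < m × Q k)
  ∃<? m Q? = ℕ.anyUpTo? Q? m

Exclusive : Bool → Bool → Bool → Bool → Set
Exclusive b₀ b₁ b₂ b₃ = b₀ ∧ b₃ ≡ false × b₁ ∧ b₂ ≡ false

private
  exclusive? : ∀ b₀ b₁ b₂ b₃ → Dec (Exclusive b₀ b₁ b₂ b₃)
  exclusive? b₀ b₁ b₂ b₃ = (b₀ ∧ b₃ Bool.≟ false) ×-dec (b₁ ∧ b₂ Bool.≟ false)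

abstract
  -- Decided on all bit patterns, with rows counted from M. Exclusivity leaves at most two beads,
  -- and a gain forces both to be left of D; the gained cells lie in rows that end at such a bead.
  new-cells : ∀ b₀ b₁ b₂ b₃ → Exclusive b₀ b₁ b₂ b₃ → ∀ q → q < 3 → ∀ t → t < 3 →
    old b₁ b₂ b₃ q ≤ t → t < new b₀ b₁ b₃ q →
    (∃[ p ] p < 4 × flag b₀ b₁ b₂ b₃ p ≡ true × t ≡ old b₁ b₂ b₃ p × resB p q ≡ true) × b₂ ≡ false × b₃ ≡ false
  new-cells = from-yes (∀bits? λ b₀ b₁ b₂ b₃ → exclusive? b₀ b₁ b₂ b₃ →-dec ∀<? 3 λ q → ∀<? 3 λ t →
    (old b₁ b₂ b₃ q ≤? t) →-dec (t <? new b₀ b₁ b₃ q) →-dec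
    ((∃<? 4 λ p → (flag b₀ b₁ b₂ b₃ p Bool.≟ true) ×-dec (t ≟ old b₁ b₂ b₃ p) ×-dec (resB p q Bool.≟ true)) ×-dec (b₂ Bool.≟ false) ×-dec (b₃ Bool.≟ false)))

  -- Used for closure under neighbours: once D and D + 1 are empty, every cell of residue B in a row
  -- ending at a bead of the band is gained.
  new-cells⁻ : ∀ b₀ b₁ b₂ b₃ → b₂ ≡ false → b₃ ≡ false → ∀ p → p < 4 → ∀ q → q < 3 →
    flag b₀ b₁ b₂ b₃ p ≡ true → resB p q ≡ true → old b₁ b₂ b₃ q ≤ old b₁ b₂ b₃ p × old b₁ b₂ b₃ p < new b₀ b₁ b₃ q
  new-cells⁻ = from-yes (∀bits? λ b₀ b₁ b₂ b₃ → (b₂ Bool.≟ false) →-dec (b₃ Bool.≟ false) →-dec ∀<? 4 λ p → ∀<? 3 λ q →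
    (flag b₀ b₁ b₂ b₃ p Bool.≟ true) →-dec (resB p q Bool.≟ true) →-dec
    ((old b₁ b₂ b₃ q ≤? old b₁ b₂ b₃ p) ×-dec (old b₁ b₂ b₃ p <? new b₀ b₁ b₃ q)))

  -- For addable components: a cell of residue B outside the diagram belongs to the bead p = 0 or p
  -- = 1, and only a bead at p + 2, its partner in the exchange, can prevent the gain.
  outer-cells : ∀ b₀ b₁ b₂ b₃ → Exclusive b₀ b₁ b₂ b₃ → ∀ p → p < 4 → ∀ q → q < 3 →
    flag b₀ b₁ b₂ b₃ p ≡ true → resB p q ≡ true → old b₁ b₂ b₃ q ≤ old b₁ b₂ b₃ p →
    (p ≡ 0 × q < 2 × (b₂ ≡ false → old b₁ b₂ b₃ p < new b₀ b₁ b₃ q)) ⊎ (p ≡ 1 × 0 < q × (b₃ ≡ false → old b₁ b₂ b₃ p < new b₀ b₁ b₃ q))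
  outer-cells = from-yes (∀bits? λ b₀ b₁ b₂ b₃ → exclusive? b₀ b₁ b₂ b₃ →-dec ∀<? 4 λ p → ∀<? 3 λ q →
    (flag b₀ b₁ b₂ b₃ p Bool.≟ true) →-dec (resB p q Bool.≟ true) →-dec (old b₁ b₂ b₃ q ≤? old b₁ b₂ b₃ p) →-dec
    (((p ≟ 0) ×-dec (q <? 2) ×-dec ((b₂ Bool.≟ false) →-dec (old b₁ b₂ b₃ p <? new b₀ b₁ b₃ q)))
      ⊎-dec ((p ≟ 1) ×-dec (0 <? q) ×-dec ((b₃ Bool.≟ false) →-dec (old b₁ b₂ b₃ p <? new b₀ b₁ b₃ q)))))

  lost-cells : ∀ b₀ b₁ b₂ b₃ → Exclusive b₀ b₁ b₂ b₃ → ∀ q → q < 3 → ∀ t → t < 3 →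
    new b₀ b₁ b₃ q ≤ t → t < old b₁ b₂ b₃ q →
    (∃[ p ] p < 4 × flag b₀ b₁ b₂ b₃ p ≡ true × t ≡ old b₁ b₂ b₃ p × resB p q ≡ true) × b₀ ≡ false × b₁ ≡ false
  lost-cells = from-yes (∀bits? λ b₀ b₁ b₂ b₃ → exclusive? b₀ b₁ b₂ b₃ →-dec ∀<? 3 λ q → ∀<? 3 λ t →
    (new b₀ b₁ b₃ q ≤? t) →-dec (t <? old b₁ b₂ b₃ q) →-dec
    ((∃<? 4 λ p → (flag b₀ b₁ b₂ b₃ p Bool.≟ true) ×-dec (t ≟ old b₁ b₂ b₃ p) ×-dec (resB p q Bool.≟ true)) ×-dec (b₀ Bool.≟ false) ×-dec (b₁ Bool.≟ false)))

  lost-cells⁻ : ∀ b₀ b₁ b₂ b₃ → b₀ ≡ false → b₁ ≡ false → ∀ p → p < 4 → ∀ q → q < 3 →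
    flag b₀ b₁ b₂ b₃ p ≡ true → resB p q ≡ true → new b₀ b₁ b₃ q ≤ old b₁ b₂ b₃ p × old b₁ b₂ b₃ p < old b₁ b₂ b₃ q
  lost-cells⁻ = from-yes (∀bits? λ b₀ b₁ b₂ b₃ → (b₀ Bool.≟ false) →-dec (b₁ Bool.≟ false) →-dec ∀<? 4 λ p → ∀<? 3 λ q →
    (flag b₀ b₁ b₂ b₃ p Bool.≟ true) →-dec (resB p q Bool.≟ true) →-dec
    ((new b₀ b₁ b₃ q ≤? old b₁ b₂ b₃ p) ×-dec (old b₁ b₂ b₃ p <? old b₁ b₂ b₃ q)))

  inner-cells : ∀ b₀ b₁ b₂ b₃ → Exclusive b₀ b₁ b₂ b₃ → ∀ p → p < 4 → ∀ q → q < 3 →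
    flag b₀ b₁ b₂ b₃ p ≡ true → resB p q ≡ true → old b₁ b₂ b₃ p < old b₁ b₂ b₃ q →
    (p ≡ 2 × q < 2 × (b₀ ≡ false → new b₀ b₁ b₃ q ≤ old b₁ b₂ b₃ p)) ⊎ (p ≡ 3 × 0 < q × (b₁ ≡ false → new b₀ b₁ b₃ q ≤ old b₁ b₂ b₃ p))
  inner-cells = from-yes (∀bits? λ b₀ b₁ b₂ b₃ → exclusive? b₀ b₁ b₂ b₃ →-dec ∀<? 4 λ p → ∀<? 3 λ q →
    (flag b₀ b₁ b₂ b₃ p Bool.≟ true) →-dec (resB p q Bool.≟ true) →-dec (old b₁ b₂ b₃ p <? old b₁ b₂ b₃ q) →-dec
    (((p ≟ 2) ×-dec (q <? 2) ×-dec ((b₀ Bool.≟ false) →-dec (new b₀ b₁ b₃ q ≤? old b₁ b₂ b₃ p)))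
      ⊎-dec ((p ≟ 3) ×-dec (0 <? q) ×-dec ((b₁ Bool.≟ false) →-dec (new b₀ b₁ b₃ q ≤? old b₁ b₂ b₃ p)))))

  -- Inside a band the residue A is assigned by the row rule too, so the generator of type C next to
  -- a D-variant needs a table as well. It exchanges D - 2 with D - 1 and D with D + 1.
  new-cells-A : ∀ b₀ b₁ b₂ b₃ → ∀ q → q < 3 → ∀ t → t < 3 → old b₁ b₂ b₃ q ≤ t → t < newA b₀ b₂ b₃ q →
    ∃[ p ] p < 4 × flag b₀ b₁ b₂ b₃ p ≡ true × t ≡ old b₁ b₂ b₃ p × resA p q ≡ true
  new-cells-A = from-yes (∀bits? λ b₀ b₁ b₂ b₃ → ∀<? 3 λ q → ∀<? 3 λ t →
    (old b₁ b₂ b₃ q ≤? t) →-dec (t <? newA b₀ b₂ b₃ q) →-dec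
    ∃<? 4 λ p → (flag b₀ b₁ b₂ b₃ p Bool.≟ true) ×-dec (t ≟ old b₁ b₂ b₃ p) ×-dec (resA p q Bool.≟ true))

  lost-cells-A : ∀ b₀ b₁ b₂ b₃ → ∀ q → q < 3 → ∀ t → t < 3 → newA b₀ b₂ b₃ q ≤ t → t < old b₁ b₂ b₃ q →
    ∃[ p ] p < 4 × flag b₀ b₁ b₂ b₃ p ≡ true × t ≡ old b₁ b₂ b₃ p × resA p q ≡ true
  lost-cells-A = from-yes (∀bits? λ b₀ b₁ b₂ b₃ → ∀<? 3 λ q → ∀<? 3 λ t →
    (newA b₀ b₂ b₃ q ≤? t) →-dec (t <? old b₁ b₂ b₃ q) →-dec
    ∃<? 4 λ p → (flag b₀ b₁ b₂ b₃ p Bool.≟ true) ×-dec (t ≟ old b₁ b₂ b₃ p) ×-dec (resA p q Bool.≟ true))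

-- Around the main diagonal b₂ and b₃ are the negations of b₁ and b₀; the
-- changing cells then form the square of side 2 with corner at offset 0.
square : ℕ → ℕ → Bool
square 0 1 = true
square 1 0 = true
square 1 1 = true
square 2 0 = true
square _ _ = false

abstract
  new-square : ∀ b₀ b₁ → ∀ q → q < 3 → ∀ t → t < 3 → old b₁ (not b₁) (not b₀) q ≤ t → t < new b₀ b₁ (not b₀) q →
    square q t ≡ true × b₀ ≡ true × b₁ ≡ true
  new-square = from-yes (allBool? λ b₀ → allBool? λ b₁ → ∀<? 3 λ q → ∀<? 3 λ t →
    (old b₁ (not b₁) (not b₀) q ≤? t) →-dec (t <? new b₀ b₁ (not b₀) q) →-dec
    ((square q t Bool.≟ true) ×-dec (b₀ Bool.≟ true) ×-dec (b₁ Bool.≟ true)))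

  lost-square : ∀ b₀ b₁ → ∀ q → q < 3 → ∀ t → t < 3 → new b₀ b₁ (not b₀) q ≤ t → t < old b₁ (not b₁) (not b₀) q →
    square q t ≡ true × b₀ ≡ false × b₁ ≡ false
  lost-square = from-yes (allBool? λ b₀ → allBool? λ b₁ → ∀<? 3 λ q → ∀<? 3 λ t →
    (new b₀ b₁ (not b₀) q ≤? t) →-dec (t <? old b₁ (not b₁) (not b₀) q) →-dec
    ((square q t Bool.≟ true) ×-dec (b₀ Bool.≟ false) ×-dec (b₁ Bool.≟ false)))

  square-bounds : ∀ q → q < 3 → ∀ t → t < 2 → square q t ≡ true →
    (old true false false q ≤ t × t < new true true false q) × (new false false true q ≤ t × t < old false true true q)
  square-bounds = from-yes (∀<? 3 λ q → ∀<? 2 λ t → (square q t Bool.≟ true) →-dec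
    (((old true false false q ≤? t) ×-dec (t <? new true true false q)) ×-dec ((new false false true q ≤? t) ×-dec (t <? old false true true q))))

-- Strips off the height M at D + 2, so that the finite tables apply to the rest.
offset : ∀ {M r lo hi} → lo + M ≤ r → r < hi + M → hi ≤ 3 → ∃[ t ] t < 3 × r ≡ t + M × lo ≤ t × t < hi
offset {M} {r} {lo} {hi} l u hi≤3 = r ∸ M , ℕ.≤-trans t<hi hi≤3 , sym r≡ , ℕ.+-cancelʳ-≤ M lo (r ∸ M) (subst (lo + M ≤_) (sym r≡) l) , t<hi
  where
  r≡ : r ∸ M + M ≡ r
  r≡ = ℕ.m∸n+n≡m (ℕ.≤-trans (ℕ.m≤n+m M lo) l)
  t<hi : r ∸ M < hi
  t<hi = ℕ.+-cancelʳ-≤ M (suc (r ∸ M)) hi (subst (_≤ hi + M) (cong suc (sym r≡)) u)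

bit≤1 : ∀ b → bit b ≤ 1
bit≤1 true  = ℕ.≤-refl
bit≤1 false = z≤n

old≤3 : ∀ b₁ b₂ b₃ q → old b₁ b₂ b₃ q ≤ 3
old≤3 b₁ b₂ b₃ 0 = ℕ.+-mono-≤ (bit≤1 b₁) (ℕ.+-mono-≤ (bit≤1 b₂) (bit≤1 b₃))
old≤3 b₁ b₂ b₃ 1 = ℕ.≤-trans (ℕ.+-mono-≤ (bit≤1 b₂) (bit≤1 b₃)) (ℕ.n≤1+n 2)
old≤3 b₁ b₂ b₃ 2 = ℕ.≤-trans (bit≤1 b₃) (s≤s z≤n)
old≤3 b₁ b₂ b₃ (suc (suc (suc _))) = z≤n

new≤3 : ∀ b₀ b₁ b₃ q → new b₀ b₁ b₃ q ≤ 3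
new≤3 b₀ b₁ b₃ 0 = ℕ.+-mono-≤ (bit≤1 b₀) (ℕ.+-mono-≤ (bit≤1 b₁) (bit≤1 b₃))
new≤3 b₀ b₁ b₃ 1 = ℕ.≤-trans (ℕ.+-mono-≤ (bit≤1 b₀) (bit≤1 b₁)) (ℕ.n≤1+n 2)
new≤3 b₀ b₁ b₃ (suc (suc _)) = ℕ.≤-trans (bit≤1 b₁) (s≤s z≤n)

newA≤3 : ∀ b₀ b₂ b₃ q → newA b₀ b₂ b₃ q ≤ 3
newA≤3 b₀ b₂ b₃ 0 = ℕ.+-mono-≤ (bit≤1 b₀) (ℕ.+-mono-≤ (bit≤1 b₂) (bit≤1 b₃))
newA≤3 b₀ b₂ b₃ 1 = ℕ.≤-trans (ℕ.+-mono-≤ (bit≤1 b₂) (bit≤1 b₃)) (ℕ.n≤1+n 2)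
newA≤3 b₀ b₂ b₃ (suc (suc _)) = ℕ.≤-trans (bit≤1 b₂) (s≤s z≤n)

-- Bands to the right of the main diagonal.

open Equivalence using (to; from)

-- The content of the cell with offset q in a row of the band centred at D.
at : ℕ → ℤ → ℤ
at q D = ℤ.- + 1 ℤ.+ (+ q ℤ.+ D)

at-suc : ∀ q D → + 1 ℤ.+ at q D ≡ at (suc q) D
at-suc q D = h (+ q) D
  where
  h : ∀ q D → + 1 ℤ.+ (ℤ.- + 1 ℤ.+ (q ℤ.+ D)) ≡ ℤ.- + 1 ℤ.+ (+ 1 ℤ.+ q ℤ.+ D)
  h = solve-∀

at-pred : ∀ q D → ℤ.- + 1 ℤ.+ at (suc q) D ≡ at q D
at-pred q D = h (+ q) D
  where
  h : ∀ q D → ℤ.- + 1 ℤ.+ (ℤ.- + 1 ℤ.+ (+ 1 ℤ.+ q ℤ.+ D)) ≡ ℤ.- + 1 ℤ.+ (q ℤ.+ D)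
  h = solve-∀

at-0 : ∀ D → at 0 D ≡ ℤ.- + 1 ℤ.+ D
at-0 D = cong (λ x → ℤ.- + 1 ℤ.+ x) (ℤ.+-identityˡ D)

at-1 : ∀ D → at 1 D ≡ D
at-1 = h
  where
  h : ∀ D → ℤ.- + 1 ℤ.+ (+ 1 ℤ.+ D) ≡ D
  h = solve-∀

at-2 : ∀ D → at 2 D ≡ + 1 ℤ.+ D
at-2 = h
  where
  h : ∀ D → ℤ.- + 1 ℤ.+ (+ 2 ℤ.+ D) ≡ + 1 ℤ.+ D
  h = solve-∀

at-3 : ∀ D → at 3 D ≡ + 2 ℤ.+ D
at-3 = h
  where
  h : ∀ D → ℤ.- + 1 ℤ.+ (+ 3 ℤ.+ D) ≡ + 2 ℤ.+ D
  h = solve-∀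

<3⇒ : ∀ {q} → q < 3 → q ≡ 0 ⊎ q ≡ 1 ⊎ q ≡ 2
<3⇒ {0} _ = inj₁ refl
<3⇒ {1} _ = inj₂ (inj₁ refl)
<3⇒ {2} _ = inj₂ (inj₂ refl)
<3⇒ {suc (suc (suc _))} (s≤s (s≤s (s≤s ())))

resA-col : ∀ p q → resA p q ≡ true → q ≡ 0 ⊎ q ≡ 2
resA-col 0 0 _ = inj₁ refl
resA-col 1 0 _ = inj₁ refl
resA-col 2 2 _ = inj₂ refl
resA-col 3 2 _ = inj₂ refl

resB-col : ∀ p q → resB p q ≡ true → q < 3
resB-col p 0 _ = z<s
resB-col p 1 _ = s≤s z<s
resB-col p 2 _ = s≤s (s≤s z<s)
resB-col 0 (suc (suc (suc _))) ()
resB-col 1 (suc (suc (suc _))) ()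
resB-col 2 (suc (suc (suc _))) ()
resB-col 3 (suc (suc (suc _))) ()
resB-col (suc (suc (suc (suc _)))) (suc (suc (suc _))) ()

bandResidues-bounds : ∀ {a b k q} p → (q , k) ∈ₗ bandResidues a b p → p < 4 × q < 3
bandResidues-bounds {q = q} p m = bound-p p m , [ (λ (_ , e) → bound-A (resA-col p q e)) , (λ (_ , e) → resB-col p q e) ]′ (bandResidues⇒ p m)
  where
  bound-A : q ≡ 0 ⊎ q ≡ 2 → q < 3
  bound-A (inj₁ refl) = z<s
  bound-A (inj₂ refl) = s≤s (s≤s z<s)
  bound-p : ∀ {a b k q} p → (q , k) ∈ₗ bandResidues a b p → p < 4
  bound-p 0 _ = z<s
  bound-p 1 _ = s≤s z<s
  bound-p 2 _ = s≤s (s≤s z<s)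
  bound-p 3 _ = s≤s (s≤s (s≤s z<s))

module Bands (X : QuotientType) (n : ℕ) .{{_ : NonZero n}} (rank : minRank X ≤ n)
  {w g : ℤ → ℤ} (I : Shape.Inverse X n rank w g) where
  open Quotient X n renaming (N to Nℕ)
  open Index n
  open Generators X n
  open Lengths X n rank
  open Abacus X n rank
  open Shape X n rank
  open Diagrams X n rank
  open Inverse I renaming (equivariant to E; equivariant⁻ to F)

  b : ℤ → Bool
  b = bead (+ 0) g

  h : ℤ → ℕ
  h = h₀ I

  μ : Diagram
  μ = 𝒞 w

  h-step : ∀ d → h d ≡ bit (b d) + h (+ 1 ℤ.+ d)
  h-step = height-step 0 F

  h-mirror : ∀ d → + h (ℤ.- d) ≡ + h d ℤ.+ d
  h-mirror = h₀-mirror I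

  h-antitone : ∀ {d d′} → d ℤ.≤ d′ → h d′ ≤ h d
  h-antitone = height-antitone F

  -- Shared by the diagram and its transpose, so that the column rule is treated by the lemmas on
  -- the row rule.
  Shaped : Diagram → Set
  Shaped ν = ∀ x → x ∈ ν ⇔ row x ≤ h (ct x)

  μ-shaped : Shaped μ
  μ-shaped = 𝒞⇔ I

  mirror-≤ : ∀ x → col x ≤ h (ct (swap x)) ⇔ row x ≤ h (ct x)
  mirror-≤ x = mk⇔
      (λ p → ℤ.drop‿+≤+ (≤-via (ℤ.≤-trans (+≤+ p) (ℤ.≤-reflexive e)) (k (+ row x) (+ col x) (+ h (ct x)))))
      (λ p → ℤ.drop‿+≤+ (ℤ.≤-trans (≤-via (+≤+ p) (sym (k (+ row x) (+ col x) (+ h (ct x))))) (ℤ.≤-reflexive (sym e))))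
    where
    e : + h (ct (swap x)) ≡ + h (ct x) ℤ.+ ct x
    e = trans (cong (λ d → + h d) (ct-swap x)) (h-mirror (ct x))
    k : ∀ r c m → m ℤ.+ (c ℤ.- r) ℤ.- c ≡ m ℤ.- r
    k = solve-∀

  transposed-shaped : Shaped (transposed μ)
  transposed-shaped x = mk⇔ (to (mirror-≤ x) ∘ to (μ-shaped (swap x))) (from (μ-shaped (swap x)) ∘ from (mirror-≤ x))

  μ-swap : ∀ {x} → x ∈ μ → swap x ∈ μ
  μ-swap {x} p = from (μ-shaped (swap x)) (from (mirror-≤ x) (to (μ-shaped x) p))

  module Bits (D : ℤ) where
    b₀ = b (ℤ.- + 2 ℤ.+ D)
    b₁ = b (ℤ.- + 1 ℤ.+ D)
    b₂ = b D
    b₃ = b (+ 1 ℤ.+ D)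
    M = h (+ 2 ℤ.+ D)

    oldD : ℕ → ℕ
    oldD = old b₁ b₂ b₃

    flagD : ℕ → Bool
    flagD = flag b₀ b₁ b₂ b₃

    h-D+1 : h (+ 1 ℤ.+ D) ≡ bit b₃ + M
    h-D+1 = trans (h-step (+ 1 ℤ.+ D)) (cong (λ x → bit b₃ + h x) (k D))
      where
      k : ∀ D → + 1 ℤ.+ (+ 1 ℤ.+ D) ≡ + 2 ℤ.+ D
      k = solve-∀

    h-D : h D ≡ bit b₂ + bit b₃ + M
    h-D = trans (h-step D) (trans (cong (λ x → bit b₂ + x) h-D+1) (sym (ℕ.+-assoc (bit b₂) (bit b₃) M)))

    h-old : ∀ q → q < 4 → h (at q D) ≡ oldD q + M
    h-old 0 _ = trans (cong h (at-0 D)) (trans (h-step (ℤ.- + 1 ℤ.+ D)) (trans (cong (λ y → bit b₁ + y) (trans (cong h (suc-pred D)) h-D)) (sym (ℕ.+-assoc (bit b₁) (bit b₂ + bit b₃) M))))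
    h-old 1 _ = trans (cong h (at-1 D)) h-D
    h-old 2 _ = trans (cong h (at-2 D)) h-D+1
    h-old 3 _ = cong h (at-3 D)
    h-old (suc (suc (suc (suc _)))) (s≤s (s≤s (s≤s (s≤s ()))))

    b-flag : ∀ p → p < 4 → b (ℤ.- + 1 ℤ.+ at p D) ≡ flagD p
    b-flag 0 _ = cong b (k D)
      where
      k : ∀ D → ℤ.- + 1 ℤ.+ (ℤ.- + 1 ℤ.+ (+ 0 ℤ.+ D)) ≡ ℤ.- + 2 ℤ.+ D
      k = solve-∀
    b-flag 1 _ = cong (λ x → b (ℤ.- + 1 ℤ.+ x)) (at-1 D)
    b-flag 2 _ = cong b (trans (at-pred 1 D) (at-1 D))
    b-flag 3 _ = cong b (trans (at-pred 2 D) (at-2 D))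
    b-flag (suc (suc (suc (suc _)))) (s≤s (s≤s (s≤s (s≤s ()))))

  -- Row r (counted from zero) ends just before content 1 + d exactly when d
  -- carries a bead with r beads after it.
  rowLength⇒ : ∀ {ν r k} → Shaped ν → RowLength ν r k → b (+ k ℤ.- + suc r) ≡ true × h (+ 1 ℤ.+ (+ k ℤ.- + suc r)) ≡ r
  rowLength⇒ {ν} {r} {k} shaped rl = go (b d) refl
    where
    d = + k ℤ.- + suc r
    outside : h (+ 1 ℤ.+ d) ≤ r
    outside = ℕ.≮⇒≥ λ r<h → ℕ.n≮n k (to (rl k) (from (shaped (r , k)) (subst (λ x → suc r ≤ h x) (sym (ℤ.+-assoc (+ 1) (+ k) (ℤ.- + suc r))) r<h)))
    inside : ∀ k′ → k′ ≡ k → suc r ≤ h d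
    -- An empty row ends at the left border, where `h-mirror` gives h (-(r + 1)) ≥ r + 1.
    inside zero refl = ℤ.drop‿+≤+ (subst (+ suc r ℤ.≤_) (sym (trans (cong (λ x → + h x) (ℤ.+-identityˡ (ℤ.- + suc r))) (h-mirror (+ suc r)))) (ℤ.i≤j+i (+ suc r) (+ h (+ suc r))))
    inside (suc k′) refl = to (shaped (r , k′)) (from (rl k′) ℕ.≤-refl)
    go : ∀ c → b d ≡ c → b d ≡ true × h (+ 1 ℤ.+ d) ≡ r
    go c e with subst (suc r ≤_) (trans (h-step d) (cong (λ x → bit x + h (+ 1 ℤ.+ d)) e)) (inside k refl)
    go true e | s≤s r≤ = e , ℕ.≤-antisym outside r≤
    go false e | r< = contradiction outside (ℕ.<⇒≱ r<)

  rowLength⇐ : ∀ {ν r k} → Shaped ν → b (+ k ℤ.- + suc r) ≡ true → h (+ 1 ℤ.+ (+ k ℤ.- + suc r)) ≡ r → RowLength ν r k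
  rowLength⇐ {ν} {r} {k} shaped bd hd j = mk⇔
      (λ p → ℕ.≰⇒> λ k≤j → ℕ.<⇒≱ (to (shaped (r , j)) p) (ℕ.≤-trans (h-antitone (≤-via (+≤+ k≤j) (k₁ (+ k) (+ j) (+ suc r)))) (ℕ.≤-reflexive hd)))
      (λ j<k → from (shaped (r , j)) (ℕ.≤-trans (ℕ.≤-reflexive (sym (trans (h-step d) (cong₂ _+_ (cong bit bd) hd)))) (h-antitone (≤-via (+≤+ j<k) (k₂ (+ k) (+ suc j) (+ suc r))))))
    where
    d = + k ℤ.- + suc r
    k₁ : ∀ k j r → j ℤ.- k ≡ + 1 ℤ.+ j ℤ.- r ℤ.- (+ 1 ℤ.+ (k ℤ.- r))
    k₁ = solve-∀
    k₂ : ∀ k j r → k ℤ.- j ≡ k ℤ.- r ℤ.- (j ℤ.- r)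
    k₂ = solve-∀

  Zone : ℕ → ℕ → Pred Box 0ℓ
  Zone A B z = fr (ct z) ≡ A ⊎ fr (ct z) ≡ B

  -- The residues of the rule for upper bands, in terms of the bits around the centre.
  data UpperRes (A B : ℕ) (x : Box) (k : ℕ) : Set where
    upperRes : ∀ D p q → fr D ≡ B → + 1 ℤ.≤ D → p < 4 → q < 3 → Bits.flagD D p ≡ true →
      proj₁ x ≡ Bits.oldD D p + Bits.M D → ct x ≡ at q D → (q , k) ∈ₗ bandResidues A B p → UpperRes A B x k

  ct-offset : ∀ r c q → ct (r , c + q) ≡ at q (+ 1 ℤ.+ ct (r , c))
  ct-offset r c q = k (+ r) (+ c) (+ q)
    where
    k : ∀ r c q → + 1 ℤ.+ (c ℤ.+ q) ℤ.- (+ 1 ℤ.+ r) ≡ ℤ.- + 1 ℤ.+ (q ℤ.+ (+ 1 ℤ.+ (+ 1 ℤ.+ c ℤ.- (+ 1 ℤ.+ r))))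
    k = solve-∀

  end-offset : ∀ r c p → + (c + p) ℤ.- + suc r ≡ ℤ.- + 1 ℤ.+ at p (+ 1 ℤ.+ ct (r , c))
  end-offset r c p = k (+ r) (+ c) (+ p)
    where
    k : ∀ r c q → c ℤ.+ q ℤ.- (+ 1 ℤ.+ r) ≡ ℤ.- + 1 ℤ.+ (ℤ.- + 1 ℤ.+ (q ℤ.+ (+ 1 ℤ.+ (+ 1 ℤ.+ c ℤ.- (+ 1 ℤ.+ r)))))
    k = solve-∀

  module Band {A B} (sp : Special A B) where
    open Double sp

    zone-at : ∀ D → fr D ≡ B → ∀ q → q < 3 → fr (at q D) ≡ A ⊎ fr (at q D) ≡ B
    zone-at D e 0 _ = inj₁ (trans (cong fr (at-0 D)) (proj₂ (special-centre sp D e)))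
    zone-at D e 1 _ = inj₂ (trans (cong fr (at-1 D)) e)
    zone-at D e 2 _ = inj₁ (trans (cong fr (at-2 D)) (proj₁ (special-centre sp D e)))
    zone-at D e (suc (suc (suc _))) (s≤s (s≤s (s≤s ())))

    -- If the middle content had residue A, one of its two neighbours would leave the zone.
    centre : ∀ D → (∀ q → q < 3 → fr (at q D) ≡ A ⊎ fr (at q D) ≡ B) → fr D ≡ B
    centre D zone with zone 1 (s≤s z<s)
    ... | inj₂ e = trans (cong fr (sym (at-1 D))) e
    ... | inj₁ e with special-next sp D (trans (cong fr (sym (at-1 D))) e)
    ...   | inj₁ (_ , ¬A , ¬B) = contradiction (zone 0 z<s) [ (λ x → ¬A (trans (cong fr (sym (at-0 D))) x)) , (λ x → ¬B (trans (cong fr (sym (at-0 D))) x)) ]′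
    ...   | inj₂ (_ , ¬A , ¬B) = contradiction (zone 2 (s≤s (s≤s z<s))) [ (λ x → ¬A (trans (cong fr (sym (at-2 D))) x)) , (λ x → ¬B (trans (cong fr (sym (at-2 D))) x)) ]′

    band⇒ : ∀ {ν E k} → Shaped ν → (∀ z → z ∈ E → z ∈ Zone A B) → (∀ z → z ∈ E → row z < col z) →
      ∀ x → RowResidue E A B ν x k → UpperRes A B x k
    band⇒ shaped E⊆ upper (r , _) (c , p , q , meets , rl , m , refl) with bandResidues-bounds p m | rowLength⇒ shaped rl
    ... | p< , q< | bd , hd = upperRes D p q frD 1≤D p< q<
          (trans (sym (Bits.b-flag D p p<)) (trans (cong b (sym (end-offset r c p))) bd))
          (sym (trans (sym (Bits.h-old D p p<)) (trans (cong h (sym (trans (cong (λ x → + 1 ℤ.+ x) (end-offset r c p)) (suc-pred (at p D))))) hd)))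
          (ct-offset r c q) m
      where
      D = + 1 ℤ.+ ct (r , c)
      frD : fr D ≡ B
      frD = centre D λ q q< → subst (λ d → fr d ≡ A ⊎ fr d ≡ B) (ct-offset r c q) (E⊆ _ (from (meets (c + q)) (ℕ.m≤m+n c q , ℕ.+-monoʳ-< c q<)))
      1≤D : + 1 ℤ.≤ D
      1≤D = ℤ.+-monoʳ-≤ (+ 1) {+ 0} (ℤ.i≤j⇒0≤j-i (+≤+ (ℕ.<⇒≤ (upper _ (from (meets c) (ℕ.≤-refl , ℕ.m<m+n c z<s))))))

    -- The content 1 has folded residue 1, which is neither 0 nor n. A band with positive centre
    -- therefore stays strictly above the main diagonal.
    2≤centre : ∀ D → fr D ≡ B → + 1 ℤ.≤ D → + 2 ℤ.≤ D
    2≤centre (+ suc zero) e _ = contradiction (trans (sym (trans (cong fr (sym (+0* (+ 1) P))) (fr-up (+ 0) {1} 0<n))) e) (1≢ sp)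
      where
      1≢ : ∀ {A B} → Special A B → 1 ≢ B
      1≢ (bottom _) ()
      1≢ (top _ _ _) x = ℕ.<⇒≢ 2≤n x
    2≤centre (+ suc (suc m)) e _ = +≤+ (s≤s (s≤s z≤n))
    2≤centre (+ zero) e (+≤+ ())

    neighbour : ∀ D q → fr D ≡ B → q < 3 → ∀ {y z} → ct y ≡ at q D → ShareEdge y z → z ∈ Zone A B → ∃[ q′ ] q′ < 3 × ct z ≡ at q′ D
    neighbour D q e q< {y} {z} ey se zone with ct-edge (edge se)
    neighbour D 0 e q< {y} {z} ey se zone | inj₁ ez = 1 , s≤s z<s , trans ez (trans (cong (λ d → + 1 ℤ.+ d) ey) (at-suc 0 D))
    neighbour D 1 e q< {y} {z} ey se zone | inj₁ ez = 2 , s≤s (s≤s z<s) , trans ez (trans (cong (λ d → + 1 ℤ.+ d) ey) (at-suc 1 D))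
    neighbour D 2 e q< {y} {z} ey se zone | inj₁ ez = contradiction zone [ proj₁ (outer₊ D e) ∘ trans (cong fr (sym z≡)) , proj₂ (outer₊ D e) ∘ trans (cong fr (sym z≡)) ]′
      where
      z≡ : ct z ≡ + 2 ℤ.+ D
      z≡ = trans ez (trans (cong (λ d → + 1 ℤ.+ d) ey) (trans (at-suc 2 D) (at-3 D)))
    neighbour D 0 e q< {y} {z} ey se zone | inj₂ ez = contradiction zone [ proj₁ (outer₋ D e) ∘ trans (cong fr (sym z≡)) , proj₂ (outer₋ D e) ∘ trans (cong fr (sym z≡)) ]′
      where
      k : ∀ D → ℤ.- + 1 ℤ.+ (ℤ.- + 1 ℤ.+ (+ 0 ℤ.+ D)) ≡ ℤ.- + 2 ℤ.+ D
      k = solve-∀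
      z≡ : ct z ≡ ℤ.- + 2 ℤ.+ D
      z≡ = trans ez (trans (cong (λ d → ℤ.- + 1 ℤ.+ d) ey) (k D))
    neighbour D 1 e q< {y} {z} ey se zone | inj₂ ez = 0 , z<s , trans ez (trans (cong (λ d → ℤ.- + 1 ℤ.+ d) ey) (at-pred 0 D))
    neighbour D 2 e q< {y} {z} ey se zone | inj₂ ez = 1 , s≤s z<s , trans ez (trans (cong (λ d → ℤ.- + 1 ℤ.+ d) ey) (at-pred 1 D))
    neighbour D (suc (suc (suc _))) e (s≤s (s≤s (s≤s ()))) ey se zone | _

    module _ {Z : Pred Box 0ℓ} (Z⇒ : ∀ z → z ∈ Z → z ∈ Zone A B) (Z⇐ : ∀ z → z ∈ Zone A B → z ∈ Z) where
      component-band : ∀ {x} D q → fr D ≡ B → q < 3 → ct x ≡ at q D → ∀ {y} → y ∈ Component Z x → ∃[ q′ ] q′ < 3 × ct y ≡ at q′ D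
      component-band {x} D q e q< ex = component-closed (λ y → ∃[ q′ ] q′ < 3 × ct y ≡ at q′ D) (q , q< , ex)
        (λ {y} {z} (q , q< , ey) se z∈Z → neighbour D q e q< ey se (Z⇒ z z∈Z))

      private
        Path : Box → Box → Set
        Path = Star (λ u v → ShareEdge u v × v ∈ Z)

        walk-right : ∀ r j m → (∀ i → i ≤ m → (r , j + i) ∈ Z) → Path (r , j) (r , j + m)
        walk-right r j zero z = subst (λ c → Path (r , j) (r , c)) (sym (ℕ.+-identityʳ j)) done
        walk-right r j (suc m) z = walk-right r j m (λ i i≤ → z i (ℕ.m≤n⇒m≤1+n i≤))
          ◅◅ ((subst (λ c → ShareEdge (r , j + m) (r , c)) (sym (ℕ.+-suc j m)) (shareEdge right) , z (suc m) ℕ.≤-refl) ◅ done)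

        walk-left : ∀ r j m → (∀ i → i ≤ m → (r , j + i) ∈ Z) → Path (r , j + m) (r , j)
        walk-left r j zero z = subst (λ c → Path (r , c) (r , j)) (sym (ℕ.+-identityʳ j)) done
        walk-left r j (suc m) z =
          (subst (λ c → ShareEdge (r , c) (r , j + m)) (sym (ℕ.+-suc j m)) (shareEdge left) , z m (ℕ.n≤1+n m)) ◅ walk-left r j m (λ i i≤ → z i (ℕ.m≤n⇒m≤1+n i≤))

      -- The three cells of the band in row r are joined along the row. The contents D - 2 and D + 2
      -- lie outside the zone, so the component meets the row in no further cell.
      band⇐ : ∀ {ν k} → Shaped ν → ∀ {x} → UpperRes A B x k → Defs.Upper (Component Z x) × RowResidue (Component Z x) A B ν x k
      band⇐ {ν} {k} shaped {r , j} (upperRes D p q e 1≤D p< q< fl rw ex m) = upper , c , p , q , meets , rl , m , j≡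
        where
        0≤c : + 0 ℤ.≤ + r ℤ.+ (ℤ.- + 1 ℤ.+ D)
        0≤c = ℤ.+-mono-≤ (+≤+ (z≤n {r})) (ℤ.+-monoʳ-≤ (ℤ.- + 1) 1≤D)
        -- The column of c₁ is r + D - 1, a natural number since D ≥ 1.
        c : ℕ
        c = proj₁ (≤⇒∃ 0≤c)
        c≡ : + c ≡ + r ℤ.+ (ℤ.- + 1 ℤ.+ D)
        c≡ = trans (sym (ℤ.+-identityʳ (+ c))) (sym (proj₂ (≤⇒∃ 0≤c)))
        D≡ : D ≡ + 1 ℤ.+ ct (r , c)
        D≡ = trans (k₁ (+ r) D) (cong (λ x → + 1 ℤ.+ (+ 1 ℤ.+ x ℤ.- (+ suc r))) (sym c≡))
          where
          k₁ : ∀ r D → D ≡ + 1 ℤ.+ (+ 1 ℤ.+ (r ℤ.+ (ℤ.- + 1 ℤ.+ D)) ℤ.- (+ 1 ℤ.+ r))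
          k₁ = solve-∀
        ct-at : ∀ q → ct (r , c + q) ≡ at q D
        ct-at q = trans (ct-offset r c q) (cong (at q) (sym D≡))
        ct-col : ∀ i i′ → ct (r , i) ≡ ct (r , i′) → i ≡ i′
        ct-col i i′ x = ℤ.+-injective (≡-via x (k₁ (+ i) (+ i′) (+ r)))
          where
          k₁ : ∀ i i′ r → + 1 ℤ.+ i ℤ.- (+ 1 ℤ.+ r) ℤ.- (+ 1 ℤ.+ i′ ℤ.- (+ 1 ℤ.+ r)) ≡ i ℤ.- i′
          k₁ = solve-∀
        j≡ : j ≡ c + q
        j≡ = ct-col j (c + q) (trans ex (sym (ct-at q)))
        inZ : ∀ i → i ≤ 2 → (r , c + i) ∈ Z
        inZ i i≤2 = Z⇐ _ (subst (λ d → fr d ≡ A ⊎ fr d ≡ B) (sym (ct-at i)) (zone-at D e i (s≤s i≤2)))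
        upper : Defs.Upper (Component Z (r , j))
        upper y y∈ with component-band D q e q< ex y∈
        ... | q′ , _ , ey = ℤ.drop‿+<+ (<-via {+ 0} {at q′ D} (ℤ.<-≤-trans (+<+ z<s) (ℤ.≤-trans {j = ℤ.- + 1 ℤ.+ D}
                (ℤ.+-monoʳ-≤ (ℤ.- + 1) (2≤centre D e 1≤D)) (ℤ.+-monoʳ-≤ (ℤ.- + 1) (ℤ.i≤j+i D (+ q′)))))
                (trans (cong (ℤ._- + 0) (sym ey)) (ℤ.+-identityʳ (ct y))))
        meets : MeetsRow (Component Z (r , j)) r c
        meets i = mk⇔ ⇒ λ (c≤i , i<) → ⇐ i (ℕ.m≤n⇒∃[o]m+o≡n c≤i) i<
          where
          ⇒ : (r , i) ∈ Component Z (r , j) → c ≤ i × i < c + 3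
          ⇒ y∈ with component-band D q e q< ex y∈
          ... | q′ , q′< , ey with refl ← ct-col i (c + q′) (trans ey (sym (ct-at q′))) = ℕ.m≤m+n c q′ , ℕ.+-monoʳ-< c q′<
          ⇐ : ∀ i → ∃[ o ] c + o ≡ i → i < c + 3 → (r , i) ∈ Component Z (r , j)
          ⇐ _ (o , refl) i< = subst (λ i → (r , c + o) ∈ Component Z (r , i)) (sym j≡)
            (inZ q (s≤s⁻¹ q<) , walk-left r c q (λ i i≤ → inZ i (ℕ.≤-trans i≤ (s≤s⁻¹ q<))) ◅◅ walk-right r c o (λ i i≤ → inZ i (ℕ.≤-trans i≤ (s≤s⁻¹ (ℕ.+-cancelˡ-< c o 3 i<)))))
        end : + (c + p) ℤ.- + suc r ≡ ℤ.- + 1 ℤ.+ at p D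
        end = trans (end-offset r c p) (cong (λ d → ℤ.- + 1 ℤ.+ at p d) (sym D≡))
        rl : RowLength ν r (c + p)
        rl = rowLength⇐ shaped (trans (cong b end) (trans (Bits.b-flag D p p<) fl))
          (trans (cong h (trans (cong (λ d → + 1 ℤ.+ d) end) (suc-pred (at p D)))) (trans (Bits.h-old D p p<) (sym rw)))


-- The squares of the main descalator.

at-neg : ∀ q D → q < 3 → ℤ.- at q D ≡ at (2 ∸ q) (ℤ.- D)
at-neg 0 D _ = h D
  where
  h : ∀ D → ℤ.- (ℤ.- + 1 ℤ.+ (+ 0 ℤ.+ D)) ≡ ℤ.- + 1 ℤ.+ (+ 2 ℤ.+ ℤ.- D)
  h = solve-∀
at-neg 1 D _ = h D
  where
  h : ∀ D → ℤ.- (ℤ.- + 1 ℤ.+ (+ 1 ℤ.+ D)) ≡ ℤ.- + 1 ℤ.+ (+ 1 ℤ.+ ℤ.- D)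
  h = solve-∀
at-neg 2 D _ = h D
  where
  h : ∀ D → ℤ.- (ℤ.- + 1 ℤ.+ (+ 2 ℤ.+ D)) ≡ ℤ.- + 1 ℤ.+ (+ 0 ℤ.+ ℤ.- D)
  h = solve-∀
at-neg (suc (suc (suc _))) D (s≤s (s≤s (s≤s ())))

2∸<3 : ∀ q → 2 ∸ q < 3
2∸<3 q = s≤s (ℕ.m∸n≤m 2 q)

-- The cells of residue 0 in the main descalator form squares of side 2 whose
-- corners have even zero-based coordinates.
data Block (m : ℕ) : Box → Set where
  block : ∀ {d e} → d < 2 → e < 2 → Block m (d + (m + m) , e + (m + m))

halve : ∀ a → ∃[ m ] ∃[ d ] d < 2 × a ≡ d + (m + m)
halve zero = 0 , 0 , z<s , refl
halve (suc a) with halve a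
... | m , 0 , _ , e = m , 1 , s≤s z<s , cong suc e
... | m , 1 , _ , e = suc m , 0 , z<s , trans (cong suc e) (cong suc (sym (ℕ.+-suc m m)))
... | m , suc (suc _) , s≤s (s≤s ()) , _

private
  double-odd : ∀ m m′ → m + m ≢ suc (m′ + m′)
  double-odd zero m′ ()
  double-odd (suc m) zero e with () ← trans (sym (ℕ.+-suc m m)) (ℕ.suc-injective e)
  double-odd (suc m) (suc m′) e = double-odd m m′ (ℕ.suc-injective (trans (sym (ℕ.+-suc m m)) (trans (ℕ.suc-injective e) (cong suc (ℕ.+-suc m′ m′)))))

  double-inj : ∀ m m′ → m + m ≡ m′ + m′ → m ≡ m′
  double-inj zero zero _ = refl
  double-inj (suc m) (suc m′) e = cong suc (double-inj m m′ (ℕ.suc-injective (trans (sym (ℕ.+-suc m m)) (trans (ℕ.suc-injective e) (ℕ.+-suc m′ m′)))))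

parity-unique : ∀ {m m′ d d′} → d < 2 → d′ < 2 → d + (m + m) ≡ d′ + (m′ + m′) → m ≡ m′
parity-unique {m} {m′} {0} {0} _ _ e = double-inj m m′ e
parity-unique {m} {m′} {0} {1} _ _ e = contradiction e (double-odd m m′)
parity-unique {m} {m′} {1} {0} _ _ e = contradiction (sym e) (double-odd m′ m)
parity-unique {m} {m′} {1} {1} _ _ e = double-inj m m′ (ℕ.suc-injective e)
parity-unique {d = suc (suc _)} (s≤s (s≤s ())) _ _
parity-unique {d′ = suc (suc _)} _ (s≤s (s≤s ())) _

private
  mod-even : ∀ m → suc (m + m) + suc (suc (m + m)) ≡ 3 + m * 4
  mod-even = solveℕ-∀

  mod-odd : ∀ m → suc (suc (m + m)) + suc (suc (suc (m + m))) ≡ 1 + suc m * 4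
  mod-odd = solveℕ-∀

  even-sum : ∀ m → (suc (m + m) + suc (suc (m + m))) % 4 ≡ 3
  even-sum m = trans (cong (_% 4) (mod-even m)) ([m+kn]%n≡m%n 3 m 4)

  odd-sum : ∀ m → (suc (suc (m + m)) + suc (suc (suc (m + m)))) % 4 ≡ 1
  odd-sum m = trans (cong (_% 4) (mod-odd m)) ([m+kn]%n≡m%n 1 (suc m) 4)

  sum-halve : ∀ a → (suc a + suc (suc a)) % 4 ≡ 3 → ∃[ m ] a ≡ m + m
  sum-halve a e with halve a
  ... | m , 0 , _ , refl = m , refl
  ... | m , 1 , _ , refl with () ← trans (sym (odd-sum m)) e
  sum-halve a e | _ , suc (suc _) , s≤s (s≤s ()) , _

-- In one-based coordinates the off-diagonal cells of a square have i + j = 4m + 3, while the cells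
-- joining it to the next square have i + j = 4m + 5.
block⇒residue : ∀ {m x} → Block m x → MainResidue x 0
block⇒residue (block {d = 0} {0} _ _) = diagonal refl
block⇒residue (block {d = 1} {1} _ _) = diagonal refl
block⇒residue {m} (block {d = 0} {1} _ _) = off₃ (∣n-1+n∣≡1 (m + m)) (even-sum m)
block⇒residue {m} (block {d = 1} {0} _ _) = off₃ (∣1+n-n∣≡1 (m + m)) (trans (cong (_% 4) (ℕ.+-comm (suc (suc (m + m))) (suc (m + m)))) (even-sum m))
block⇒residue (block {d = suc (suc _)} (s≤s (s≤s ())) _)
block⇒residue (block {e = suc (suc _)} _ (s≤s (s≤s ())))

residue⇒block : ∀ {x} → MainResidue x 0 → ∃[ m ] Block m x
residue⇒block {a , .a} (diagonal refl) with halve a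
... | m , d , d<2 , refl = m , block d<2 d<2
residue⇒block {a , b} (off₃ e s) with ∣-∣≡1 a b e
... | inj₁ refl with sum-halve a s
...   | m , refl = m , block {e = 1} z<s (s≤s z<s)
residue⇒block {a , b} (off₃ e s) | inj₂ refl with sum-halve b (trans (cong (_% 4) (ℕ.+-comm (suc b) (suc (suc b)))) s)
...   | m , refl = m , block {d = 1} (s≤s z<s) z<s

odd⇒residue : ∀ m → MainResidue (suc (m + m) , suc (suc (m + m))) 1
odd⇒residue m = off₁ (∣n-1+n∣≡1 (suc (m + m))) (odd-sum m)

-- Adjacent cells share a row or a column, and either coordinate determines m. So distinct squares
-- touch only at corners.
block-adjacent : ∀ {m m′ x y} → Block m x → Block m′ y → ShareEdge x y → m ≡ m′
block-adjacent (block d< _) (block d′< _) (inj₁ (e , _)) = parity-unique d< d′< (ℕ.suc-injective e)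
block-adjacent (block _ e<) (block _ e′<) (inj₂ (e , _)) = parity-unique e< e′< (ℕ.suc-injective e)

residue-swap : ∀ {x k} → MainResidue x k → MainResidue (swap x) k
residue-swap (diagonal e) = diagonal (sym e)
residue-swap {x} (off₁ e s) = off₁ (trans (ℕ.∣-∣-comm (col x) (row x)) e) (trans (cong (_% 4) (ℕ.+-comm (col x) (row x))) s)
residue-swap {x} (off₃ e s) = off₃ (trans (ℕ.∣-∣-comm (col x) (row x)) e) (trans (cong (_% 4) (ℕ.+-comm (col x) (row x))) s)

ct-diagonal : ∀ a → ct (a , a) ≡ + 0
ct-diagonal a = ℤ.+-inverseʳ (+ suc a)

main-content : ∀ {x k} → MainResidue x k → ∃[ q ] q < 3 × ct x ≡ at q (+ 0)
main-content {a , b} = go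
  where
  off : ∣ a - b ∣ ≡ 1 → ∃[ q ] q < 3 × ct (a , b) ≡ at q (+ 0)
  off e with ∣-∣≡1 a b e
  ... | inj₁ refl = 2 , s≤s (s≤s z<s) , trans (ct-right a a) (cong (λ d → + 1 ℤ.+ d) (ct-diagonal a))
  ... | inj₂ refl = 0 , z<s , trans (ct-down b b) (cong (λ d → ℤ.- + 1 ℤ.+ d) (ct-diagonal b))
  go : ∀ {k} → MainResidue (a , b) k → ∃[ q ] q < 3 × ct (a , b) ≡ at q (+ 0)
  go (diagonal refl) = 1 , s≤s z<s , ct-diagonal a
  go (off₁ e _) = off e
  go (off₃ e _) = off e

-- Residues expressed through bits and squares.

module Residues (X : QuotientType) (n : ℕ) .{{_ : NonZero n}} (rank : minRank X ≤ n)
  {w g : ℤ → ℤ} (I : Shape.Inverse X n rank w g) where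
  open Quotient X n renaming (N to Nℕ)
  open Index n
  open Generators X n
  open Lengths X n rank
  open Bands X n rank I
  open Band

  zone : ∀ {A B} → Special A B → Pred Box 0ℓ
  zone (bottom _)  = Descalators
  zone (top _ _ _) = Escalators

  private
    fr-content : ∀ x → fr (ct x) ≡ fold (content x)
    fr-content x = fr-def (ct x)

    content< : ∀ x → content x < 2 * n
    content< x = n%ℕd<d (ct x) (2 * n)

    fold-case : ∀ {c} → c < 2 * n → fold c ≡ c ⊎ fold c ≡ 2 * n ∸ c
    fold-case {c} _ with c ≤ᵇ n
    ... | true  = inj₁ refl
    ... | false = inj₂ refl

    reflected : ∀ {c t} → c < 2 * n → 2 * n ∸ c ≡ t → c ≡ 2 * n ∸ t
    reflected {c} c< e = trans (sym (ℕ.m∸[m∸n]≡n (ℕ.<⇒≤ c<))) (cong (2 * n ∸_) e)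

    1≤2n : 1 ≤ 2 * n
    1≤2n = ℕ.≤-trans 0<n (ℕ.<⇒≤ n<2n)

  zone⇒ : ∀ {A B} (sp : Special A B) z → z ∈ zone sp → z ∈ Zone A B
  zone⇒ (bottom _) z (inj₁ e) = inj₂ (trans (fr-content z) (trans (cong fold e) (fold-≤ z≤n)))
  zone⇒ (bottom _) z (inj₂ (inj₁ e)) = inj₁ (trans (fr-content z) (trans (cong fold e) (fold-≤ 0<n)))
  zone⇒ (bottom _) z (inj₂ (inj₂ e)) = inj₁ (trans (fr-content z) (trans (cong fold e) (fold-≥ 0<n (ℕ.m+[n∸m]≡n 1≤2n))))
  zone⇒ (top A eA _) z (inj₁ e) = inj₁ (trans (fr-content z) (trans (cong fold (trans e (cong (_∸ 1) (sym eA)))) (fold-≤ (ℕ.<⇒≤ (ℕ.≤-reflexive eA)))))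
  zone⇒ (top A eA _) z (inj₂ (inj₁ e)) = inj₂ (trans (fr-content z) (trans (cong fold e) (fold-≤ ℕ.≤-refl)))
  zone⇒ (top A eA _) z (inj₂ (inj₂ e)) = inj₁ (trans (fr-content z) (trans (cong fold e) (fold-≥ (ℕ.<⇒≤ (ℕ.≤-reflexive eA))
    (trans (cong (λ m → A + m) (ℕ.+-comm n 1)) (trans (ℕ.+-suc A n) (trans (cong (_+ n) eA) (sym 2n≡n+n)))))))

  zone⇐ : ∀ {A B} (sp : Special A B) z → z ∈ Zone A B → z ∈ zone sp
  zone⇐ (bottom _) z m with fold-case (content< z) | m
  ... | inj₁ p | inj₁ e = inj₂ (inj₁ (trans (sym p) (trans (sym (fr-content z)) e)))
  ... | inj₁ p | inj₂ e = inj₁ (trans (sym p) (trans (sym (fr-content z)) e))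
  ... | inj₂ p | inj₁ e = inj₂ (inj₂ (reflected (content< z) (trans (sym p) (trans (sym (fr-content z)) e))))
  ... | inj₂ p | inj₂ e = contradiction (reflected (content< z) (trans (sym p) (trans (sym (fr-content z)) e))) (ℕ.<⇒≢ (content< z))
  zone⇐ (top A eA _) z m with fold-case (content< z) | m
  ... | inj₁ p | inj₁ e = inj₁ (trans (sym p) (trans (sym (fr-content z)) (trans e (cong (_∸ 1) eA))))
  ... | inj₁ p | inj₂ e = inj₂ (inj₁ (trans (sym p) (trans (sym (fr-content z)) e)))
  ... | inj₂ p | inj₁ e = inj₂ (inj₂ (trans (reflected (content< z) (trans (sym p) (trans (sym (fr-content z)) e))) k))
    where
    k : 2 * n ∸ A ≡ n + 1
    k = trans (cong (_∸ A) (trans 2n≡n+n (trans (cong (_+ n) (sym eA)) (sym (ℕ.+-suc A n))))) (trans (ℕ.m+n∸m≡n A (suc n)) (ℕ.+-comm 1 n))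
  ... | inj₂ p | inj₂ e = inj₂ (inj₁ (trans (reflected (content< z) (trans (sym p) (trans (sym (fr-content z)) e))) (trans (cong (_∸ n) 2n≡n+n) (ℕ.m+n∸n≡m n n))))

  zone-swap : ∀ {A B} z → z ∈ Zone A B → swap z ∈ Zone A B
  zone-swap {A} {B} z = subst (λ c → c ≡ A ⊎ c ≡ B) (sym (trans (cong fr (ct-swap z)) (fr-neg (ct z))))

  -- The residues near a special pair with the geometry of components removed; `residue⇒` and
  -- `residue⇐` translate. The lower band reuses the row rule at the transposed box, as the diagram
  -- is symmetric.
  data Res (A B : ℕ) (x : Box) (k : ℕ) : Set where
    upperᵣ : UpperRes A B x k → Res A B x k
    lowerᵣ : UpperRes A B (swap x) k → Res A B x k
    mainᵣ  : B ≡ 0 → MainResidue x k → Res A B x k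

  res-swap : ∀ {A B x k} → Res A B x k → Res A B (swap x) k
  res-swap (upperᵣ r) = lowerᵣ r
  res-swap (lowerᵣ r) = upperᵣ r
  res-swap (mainᵣ e r) = mainᵣ e (residue-swap r)

  module _ {A B} (sp : Special A B) where
    private
      sym-zone : ∀ z → z ∈ zone sp → swap z ∈ zone sp
      sym-zone z = zone⇐ sp (swap z) ∘ zone-swap z ∘ zone⇒ sp z

      rowResidue-resp : ∀ (E E′ : Pred Box 0ℓ) ν r j k → (∀ z → z ∈ E ⇔ z ∈ E′) → RowResidue E A B ν (r , j) k → RowResidue E′ A B ν (r , j) k
      rowResidue-resp E E′ ν r j k E⇔ (c , p , q , meets , rest) =
        c , p , q , (λ i → mk⇔ (λ y → to (meets i) (from (E⇔ (r , i)) y)) (λ y → to (E⇔ (r , i)) (from (meets i) y))) , rest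

      component-transpose : ∀ x z → z ∈ Component (zone sp) (swap x) ⇔ swap z ∈ Component (zone sp) x
      component-transpose x z = mk⇔ (component-swap {zone sp} sym-zone {swap x} {z}) (component-swap {zone sp} sym-zone {x} {swap z})

    bandResidue⇒ : ∀ x k → BandResidue (Component (zone sp) x) A B μ x k → Res A B x k
    bandResidue⇒ x k (inj₁ (upper , rr)) =
      upperᵣ (band⇒ sp {μ} {Component (zone sp) x} {k} μ-shaped (λ z z∈ → zone⇒ sp z (component-⊆ {zone sp} {x} z∈)) upper x rr)
    bandResidue⇒ x k (inj₂ (lower , rr)) =
      lowerᵣ (band⇒ sp {transposed μ} {λ z → swap z ∈ Component (zone sp) x} {k} transposed-shaped
        (λ z z∈ → zone-swap (swap z) (zone⇒ sp (swap z) (component-⊆ {zone sp} {x} z∈))) (λ z z∈ → lower (swap z) z∈) (swap x) rr)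

    bandResidue⇐ : ∀ x k → UpperRes A B x k ⊎ UpperRes A B (swap x) k → BandResidue (Component (zone sp) x) A B μ x k
    bandResidue⇐ x k (inj₁ r) = inj₁ (band⇐ sp {zone sp} (zone⇒ sp) (zone⇐ sp) {μ} {k} μ-shaped {x} r)
    bandResidue⇐ x k (inj₂ r) = inj₂ (lower , rowResidue-resp (Component (zone sp) (swap x)) (λ z → swap z ∈ Component (zone sp) x) (transposed μ) (proj₂ x) (proj₁ x) k
        (component-transpose x) (proj₂ upper))
      where
      upper : Defs.Upper (Component (zone sp) (swap x)) × RowResidue (Component (zone sp) (swap x)) A B (transposed μ) (swap x) k
      upper = band⇐ sp {zone sp} (zone⇒ sp) (zone⇐ sp) {transposed μ} {k} transposed-shaped {swap x} r
      lower : Defs.Lower (Component (zone sp) x)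
      lower z z∈ = proj₁ upper (swap z) (component-swap {zone sp} sym-zone {x} {z} z∈)

  private
    fr-main : ∀ {x k} → MainResidue x k → variant₀ X ≡ variantD → x ∈ Descalators
    fr-main {x} r v with main-content r
    ... | q , q< , e = zone⇐ (bottom v) x (subst (λ d → fr d ≡ 1 ⊎ fr d ≡ 0) (sym e) (zone-at (bottom v) (+ 0) fr-0 q q<))

    main-component : ∀ {x k} → variant₀ X ≡ variantD → MainResidue x k → Main (Component Descalators x)
    main-component {a , b} v r = go r
      where
      near : ∣ a - b ∣ ≡ 1 → Main (Component Descalators (a , b))
      near e with ∣-∣≡1 a b e
      ... | inj₁ refl = (a , a) , (fr-main r v , (shareEdge left , fr-main {a , a} (diagonal refl) v) ◅ done) , refl
      ... | inj₂ refl = (b , b) , (fr-main r v , (shareEdge up , fr-main {b , b} (diagonal refl) v) ◅ done) , refl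
      go : ∀ {k} → MainResidue (a , b) k → Main (Component Descalators (a , b))
      go (diagonal e) = (a , b) , (fr-main r v , done) , e
      go (off₁ e _) = near e
      go (off₃ e _) = near e

  residue⇐ : ∀ {A B x k} → Special A B → Res A B x k → HasResidue μ x k
  residue⇐ {x = x} {k} sp@(bottom v) (upperᵣ r) = descalator v (bandResidue⇐ sp x k (inj₁ r))
  residue⇐ {x = x} {k} sp@(bottom v) (lowerᵣ r) = descalator v (bandResidue⇐ sp x k (inj₂ r))
  residue⇐ (bottom v) (mainᵣ _ r) = mainDescalator v (main-component v r) r
  residue⇐ {x = x} {k} sp@(top A eA v) (upperᵣ r) = escalator v (subst (λ a → BandResidue (Component Escalators x) a n μ x k) (cong (_∸ 1) eA) (bandResidue⇐ sp x k (inj₁ r)))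
  residue⇐ {x = x} {k} sp@(top A eA v) (lowerᵣ r) = escalator v (subst (λ a → BandResidue (Component Escalators x) a n μ x k) (cong (_∸ 1) eA) (bandResidue⇐ sp x k (inj₂ r)))
  residue⇐ (top _ _ _) (mainᵣ e _) = contradiction e (λ e → ℕ.<⇒≢ 0<n (sym e))

  res-value : ∀ {A B x k} → Special A B → Res A B x k → k ≡ A ⊎ k ≡ B
  res-value sp (upperᵣ (upperRes _ p _ _ _ _ _ _ _ _ m)) = [ inj₁ ∘ proj₁ , inj₂ ∘ proj₁ ]′ (bandResidues⇒ p m)
  res-value sp (lowerᵣ (upperRes _ p _ _ _ _ _ _ _ _ m)) = [ inj₁ ∘ proj₁ , inj₂ ∘ proj₁ ]′ (bandResidues⇒ p m)
  res-value (top _ _ _) (mainᵣ e _) = contradiction e (λ e → ℕ.<⇒≢ 0<n (sym e))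
  res-value (bottom _) (mainᵣ _ (diagonal _)) = inj₂ refl
  res-value (bottom _) (mainᵣ _ (off₁ _ _)) = inj₁ refl
  res-value (bottom _) (mainᵣ _ (off₃ _ _)) = inj₂ refl

  data ResidueView (x : Box) (k : ℕ) : Set where
    special : ∀ {A B} → Special A B → Res A B x k → ResidueView x k
    regular : fr (ct x) ≡ k → (∀ {A B} → Special A B → k ≢ A × k ≢ B) → ResidueView x k

  residue-view : ∀ {x k} → HasResidue μ x k → ResidueView x k
  residue-view {x} {k} (escalator v r) = special sp (bandResidue⇒ sp x k r)
    where sp = top (n ∸ 1) (ℕ.m+[n∸m]≡n 0<n) v
  residue-view {x} {k} (descalator v r) = special (bottom v) (bandResidue⇒ (bottom v) x k r)
  residue-view (mainDescalator v _ r) = special (bottom v) (mainᵣ refl r)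
  residue-view {x} {k} (fixed ¬esc ¬desc e) = regular (trans (fr-content x) e) ns
    where
    ns : ∀ {A B} → Special A B → k ≢ A × k ≢ B
    ns sp@(bottom v) = (λ p → ¬desc v (zone⇐ sp x (inj₁ (trans (fr-content x) (trans e p))))) , λ p → ¬desc v (zone⇐ sp x (inj₂ (trans (fr-content x) (trans e p))))
    ns sp@(top _ _ v) = (λ p → ¬esc v (zone⇐ sp x (inj₁ (trans (fr-content x) (trans e p))))) , λ p → ¬esc v (zone⇐ sp x (inj₂ (trans (fr-content x) (trans e p))))

  regular-residue : ∀ {x k} → fr (ct x) ≡ k → (∀ {A B} → Special A B → k ≢ A × k ≢ B) → HasResidue μ x k
  regular-residue {x} {k} e ns = fixed
    (λ v esc → outside (top (n ∸ 1) (ℕ.m+[n∸m]≡n 0<n) v) esc) (λ v desc → outside (bottom v) desc) (trans (sym (fr-content x)) e)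
    where
    outside : ∀ {A B} (sp : Special A B) → x ∉ zone sp
    outside sp z∈ = [ (λ p → proj₁ (ns sp) (trans (sym e) p)) , (λ p → proj₂ (ns sp) (trans (sym e) p)) ]′ (zone⇒ sp x z∈)

  -- The two special pairs have no residue in common, as n ≥ 3.
  special-unique : ∀ {A B A′ B′ k} → Special A B → Special A′ B′ → k ≡ A ⊎ k ≡ B → k ≡ A′ ⊎ k ≡ B′ → A ≡ A′ × B ≡ B′
  special-unique (bottom _) (bottom _) _ _ = refl , refl
  special-unique (top A e _) (top A′ e′ _) _ _ = ℕ.suc-injective (trans e (sym e′)) , refl
  special-unique (bottom v) sp@(top A e _) p q = ⊥-elim (small p q)
    where
    small : ∀ {k} → k ≡ 1 ⊎ k ≡ 0 → k ≡ A ⊎ k ≡ n → ⊥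
    small (inj₁ refl) (inj₁ r) = ℕ.<⇒≢ (special⇒3≤n sp) (trans (cong suc r) e)
    small (inj₁ refl) (inj₂ r) = ℕ.<⇒≢ 2≤n r
    small (inj₂ refl) (inj₁ r) = ℕ.<⇒≢ 2≤n (trans (cong suc r) e)
    small (inj₂ refl) (inj₂ r) = ℕ.<⇒≢ 0<n r
  special-unique sp@(top A e _) (bottom v) p q with special-unique (bottom v) sp q p
  ... | x , y = sym x , sym y

  residue⇒ : ∀ {A B x k} → Special A B → k ≡ A ⊎ k ≡ B → HasResidue μ x k → Res A B x k
  residue⇒ sp k∈ r with residue-view r
  ... | regular _ ns = ⊥-elim ([ proj₁ (ns sp) , proj₂ (ns sp) ]′ k∈)
  ... | special sp′ res with refl , refl ← special-unique sp′ sp (res-value sp′ res) k∈ = res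

  res-zone : ∀ {A B x k} → Special A B → Res A B x k → x ∈ Zone A B
  res-zone {A} {B} {x} sp (upperᵣ (upperRes D _ q e _ _ q< _ _ ex _)) = subst (λ d → fr d ≡ A ⊎ fr d ≡ B) (sym ex) (zone-at sp D e q q<)
  res-zone {A} {B} {x} sp (lowerᵣ (upperRes D _ q e _ _ q< _ _ ex _)) = zone-swap (swap x) (subst (λ d → fr d ≡ A ⊎ fr d ≡ B) (sym ex) (zone-at sp D e q q<))
  res-zone {x = x} (bottom v) (mainᵣ _ r) = zone⇒ (bottom v) x (fr-main r v)
  res-zone (top _ _ _) (mainᵣ e _) = contradiction e (λ e → ℕ.<⇒≢ 0<n (sym e))

  -- The band rules place A only at the outer contents D - 1 and D + 1, whose folded residue is A,
  -- and the same holds for residue 1 on the main descalator. Elsewhere the residue is the fixed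
  -- one.
  adjacent-fr : ∀ {x k} → (∀ A → ¬ Special A k) → HasResidue μ x k → fr (ct x) ≡ k
  adjacent-fr {x} {k} ns r with residue-view r
  ... | regular e _ = e
  ... | special {A} {B} sp res with res-value sp res
  ...   | inj₂ refl = contradiction sp (ns A)
  ...   | inj₁ refl = go res
    where
    cols : ∀ {x D} q → fr D ≡ B → q ≡ 0 ⊎ q ≡ 2 → ct x ≡ at q D → fr (ct x) ≡ A
    cols {D = D} _ e (inj₁ refl) ex = trans (cong fr (trans ex (at-0 D))) (proj₂ (special-centre sp D e))
    cols {D = D} _ e (inj₂ refl) ex = trans (cong fr (trans ex (at-2 D))) (proj₁ (special-centre sp D e))
    up-fr : ∀ {x} → UpperRes A B x A → fr (ct x) ≡ A
    up-fr {y} (upperRes D p q e _ _ _ _ _ ex m) with bandResidues⇒ p m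
    ... | inj₁ (_ , t) = cols {y} q e (resA-col p q t) ex
    ... | inj₂ (A≡B , _) = contradiction A≡B (special-A≢B sp)
    fr-main-A : ∀ {B x} → Special A B → B ≡ 0 → MainResidue x A → fr (ct x) ≡ A
    fr-main-A (top _ _ _) e _ = contradiction e (λ e → ℕ.<⇒≢ 0<n (sym e))
    fr-main-A {x = a , b} sp@(bottom _) _ (off₁ e _) with ∣-∣≡1 a b e
    ... | inj₁ refl = trans (cong fr (trans (ct-right a a) (cong (λ d → + 1 ℤ.+ d) (ct-diagonal a)))) (proj₁ (special-centre sp (+ 0) fr-0))
    ... | inj₂ refl = trans (cong fr (trans (ct-down b b) (cong (λ d → ℤ.- + 1 ℤ.+ d) (ct-diagonal b)))) (proj₂ (special-centre sp (+ 0) fr-0))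
    go : Res A B x A → fr (ct x) ≡ A
    go (upperᵣ u) = up-fr u
    go (lowerᵣ u) = trans (sym (trans (cong fr (ct-swap x)) (fr-neg (ct x)))) (up-fr u)
    go (mainᵣ e m) = fr-main-A sp e m


-- Boxes changed by a generator of type C.

data Sign (D : ℤ) : Set where
  positive : + 1 ℤ.≤ D → Sign D
  negative : + 1 ℤ.≤ ℤ.- D → Sign D
  null     : D ≡ + 0 → Sign D

sign : ∀ D → Sign D
sign (+ zero)  = null refl
sign (+ suc m) = positive (+≤+ (s≤s z≤n))
sign -[1+ m ]  = negative (+≤+ (s≤s z≤n))

even⇒double : ∀ {m} → 2 ∣ m → ∃[ k ] m ≡ k + k
even⇒double (divides k e) = k , trans e (trans (ℕ.*-comm k 2) (cong (λ x → k + x) (ℕ.+-identityʳ k)))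

even-suc⇒ : ∀ {m} → 2 ∣ suc m → ∃[ k ] m ≡ suc (k + k)
even-suc⇒ d with even⇒double d
... | suc k , e = k , trans (ℕ.suc-injective e) (ℕ.+-suc k k)

old-cong : ∀ {b₁ b₂ b₃ c₁ c₂ c₃} q → b₁ ≡ c₁ → b₂ ≡ c₂ → b₃ ≡ c₃ → old b₁ b₂ b₃ q ≡ old c₁ c₂ c₃ q
old-cong q refl refl refl = refl

new-cong : ∀ {b₀ b₁ b₃ c₀ c₁ c₃} q → b₀ ≡ c₀ → b₁ ≡ c₁ → b₃ ≡ c₃ → new b₀ b₁ b₃ q ≡ new c₀ c₁ c₃ q
new-cong q refl refl refl = refl

∧-right : ∀ {a b} → a ∧ b ≡ false → a ≡ true → b ≡ false
∧-right e refl = e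

∧-left : ∀ {a b} → a ∧ b ≡ false → b ≡ true → a ≡ false
∧-left {false} _ _ = refl
∧-left {true} e refl = e

module Changes (X : QuotientType) (n : ℕ) .{{_ : NonZero n}} (rank : minRank X ≤ n)
  {w g w′ g′ : ℤ → ℤ} (I : Shape.Inverse X n rank w g) (I′ : Shape.Inverse X n rank w′ g′) where
  open Quotient X n renaming (N to Nℕ)
  open Index n
  open Generators X n
  open Lengths X n rank
  open Abacus X n rank
  open Shape X n rank
  open Diagrams X n rank
  open Bands X n rank I
  open Residues X n rank I
  open Inverse I renaming (equivariant to E; equivariant⁻ to F)

  private module Target = Bands X n rank I′

  μ′ : Diagram
  μ′ = 𝒞 w′

  h′ : ℤ → ℕ
  h′ = h₀ I′

  Added Removed : Pred Box 0ℓ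
  Added   x = x ∈ μ′ × x ∉ μ
  Removed x = x ∈ μ × x ∉ μ′

  added-swap : ∀ {x} → Added x → Added (swap x)
  added-swap (p , q) = Target.μ-swap p , λ r → q (μ-swap r)

  removed-swap : ∀ {x} → Removed x → Removed (swap x)
  removed-swap (p , q) = μ-swap p , λ r → q (Target.μ-swap r)

  module _ {r j : ℕ} {d : ℤ} {m : ℕ} (e : ct (r , j) ≡ d) where
    μ⇒ : h d ≡ m → (r , j) ∈ μ → r < m
    μ⇒ hd p = subst (r <_) (trans (cong h e) hd) (to (μ-shaped (r , j)) p)
    μ⇐ : h d ≡ m → r < m → (r , j) ∈ μ
    μ⇐ hd p = from (μ-shaped (r , j)) (subst (r <_) (sym (trans (cong h e) hd)) p)
    μ′⇒ : h′ d ≡ m → (r , j) ∈ μ′ → r < m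
    μ′⇒ hd p = subst (r <_) (trans (cong h′ e) hd) (to (Target.μ-shaped (r , j)) p)
    μ′⇐ : h′ d ≡ m → r < m → (r , j) ∈ μ′
    μ′⇐ hd p = from (Target.μ-shaped (r , j)) (subst (r <_) (sym (trans (cong h′ e) hd)) p)

  added-≢ : ∀ {x} → Added x → h′ (ct x) ≢ h (ct x)
  added-≢ {r , j} (p , q) e = q (μ⇐ refl refl (μ′⇒ refl e p))

  removed-≢ : ∀ {x} → Removed x → h′ (ct x) ≢ h (ct x)
  removed-≢ {r , j} (p , q) e = q (μ′⇐ refl e (μ⇒ refl refl p))

  flush : ∀ q m → b (q ℤ.+ + m ℤ.* P) ≡ true → b q ≡ true
  flush q m t = dec-true (g (ε q) ℤ.≤? N ℤ.+ + 0) (ℤ.≤-trans (subst (g (ε q) ℤ.≤_) (sym e) (≤-via (+≤+ (z≤n {m * Nℕ})) (trans (cong (ℤ._- + 0) (ℤ.pos-* m Nℕ)) (k (g (ε q)) (+ m ℤ.* N)))))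
      (does-true (g (ε (q ℤ.+ + m ℤ.* P)) ℤ.≤? N ℤ.+ + 0) t))
    where
    e : g (ε (q ℤ.+ + m ℤ.* P)) ≡ g (ε q) ℤ.+ + m ℤ.* N
    e = trans (cong g (ε-shift (+ m) q)) (Equivariant.shift F (+ m) (ε q))
    k : ∀ x y → y ℤ.- + 0 ≡ x ℤ.+ y ℤ.- x
    k = solve-∀

  -- Beads are flush and mirrored, so two positions symmetric about a point to
  -- the right of the main diagonal cannot both carry one.
  exclusive : ∀ {A B} → Special A B → ∀ D → fr D ≡ B → + 1 ℤ.≤ D → let open Bits D in Exclusive b₀ b₁ b₂ b₃
  exclusive sp D e 1≤D = apart (+ 1 ℤ.+ D) (ℤ.- + 2 ℤ.+ D) (k₁ D) , apart D (ℤ.- + 1 ℤ.+ D) (k₂ D)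
    where
    k₁ : ∀ D → ℤ.- + 2 ℤ.+ D ≡ ℤ.- (+ 1 ℤ.+ (+ 1 ℤ.+ D)) ℤ.+ (D ℤ.+ D)
    k₁ = solve-∀
    k₂ : ∀ D → ℤ.- + 1 ℤ.+ D ≡ ℤ.- (+ 1 ℤ.+ D) ℤ.+ (D ℤ.+ D)
    k₂ = solve-∀
    2D : ∃[ m ] D ℤ.+ D ≡ + m ℤ.* P
    2D with special-double sp D e
    ... | + m , x = m , x
    ... | -[1+ m ] , x = contradiction (ℤ.+-mono-≤ 1≤D 1≤D) (ℤ.<⇒≱ (ℤ.≤-<-trans (ℤ.≤-reflexive x)
            (ℤ.≤-<-trans (ℤ.*-monoʳ-≤-nonNeg P {x = -[1+ m ]} {y = + 0} ℤ.-≤+) (+<+ z<s))))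
    apart : ∀ u v → v ≡ ℤ.- (+ 1 ℤ.+ u) ℤ.+ (D ℤ.+ D) → b v ∧ b u ≡ false
    apart u v x with b v in ev | b u in eu
    ... | false | _ = refl
    ... | true | false = refl
    ... | true | true with 2D
    -- A bead at v yields, m periods earlier, a bead at the mirror image of u, so u would carry a
    -- gap.
    ...   | m , y = trans (sym (flush (ℤ.- (+ 1 ℤ.+ u)) m (trans (cong b (sym (trans x (cong (λ z → ℤ.- (+ 1 ℤ.+ u) ℤ.+ z) y)))) ev)))
              (trans (bead-mirror I u) (cong not eu))

  opposite : ∀ {x} D q → q < 3 → ct x ≡ at q D → ct (swap x) ≡ at (2 ∸ q) (ℤ.- D)
  opposite {x} D q q< e = trans (ct-swap x) (trans (cong ℤ.-_ e) (at-neg q D q<))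

  null⇒0 : ∀ {A B} → Special A B → ∀ D → fr D ≡ B → D ≡ + 0 → B ≡ 0
  null⇒0 _ _ e refl = trans (sym e) fr-0

  module Main where
    open Bits (+ 0) public

    b₂≡ : b₂ ≡ not b₁
    b₂≡ = bead-mirror I (ℤ.- + 1)

    b₃≡ : b₃ ≡ not b₀
    b₃≡ = bead-mirror I (ℤ.- + 2)

  module AdjacentCase (i : ℕ) (ns : ∀ A → ¬ Special A i)
    (on : ∀ d → fr d ≡ i → h′ d ≡ bit (b (ℤ.- + 1 ℤ.+ d)) + h (+ 1 ℤ.+ d))
    (off : ∀ d → fr d ≢ i → h′ d ≡ h d)
    (even : Special 1 0 → 2 ∣ h (+ 0)) where

    R : Pred Box 0ℓ
    R x = HasResidue μ x i

    not-next : ∀ d → fr d ≡ i → fr (+ 1 ℤ.+ d) ≢ i × fr (ℤ.- + 1 ℤ.+ d) ≢ i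
    not-next d e = fr-consecutive d e , λ x → fr-consecutive (ℤ.- + 1 ℤ.+ d) x (trans (cong fr (suc-pred d)) e)

    -- Adjacent contents differ in folded residue, so every component of residue i is a single box.
    neighbour-∉ : ∀ {x y} → fr (ct x) ≡ i → ShareEdge x y → ¬ R y
    neighbour-∉ {x} {y} e se r with ct-edge (edge se)
    ... | inj₁ c = proj₁ (not-next (ct x) e) (trans (cong fr (sym c)) (adjacent-fr ns r))
    ... | inj₂ c = proj₂ (not-next (ct x) e) (trans (cong fr (sym c)) (adjacent-fr ns r))

    h-D-1 : ∀ d → h (ℤ.- + 1 ℤ.+ d) ≡ bit (b (ℤ.- + 1 ℤ.+ d)) + h d
    h-D-1 d = trans (h-step (ℤ.- + 1 ℤ.+ d)) (cong (λ x → bit (b (ℤ.- + 1 ℤ.+ d)) + h x) (suc-pred d))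

    -- An addable box fills a corner: its left neighbour gives h (d - 1) > r, its upper one h (d +
    -- 1) ≥ r, while h d ≤ r. So d - 1 carries a bead, and the exchange lifts the height at d above
    -- r.
    addLike : ∀ {K} → AddLike μ R K → K ⊆ μ′
    addLike {K} like {r , j} x∈K = μ′⇐ refl (on d e) (go (b (ℤ.- + 1 ℤ.+ d)) refl)
      where
      open AddLike like
      d = ct (r , j)
      e : fr d ≡ i
      e = adjacent-fr ns (within x∈K)
      outside : h d ≤ r
      outside = ℕ.≮⇒≥ λ p → disjoint x∈K (μ⇐ refl refl p)
      above-≤ : ∀ r′ → r′ ≡ r → r ≤ h (+ 1 ℤ.+ d)
      above-≤ zero refl = z≤n
      above-≤ (suc r′) refl with upward r′ j x∈K
      ... | inj₂ p = contradiction (within p) (neighbour-∉ e (shareEdge up))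
      ... | inj₁ p = μ⇒ (trans (sym (suc-pred (ct (r′ , j)))) (cong (λ x → + 1 ℤ.+ x) (sym (ct-down r′ j)))) refl p
      left-< : ∀ j′ → j′ ≡ j → r < h (ℤ.- + 1 ℤ.+ d)
      -- In the first column the border replaces the left neighbour: h (-(r + 1)) is at least r + 1.
      left-< zero refl = ℤ.drop‿+≤+ (ℤ.≤-trans (ℤ.i≤j+i (+ suc r) (+ h (+ suc r))) (ℤ.≤-reflexive (sym (trans (cong (λ x → + h x) (k (+ suc r))) (h-mirror (+ suc r))))))
        where
        k : ∀ r → ℤ.- + 1 ℤ.+ (+ 1 ℤ.- r) ≡ ℤ.- r
        k = solve-∀
      left-< (suc j′) refl with leftward r j′ x∈K
      ... | inj₂ p = contradiction (within p) (neighbour-∉ e (shareEdge left))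
      ... | inj₁ p = μ⇒ (trans (sym (pred-suc (ct (r , j′)))) (cong (λ x → ℤ.- + 1 ℤ.+ x) (sym (ct-right r j′)))) refl p
      go : ∀ c → b (ℤ.- + 1 ℤ.+ d) ≡ c → r < bit (b (ℤ.- + 1 ℤ.+ d)) + h (+ 1 ℤ.+ d)
      go true c = subst (λ x → r < bit x + h (+ 1 ℤ.+ d)) (sym c) (s≤s (above-≤ r refl))
      go false c = contradiction outside (ℕ.<⇒≱ (subst (r <_) (trans (h-D-1 d) (cong (λ x → bit x + h d) c)) (left-< j refl)))

    removeLike : ∀ {K} → RemoveLike μ R K → ∀ {x} → x ∈ K → x ∉ μ′
    removeLike {K} like {r , j} x∈K x∈μ′ = go (b d) (b (ℤ.- + 1 ℤ.+ d)) refl refl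
      where
      open RemoveLike like
      d = ct (r , j)
      e : fr d ≡ i
      e = adjacent-fr ns (within x∈K)
      insideD : r < h d
      insideD = μ⇒ refl refl (inside x∈K)
      right-≤ : h (+ 1 ℤ.+ d) ≤ r
      right-≤ = ℕ.≮⇒≥ λ p → rightward r j x∈K (μ⇐ (ct-right r j) refl p) λ q → neighbour-∉ e (shareEdge right) (within q)
      down-≤ : h (ℤ.- + 1 ℤ.+ d) ≤ suc r
      down-≤ = ℕ.≮⇒≥ λ p → downward r j x∈K (μ⇐ (ct-down r j) refl p) λ q → neighbour-∉ e (shareEdge down) (within q)
      go : ∀ c c′ → b d ≡ c → b (ℤ.- + 1 ℤ.+ d) ≡ c′ → ⊥
      go false _ x _ = ℕ.<⇒≱ insideD (ℕ.≤-trans (ℕ.≤-reflexive (trans (h-step d) (cong (λ y → bit y + h (+ 1 ℤ.+ d)) x))) right-≤)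
      go true true x y = ℕ.<⇒≱ insideD (s≤s⁻¹ (ℕ.≤-trans (ℕ.≤-reflexive (sym (trans (h-D-1 d) (cong (λ z → bit z + h d) y)))) down-≤))
      go true false x y = ℕ.<⇒≱ (μ′⇒ refl (trans (on d e) (cong (λ z → bit z + h (+ 1 ℤ.+ d)) y)) x∈μ′) right-≤

    Changed : Pred Box 0ℓ
    Changed x = Added x ⊎ Removed x

    changed-swap : ∀ {x} → Changed x → Changed (swap x)
    changed-swap (inj₁ p) = inj₁ (added-swap p)
    changed-swap (inj₂ p) = inj₂ (removed-swap p)

    changed-fr : ∀ {x} → Changed x → fr (ct x) ≡ i
    changed-fr {x} c with fr (ct x) ≟ i
    ... | yes e = e
    ... | no ¬e = contradiction (off (ct x) ¬e) ([ added-≢ , removed-≢ ]′ c)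

    h′-newA : ∀ {B} → Special i B → ∀ D → fr D ≡ B → ∀ q → q ≡ 0 ⊎ q ≡ 2 → let open Bits D in h′ (at q D) ≡ newA b₀ b₂ b₃ q + M
    h′-newA sp D e _ (inj₁ refl) = trans (on (at 0 D) (trans (cong fr (at-0 D)) (proj₂ (special-centre sp D e))))
        (trans (cong₂ (λ x y → bit x + y) (b-flag 0 z<s) (trans (cong h (at-suc 0 D)) (h-old 1 (s≤s z<s)))) (sym (ℕ.+-assoc (bit b₀) (bit b₂ + bit b₃) M)))
      where open Bits D
    h′-newA sp D e _ (inj₂ refl) = trans (on (at 2 D) (trans (cong fr (at-2 D)) (proj₁ (special-centre sp D e))))
        (cong₂ (λ x y → bit x + y) (b-flag 2 (s≤s (s≤s z<s))) (trans (cong h (at-suc 2 D)) (h-old 3 (s≤s (s≤s (s≤s z<s))))))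
      where open Bits D

    private
      q<3 : ∀ {q} → q ≡ 0 ⊎ q ≡ 2 → q < 3
      q<3 (inj₁ refl) = z<s
      q<3 (inj₂ refl) = s≤s (s≤s z<s)

    offset-A : ∀ {B} → Special i B → ∀ D → fr D ≡ B → ∀ q (q∈ : q ≡ 0 ⊎ q ≡ 2) → ∀ {r j} → ct (r , j) ≡ at q D → Changed (r , j) → let open Bits D in
      ∃[ t ] t < 3 × r ≡ t + M × ((oldD q ≤ t × t < newA b₀ b₂ b₃ q) ⊎ (newA b₀ b₂ b₃ q ≤ t × t < oldD q))
    offset-A sp D e q q∈ {r} {j} ex (inj₁ (p , ¬p)) with offset {hi = newA b₀ b₂ b₃ q} (ℕ.≮⇒≥ λ x → ¬p (μ⇐ ex (h-old q (ℕ.m≤n⇒m≤1+n (q<3 q∈))) x)) (μ′⇒ ex (h′-newA sp D e q q∈) p) (newA≤3 b₀ b₂ b₃ q)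
      where open Bits D
    ... | t , t< , r≡ , l , u = t , t< , r≡ , inj₁ (l , u)
    offset-A sp D e q q∈ {r} {j} ex (inj₂ (p , ¬p)) with offset {hi = old b₁ b₂ b₃ q} (ℕ.≮⇒≥ λ x → ¬p (μ′⇐ ex (h′-newA sp D e q q∈) x)) (μ⇒ ex (h-old q (ℕ.m≤n⇒m≤1+n (q<3 q∈))) p) (old≤3 b₁ b₂ b₃ q)
      where open Bits D
    ... | t , t< , r≡ , l , u = t , t< , r≡ , inj₂ (l , u)

    upper-A : ∀ {B} → Special i B → ∀ D → fr D ≡ B → + 1 ℤ.≤ D → ∀ q → q ≡ 0 ⊎ q ≡ 2 → ∀ {x} → ct x ≡ at q D → Changed x → UpperRes i B x i
    upper-A sp D e 1≤D q q∈ {r , j} ex c with offset-A sp D e q q∈ ex c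
    ... | t , t< , r≡ , b with [ (λ (l , u) → new-cells-A b₀ b₁ b₂ b₃ q (q<3 q∈) t t< l u) , (λ (l , u) → lost-cells-A b₀ b₁ b₂ b₃ q (q<3 q∈) t t< l u) ]′ b
      where open Bits D
    ...   | p , p< , fl , refl , ra = upperRes D p q e 1≤D p< (q<3 q∈) fl r≡ ex (resA⇒ p q ra)

    -- A change at content 1 needs exactly one bead at the positions 0 and 1 and happens in row M.
    -- Then h 0 = M + 1 is even, so M is odd, and the box lies between two squares.
    odd-A : Special 1 0 → i ≡ 1 → ∀ {x} → ct x ≡ + 1 → Changed x → MainResidue x 1
    odd-A sp refl {r , j} ex c = go (offset-A sp (+ 0) fr-0 2 (inj₂ refl) ex c)
      where
      open Bits (+ 0)
      j≡ : j ≡ suc r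
      j≡ = ℕ.suc-injective (ℤ.+-injective (≡-via ex (k (+ suc j) (+ suc r))))
        where
        k : ∀ j r → j ℤ.- r ℤ.- + 1 ≡ j ℤ.- (+ 1 ℤ.+ r)
        k = solve-∀
      table : ∀ b₂ b₃ t → (bit b₃ ≤ t × t < bit b₂) ⊎ (bit b₂ ≤ t × t < bit b₃) → t ≡ 0 × bit b₂ + bit b₃ ≡ 1
      table true  false zero _ = refl , refl
      table false true  zero _ = refl , refl
      table true  true  _ (inj₁ (l , u)) = contradiction l (ℕ.<⇒≱ u)
      table true  true  _ (inj₂ (l , u)) = contradiction l (ℕ.<⇒≱ u)
      table false false _ (inj₁ (_ , ()))
      table false false _ (inj₂ (_ , ()))
      table true  false (suc _) (inj₁ (_ , s≤s ()))
      table true  false (suc _) (inj₂ (_ , ()))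
      table false true  (suc _) (inj₁ (_ , ()))
      table false true  (suc _) (inj₂ (_ , s≤s ()))
      go : ∃[ t ] t < 3 × r ≡ t + M × ((bit b₃ ≤ t × t < bit b₂) ⊎ (bit b₂ ≤ t × t < bit b₃)) → MainResidue (r , j) 1
      go (t , _ , r≡ , l) with table b₂ b₃ t l
      ... | refl , s with even-suc⇒ (subst (2 ∣_) (trans h-D (cong (_+ M) s)) (even sp))
      ...   | m , M≡ = subst (λ x → MainResidue x 1) (cong₂ _,_ (sym (trans r≡ M≡)) (sym (trans j≡ (cong suc (trans r≡ M≡))))) (odd⇒residue m)

    special? : (∃[ B ] Special i B) ⊎ (∀ {A B} → Special A B → i ≢ A)
    special? with i ≟ 1 | suc i ≟ n | variant₀ X in v₀ | variantₙ X in vₙ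
    ... | yes refl | _ | variantD | _ = inj₁ (0 , bottom v₀)
    ... | _ | yes e | _ | variantD = inj₁ (n , top i e vₙ)
    ... | no p | no q | _ | _ = inj₂ λ { (bottom _) → p ; (top A e _) refl → q e }
    ... | no p | yes _ | _ | variantC = inj₂ λ { (bottom _) → p ; (top A e v) refl → C≢D (trans (sym vₙ) v) }
      where
      C≢D : variantC ≢ variantD
      C≢D ()
    ... | yes refl | no q | variantC | _ = inj₂ λ { (bottom v) → λ _ → C≢D (trans (sym v₀) v) ; (top A e _) refl → q e }
      where
      C≢D : variantC ≢ variantD
      C≢D ()
    ... | yes refl | yes _ | variantC | variantC = inj₂ λ { (bottom v) → λ _ → C≢D (trans (sym v₀) v) ; (top A e v) refl → C≢D (trans (sym vₙ) v) }
      where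
      C≢D : variantC ≢ variantD
      C≢D ()

    changed-residue : ∀ {x} → Changed x → R x
    changed-residue {x} c with special?
    ... | inj₂ ¬sp = regular-residue (changed-fr c) λ {A} sp → ¬sp sp , λ e → ns A (subst (Special A) (sym e) sp)
    ... | inj₁ (B , sp) = residue⇐ sp ([ (λ (f , _) → go (+ 1 ℤ.+ ct x) 0 (inj₁ refl) f (trans (sym (pred-suc (ct x))) (sym (at-0 (+ 1 ℤ.+ ct x)))))
                                      , (λ (f , _) → go (ℤ.- + 1 ℤ.+ ct x) 2 (inj₂ refl) f (trans (sym (suc-pred (ct x))) (sym (at-2 (ℤ.- + 1 ℤ.+ ct x))))) ]′ (special-next sp (ct x) (changed-fr c)))
      where
      centre-null : ∀ {B} → Special i B → B ≡ 0 → Special 1 0 × i ≡ 1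
      centre-null sp@(bottom _) _ = sp , refl
      centre-null (top _ _ _) e = contradiction (sym e) (ℕ.<⇒≢ 0<n)
      go : ∀ D q → q ≡ 0 ⊎ q ≡ 2 → fr D ≡ B → ct x ≡ at q D → Res i B x i
      go D q q∈ f ex with sign D
      ... | positive 1≤D = upperᵣ (upper-A sp D f 1≤D q q∈ ex c)
      ... | negative 1≤-D = lowerᵣ (upper-A sp (ℤ.- D) (trans (fr-neg D) f) 1≤-D (2 ∸ q) (flip q∈) (opposite {x} D q (q<3 q∈) ex) (changed-swap c))
        where
        flip : ∀ {q} → q ≡ 0 ⊎ q ≡ 2 → 2 ∸ q ≡ 0 ⊎ 2 ∸ q ≡ 2
        flip (inj₁ refl) = inj₂ refl
        flip (inj₂ refl) = inj₁ refl
      ... | null z with centre-null sp (null⇒0 sp D f z)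
      ...   | sp₀ , i≡1 = mainᵣ (null⇒0 sp D f z) (subst (MainResidue x) (sym i≡1) (main q∈ ex z))
        where
        main : ∀ {q D} → q ≡ 0 ⊎ q ≡ 2 → ct x ≡ at q D → D ≡ + 0 → MainResidue x 1
        main (inj₂ refl) ex refl = odd-A sp₀ i≡1 ex c
        main (inj₁ refl) ex refl = residue-swap (odd-A sp₀ i≡1 (trans (ct-swap x) (cong ℤ.-_ ex)) (changed-swap c))


-- Boxes changed by a D-variant.

module DoubleChanges (X : QuotientType) (n : ℕ) .{{_ : NonZero n}} (rank : minRank X ≤ n)
  {w g w′ g′ : ℤ → ℤ} (I : Shape.Inverse X n rank w g) (I′ : Shape.Inverse X n rank w′ g′)
  {A B : ℕ} (sp : Generators.Special X n A B) where
  open Quotient X n renaming (N to Nℕ)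
  open Index n
  open Generators X n
  open Lengths X n rank
  open Shape X n rank
  open Bands X n rank I
  open Residues X n rank I
  open Changes X n rank I I′
  open Band sp
  open Double sp

  located : ∀ d → fr d ≡ A ⊎ fr d ≡ B → ∃[ D ] ∃[ q ] fr D ≡ B × q < 3 × d ≡ at q D
  located d (inj₂ e) = d , 1 , e , s≤s z<s , sym (at-1 d)
  located d (inj₁ e) with special-next sp d e
  ... | inj₁ (f , _) = + 1 ℤ.+ d , 0 , f , z<s , trans (sym (pred-suc d)) (sym (at-0 (+ 1 ℤ.+ d)))
  ... | inj₂ (f , _) = ℤ.- + 1 ℤ.+ d , 2 , f , s≤s (s≤s z<s) , trans (sym (suc-pred d)) (sym (at-2 (ℤ.- + 1 ℤ.+ d)))

  module DoubleCase
    (on : ∀ D → fr D ≡ B → ∀ q → q < 3 → h′ (at q D) ≡ new (Bits.b₀ D) (Bits.b₁ D) (Bits.b₃ D) q + Bits.M D)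
    (off : ∀ d → fr d ≢ A → fr d ≢ B → h′ d ≡ h d)
    (even : B ≡ 0 → 2 ∣ h (+ 0)) where

    R : Pred Box 0ℓ
    R x = HasResidue μ x B

    R-swap : ∀ {x} → R x → R (swap x)
    R-swap r = residue⇐ sp (res-swap (residue⇒ sp (inj₂ refl) r))

    R-zone : ∀ {x} → R x → x ∈ Zone A B
    R-zone r = res-zone sp (residue⇒ sp (inj₂ refl) r)

    addLike-swap : ∀ {K} → AddLike μ R K → AddLike μ R (K ∘ swap)
    addLike-swap {K} like = record
      { within = R-swap ∘ within
      ; closed = λ p se r → closed p (shareEdge-swap se) (R-swap r)
      ; disjoint = λ p q → disjoint p (μ-swap q)
      ; leftward = λ r j p → [ (λ q → inj₁ (μ-swap q)) , inj₂ ]′ (upward j r p)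
      ; upward = λ r j p → [ (λ q → inj₁ (μ-swap q)) , inj₂ ]′ (leftward j r p) }
      where open AddLike like

    removeLike-swap : ∀ {K} → RemoveLike μ R K → RemoveLike μ R (K ∘ swap)
    removeLike-swap {K} like = record
      { within = R-swap ∘ within
      ; closed = λ p se r → closed p (shareEdge-swap se) (R-swap r)
      ; inside = μ-swap ∘ inside
      ; rightward = λ r j p q → downward j r p (μ-swap q)
      ; downward = λ r j p q → rightward j r p (μ-swap q) }
      where open RemoveLike like

    ≢⇒zone : ∀ {x} → h′ (ct x) ≢ h (ct x) → x ∈ Zone A B
    ≢⇒zone {x} ne with fr (ct x) ≟ A | fr (ct x) ≟ B
    ... | yes p | _ = inj₁ p
    ... | no _ | yes q = inj₂ q
    ... | no p | no q = contradiction (off (ct x) p q) ne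

    centre-unique : ∀ {D D′ q q′} → fr D ≡ B → fr D′ ≡ B → q < 3 → q′ < 3 → at q D ≡ at q′ D′ → D ≡ D′ × q ≡ q′
    centre-unique {D} {D′} {q} {q′} f f′ q< q′< e with <3⇒ q< | <3⇒ q′<
    ... | inj₁ refl | inj₁ refl = trans (sym (at-1 D)) (trans (trans (sym (at-suc 0 D)) (trans (cong (λ x → + 1 ℤ.+ x) e) (at-suc 0 D′))) (at-1 D′)) , refl
    ... | inj₂ (inj₁ refl) | inj₂ (inj₁ refl) = trans (sym (at-1 D)) (trans e (at-1 D′)) , refl
    ... | inj₂ (inj₂ refl) | inj₂ (inj₂ refl) = trans (sym (at-1 D)) (trans (trans (sym (at-pred 1 D)) (trans (cong (λ x → ℤ.- + 1 ℤ.+ x) e) (at-pred 1 D′))) (at-1 D′)) , refl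
    ... | inj₁ refl | inj₂ (inj₁ refl) = contradiction (trans (sym (proj₂ (special-centre sp D f))) (trans (cong fr (trans (sym (at-0 D)) (trans e (at-1 D′)))) f′)) A≢B
    ... | inj₂ (inj₁ refl) | inj₁ refl = contradiction (trans (sym (proj₂ (special-centre sp D′ f′))) (trans (cong fr (trans (sym (at-0 D′)) (trans (sym e) (at-1 D)))) f)) A≢B
    ... | inj₂ (inj₁ refl) | inj₂ (inj₂ refl) = contradiction (trans (sym (proj₁ (special-centre sp D′ f′))) (trans (cong fr (trans (sym (at-2 D′)) (trans (sym e) (at-1 D)))) f)) A≢B
    ... | inj₂ (inj₂ refl) | inj₂ (inj₁ refl) = contradiction (trans (sym (proj₁ (special-centre sp D f))) (trans (cong fr (trans (sym (at-2 D)) (trans e (at-1 D′)))) f′)) A≢B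
    ... | inj₁ refl | inj₂ (inj₂ refl) = contradiction f (proj₂ (outer₊ D′ f′) ∘ trans (cong fr (trans (sym (at-3 D′)) (trans (sym (at-suc 2 D′)) (trans (cong (λ x → + 1 ℤ.+ x) (sym e)) (trans (at-suc 0 D) (at-1 D)))))))
    ... | inj₂ (inj₂ refl) | inj₁ refl = contradiction f′ (proj₂ (outer₊ D f) ∘ trans (cong fr (trans (sym (at-3 D)) (trans (sym (at-suc 2 D)) (trans (cong (λ x → + 1 ℤ.+ x) e) (trans (at-suc 0 D′) (at-1 D′)))))))

    Upper-at : ℤ → ℕ → Box → Set
    Upper-at D q x = ∃[ p ] p < 4 × Bits.flagD D p ≡ true × proj₁ x ≡ Bits.oldD D p + Bits.M D × resB p q ≡ true

    -- A lower residue would have a negative centre and a main one the centre 0. The triples of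
    -- contents around distinct centres are disjoint, so for D ≥ 1 only the row rule at D itself
    -- remains.
    upper-at : ∀ {x} → R x → ∀ D q → fr D ≡ B → + 1 ℤ.≤ D → q < 3 → ct x ≡ at q D → Upper-at D q x
    upper-at {x} r D q f 1≤D q< ex with residue⇒ sp (inj₂ refl) r
    ... | upperᵣ (upperRes D′ p q′ f′ _ p< q′< fl rw ex′ m) with refl , refl ← centre-unique f f′ q< q′< (trans (sym ex) ex′) with bandResidues⇒ p m
    ...   | inj₁ (B≡A , _) = contradiction (sym B≡A) A≢B
    ...   | inj₂ (_ , t) = p , p< , fl , rw , t
    upper-at {x} r D q f 1≤D q< ex | lowerᵣ (upperRes D′ p q′ f′ 1≤D′ p< q′< fl rw ex′ m)
      with refl , _ ← centre-unique {ℤ.- D} {D′} {2 ∸ q} {q′} (trans (fr-neg D) f) f′ (2∸<3 q) q′< (trans (sym (opposite {x} D q q< ex)) ex′) =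
      contradiction (ℤ.+-mono-≤ 1≤D 1≤D′) (ℤ.<⇒≱ (subst (ℤ._< + 2) (sym (ℤ.+-inverseʳ D)) (+<+ z<s)))
    upper-at {x} r D q f 1≤D q< ex | mainᵣ B≡0 m with main-content m
    ... | q′ , q′< , ex′ with refl , _ ← centre-unique {D} {+ 0} {q} {q′} f (trans fr-0 (sym B≡0)) q< q′< (trans (sym ex) ex′) = contradiction 1≤D (λ { (+≤+ ()) })

    main-at : ∀ {x} → R x → ∀ q → B ≡ 0 → q < 3 → ct x ≡ at q (+ 0) → MainResidue x 0
    main-at {x} r q B≡0 q< ex with residue⇒ sp (inj₂ refl) r
    ... | mainᵣ _ m = subst (MainResidue x) B≡0 m
    ... | upperᵣ (upperRes D′ p q′ f′ 1≤D′ p< q′< fl rw ex′ m)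
      with refl , _ ← centre-unique {+ 0} {D′} {q} {q′} (trans fr-0 (sym B≡0)) f′ q< q′< (trans (sym ex) ex′) = contradiction 1≤D′ (λ { (+≤+ ()) })
    ... | lowerᵣ (upperRes D′ p q′ f′ 1≤D′ p< q′< fl rw ex′ m)
      with refl , _ ← centre-unique {+ 0} {D′} {2 ∸ q} {q′} (trans fr-0 (sym B≡0)) f′ (2∸<3 q) q′< (trans (sym (opposite {x} (+ 0) q q< ex)) ex′) = contradiction 1≤D′ (λ { (+≤+ ()) })

    module _ (D : ℤ) (f : fr D ≡ B) where
      open Bits D

      added-offset : ∀ q → q < 3 → ∀ {r j} → ct (r , j) ≡ at q D → Added (r , j) → ∃[ t ] t < 3 × r ≡ t + M × oldD q ≤ t × t < new b₀ b₁ b₃ q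
      added-offset q q< {r} {j} ex (p , ¬p) = offset (ℕ.≮⇒≥ λ x → ¬p (μ⇐ {r} {j} ex (h-old q (ℕ.m≤n⇒m≤1+n q<)) x)) (μ′⇒ {r} {j} ex (on D f q q<) p) (new≤3 b₀ b₁ b₃ q)

      removed-offset : ∀ q → q < 3 → ∀ {r j} → ct (r , j) ≡ at q D → Removed (r , j) → ∃[ t ] t < 3 × r ≡ t + M × new b₀ b₁ b₃ q ≤ t × t < oldD q
      removed-offset q q< {r} {j} ex (p , ¬p) = offset (ℕ.≮⇒≥ λ x → ¬p (μ′⇐ {r} {j} ex (on D f q q<) x)) (μ⇒ {r} {j} ex (h-old q (ℕ.m≤n⇒m≤1+n q<)) p) (old≤3 b₁ b₂ b₃ q)

      added-here : ∀ q → q < 3 → ∀ {r j t} → ct (r , j) ≡ at q D → r ≡ t + M → oldD q ≤ t → t < new b₀ b₁ b₃ q → Added (r , j)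
      added-here q q< {r} {j} {t} ex r≡ l u = μ′⇐ {r} {j} ex (on D f q q<) (subst (_< new b₀ b₁ b₃ q + M) (sym r≡) (ℕ.+-monoˡ-< M u))
        , λ p → ℕ.<⇒≱ (μ⇒ {r} {j} ex (h-old q (ℕ.m≤n⇒m≤1+n q<)) p) (subst (oldD q + M ≤_) (sym r≡) (ℕ.+-monoˡ-≤ M l))

      removed-here : ∀ q → q < 3 → ∀ {r j t} → ct (r , j) ≡ at q D → r ≡ t + M → new b₀ b₁ b₃ q ≤ t → t < oldD q → Removed (r , j)
      removed-here q q< {r} {j} {t} ex r≡ l u = μ⇐ {r} {j} ex (h-old q (ℕ.m≤n⇒m≤1+n q<)) (subst (_< oldD q + M) (sym r≡) (ℕ.+-monoˡ-< M u))
        , λ p → ℕ.<⇒≱ (μ′⇒ {r} {j} ex (on D f q q<) p) (subst (new b₀ b₁ b₃ q + M ≤_) (sym r≡) (ℕ.+-monoˡ-≤ M l))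

    module Upper-band (D : ℤ) (f : fr D ≡ B) (1≤D : + 1 ℤ.≤ D) where
      open Bits D

      excl : Exclusive b₀ b₁ b₂ b₃
      excl = exclusive sp D f 1≤D

      row-cell : ∀ p q → p < 4 → q < 3 → flagD p ≡ true → resB p q ≡ true → ∀ {r j} → ct (r , j) ≡ at q D → r ≡ oldD p + M → R (r , j)
      row-cell p q p< q< fl t {r} {j} ex r≡ = residue⇐ {x = r , j} sp (upperᵣ (upperRes D p q f 1≤D p< q< fl r≡ ex (resB⇒ p q t)))

      added-row : ∀ q → q < 3 → ∀ {x} → ct x ≡ at q D → Added x → R x × b₂ ≡ false × b₃ ≡ false
      added-row q q< {r , j} ex a = go (added-offset D f q q< {r} {j} ex a)
        where
        finish : ∀ {t} → r ≡ t + M → (∃[ p ] p < 4 × flagD p ≡ true × t ≡ oldD p × resB p q ≡ true) × b₂ ≡ false × b₃ ≡ false → R (r , j) × b₂ ≡ false × b₃ ≡ false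
        finish r≡ ((p , p< , fl , t≡ , rb) , e) = row-cell p q p< q< fl rb {r} {j} ex (trans r≡ (cong (_+ M) t≡)) , e
        go : ∃[ t ] t < 3 × r ≡ t + M × oldD q ≤ t × t < new b₀ b₁ b₃ q → R (r , j) × b₂ ≡ false × b₃ ≡ false
        go (t , t< , r≡ , l , u) = finish r≡ (new-cells b₀ b₁ b₂ b₃ excl q q< t t< l u)

      removed-row : ∀ q → q < 3 → ∀ {x} → ct x ≡ at q D → Removed x → R x × b₀ ≡ false × b₁ ≡ false
      removed-row q q< {r , j} ex a = go (removed-offset D f q q< {r} {j} ex a)
        where
        finish : ∀ {t} → r ≡ t + M → (∃[ p ] p < 4 × flagD p ≡ true × t ≡ oldD p × resB p q ≡ true) × b₀ ≡ false × b₁ ≡ false → R (r , j) × b₀ ≡ false × b₁ ≡ false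
        finish r≡ ((p , p< , fl , t≡ , rb) , e) = row-cell p q p< q< fl rb {r} {j} ex (trans r≡ (cong (_+ M) t≡)) , e
        go : ∃[ t ] t < 3 × r ≡ t + M × new b₀ b₁ b₃ q ≤ t × t < oldD q → R (r , j) × b₀ ≡ false × b₁ ≡ false
        go (t , t< , r≡ , l , u) = finish r≡ (lost-cells b₀ b₁ b₂ b₃ excl q q< t t< l u)

      added-closed : ∀ q → q < 3 → ∀ {x y} → ct x ≡ at q D → Added x → ShareEdge x y → R y → Added y
      added-closed q q< {x} {y} ex a se ry = go (neighbour D q f q< {x} {y} ex se (R-zone ry)) (proj₂ (added-row q q< {x} ex a))
        where
        finish : ∀ q′ → q′ < 3 → ct y ≡ at q′ D → b₂ ≡ false × b₃ ≡ false → Upper-at D q′ y → Added y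
        finish q′ q′< ey (e₂ , e₃) (p , p< , fl , rw , rb) =
          let l , u = new-cells⁻ b₀ b₁ b₂ b₃ e₂ e₃ p p< q′ q′< fl rb in added-here D f q′ q′< {proj₁ y} {proj₂ y} ey rw l u
        go : ∃[ q′ ] q′ < 3 × ct y ≡ at q′ D → b₂ ≡ false × b₃ ≡ false → Added y
        go (q′ , q′< , ey) e = finish q′ q′< ey e (upper-at {y} ry D q′ f 1≤D q′< ey)

      removed-closed : ∀ q → q < 3 → ∀ {x y} → ct x ≡ at q D → Removed x → ShareEdge x y → R y → Removed y
      removed-closed q q< {x} {y} ex a se ry = go (neighbour D q f q< {x} {y} ex se (R-zone ry)) (proj₂ (removed-row q q< {x} ex a))
        where
        finish : ∀ q′ → q′ < 3 → ct y ≡ at q′ D → b₀ ≡ false × b₁ ≡ false → Upper-at D q′ y → Removed y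
        finish q′ q′< ey (e₀ , e₁) (p , p< , fl , rw , rb) =
          let l , u = lost-cells⁻ b₀ b₁ b₂ b₃ e₀ e₁ p p< q′ q′< fl rb in removed-here D f q′ q′< {proj₁ y} {proj₂ y} ey rw l u
        go : ∃[ q′ ] q′ < 3 × ct y ≡ at q′ D → b₀ ≡ false × b₁ ≡ false → Removed y
        go (q′ , q′< , ey) e = finish q′ q′< ey e (upper-at {y} ry D q′ f 1≤D q′< ey)

      private
        step-left : ∀ {r j} q → ct (r , j) ≡ at (suc q) D → 1 ≤ suc q → ∃[ j′ ] j ≡ suc j′ × ct (r , j′) ≡ at q D
        step-left {r} {zero} q ex _ = contradiction (subst (+ 1 ℤ.≤_) (sym (trans ex (k (+ q) D))) (ℤ.≤-trans 1≤D (ℤ.i≤j+i D (+ q)))) (λ p → ℤ.<⇒≱ (ct-neg r) p)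
          where
          k : ∀ q D → ℤ.- + 1 ℤ.+ (+ 1 ℤ.+ q ℤ.+ D) ≡ q ℤ.+ D
          k = solve-∀
          ct-neg : ∀ r → ct (r , 0) ℤ.< + 1
          ct-neg r = <-via {+ 0} {+ suc r} (+<+ z<s) (k′ (+ suc r))
            where
            k′ : ∀ r → r ℤ.- + 0 ≡ + 1 ℤ.- (+ 1 ℤ.- r)
            k′ = solve-∀
        step-left {r} {suc j′} q ex _ = j′ , refl , trans (sym (pred-suc (ct (r , j′)))) (trans (cong (λ x → ℤ.- + 1 ℤ.+ x) (trans (sym (ct-right r j′)) ex)) (at-pred q D))

        ct-up : ∀ r j q → ct (suc r , j) ≡ at q D → ct (r , j) ≡ at (suc q) D
        ct-up r j q ex = trans (sym (suc-pred (ct (r , j)))) (trans (cong (λ x → + 1 ℤ.+ x) (trans (sym (ct-down r j)) ex)) (at-suc q D))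

        from-bool : ∀ {c} → ¬ (c ≡ true) → c ≡ false
        from-bool {true} p = contradiction refl p
        from-bool {false} _ = refl

      -- By `outer-cells` only a bead at p + 2 could stop the gain. The row above then ends at that
      -- bead and contains a box of residue B directly above a box of K. Closure puts this box into
      -- K, although it lies in the diagram.
      addLike : ∀ {K} → AddLike μ R K → ∀ q → q < 3 → ∀ {x} → ct x ≡ at q D → x ∈ K → x ∈ μ′
      addLike {K} like q q< {r , j} ex x∈K = start (upper-at {r , j} (within x∈K) D q f 1≤D q< ex)
        where
        open AddLike like
        outside : oldD q + M ≤ r
        outside = ℕ.≮⇒≥ λ x → disjoint x∈K (μ⇐ {r} {j} ex (h-old q (ℕ.m≤n⇒m≤1+n q<)) x)

        first : ∀ q → q < 2 → b₀ ≡ true → r ≡ oldD 0 + M → ct (r , j) ≡ at q D → ∃[ c ] ct (r , c) ≡ at 0 D × (r , c) ∈ K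
        first 0 _ _ _ ex = j , ex , x∈K
        first 1 _ fl rw ex = let c , j≡ , ec = step-left {r} {j} 0 ex ℕ.≤-refl in
          c , ec , closed x∈K (subst (λ i → ShareEdge (r , i) (r , c)) (sym j≡) (shareEdge left)) (row-cell 0 0 z<s z<s fl refl {r} {c} ec rw)
        first (suc (suc _)) (s≤s (s≤s ())) _ _ _

        blocked₂ : b₀ ≡ true → b₂ ≡ true → r ≡ oldD 0 + M → ∃[ c ] ct (r , c) ≡ at 0 D × (r , c) ∈ K → ⊥
        blocked₂ e₀ e₂ rw (c , ec , c∈K) =
            disjoint (closed c∈K (subst (λ s → ShareEdge (s , c) (M , c)) (sym r≡) (shareEdge up))
                (row-cell 2 1 (s≤s (s≤s z<s)) (s≤s z<s) e₂ refl {M} {c} ec′ (cong (_+ M) (sym (old-cong 2 b₁≡ e₂ b₃≡)))))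
              (μ⇐ {M} {c} ec′ (trans (h-old 1 (s≤s z<s)) (cong (_+ M) (old-cong 1 b₁≡ e₂ b₃≡))) ℕ.≤-refl)
          where
          b₁≡ : b₁ ≡ false
          b₁≡ = ∧-left (proj₂ excl) e₂
          b₃≡ : b₃ ≡ false
          b₃≡ = ∧-right (proj₁ excl) e₀
          r≡ : r ≡ suc M
          r≡ = trans rw (cong (_+ M) (old-cong 0 b₁≡ e₂ b₃≡))
          ec′ : ct (M , c) ≡ at 1 D
          ec′ = ct-up M c 0 (subst (λ s → ct (s , c) ≡ at 0 D) r≡ ec)

        second : ∀ q → 0 < q → q < 3 → b₁ ≡ true → r ≡ oldD 1 + M → ct (r , j) ≡ at q D → ∃[ c ] ct (r , c) ≡ at 1 D × (r , c) ∈ K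
        second 1 _ _ _ _ ex = j , ex , x∈K
        second 2 _ _ fl rw ex = let c , j≡ , ec = step-left {r} {j} 1 ex (s≤s z≤n) in
          c , ec , closed x∈K (subst (λ i → ShareEdge (r , i) (r , c)) (sym j≡) (shareEdge left)) (row-cell 1 1 (s≤s z<s) (s≤s z<s) fl refl {r} {c} ec rw)
        second (suc (suc (suc _))) _ (s≤s (s≤s (s≤s ()))) _ _ _

        blocked₃ : b₁ ≡ true → b₃ ≡ true → r ≡ oldD 1 + M → ∃[ c ] ct (r , c) ≡ at 1 D × (r , c) ∈ K → ⊥
        blocked₃ e₁ e₃ rw (c , ec , c∈K) =
            disjoint (closed c∈K (subst (λ s → ShareEdge (s , c) (M , c)) (sym r≡) (shareEdge up))
                (row-cell 3 2 (s≤s (s≤s (s≤s z<s))) (s≤s (s≤s z<s)) e₃ refl {M} {c} ec′ refl))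
              (μ⇐ {M} {c} ec′ (trans (h-old 2 (s≤s (s≤s z<s))) (cong (_+ M) (old-cong {b₁} 2 refl b₂≡ e₃))) ℕ.≤-refl)
          where
          b₂≡ : b₂ ≡ false
          b₂≡ = ∧-right (proj₂ excl) e₁
          r≡ : r ≡ suc M
          r≡ = trans rw (cong (_+ M) (old-cong {b₁} 1 refl b₂≡ e₃))
          ec′ : ct (M , c) ≡ at 2 D
          ec′ = ct-up M c 1 (subst (λ s → ct (s , c) ≡ at 1 D) r≡ ec)

        conclude : ∀ {p} → r ≡ oldD p + M → oldD p < new b₀ b₁ b₃ q → (r , j) ∈ μ′
        conclude rw u = μ′⇐ {r} {j} ex (on D f q q<) (subst (_< new b₀ b₁ b₃ q + M) (sym rw) (ℕ.+-monoˡ-< M u))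

        finish : ∀ {p} → flagD p ≡ true → r ≡ oldD p + M →
          (p ≡ 0 × q < 2 × (b₂ ≡ false → oldD p < new b₀ b₁ b₃ q)) ⊎ (p ≡ 1 × 0 < q × (b₃ ≡ false → oldD p < new b₀ b₁ b₃ q)) → (r , j) ∈ μ′
        finish {p} fl rw (inj₁ (refl , q<2 , u)) = conclude {p} rw (u (from-bool λ e₂ → blocked₂ fl e₂ rw (first q q<2 fl rw ex)))
        finish {p} fl rw (inj₂ (refl , 0<q , u)) = conclude {p} rw (u (from-bool λ e₃ → blocked₃ fl e₃ rw (second q 0<q q< fl rw ex)))

        start : Upper-at D q (r , j) → (r , j) ∈ μ′
        start (p , p< , fl , rw , rb) = finish {p} fl rw
          (outer-cells b₀ b₁ b₂ b₃ excl p p< q q< fl rb (ℕ.+-cancelʳ-≤ M (oldD q) (oldD p) (subst (oldD q + M ≤_) rw outside)))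

      -- Dually, only a bead at p - 2 could stop the loss. The row below then ends at that bead and
      -- has a box of residue B outside the diagram directly below a box of K, which closure would
      -- put into K.
      removeLike : ∀ {K} → RemoveLike μ R K → ∀ q → q < 3 → ∀ {x} → ct x ≡ at q D → x ∈ K → x ∉ μ′
      removeLike {K} like q q< {r , j} ex x∈K x∈μ′ = start (upper-at {r , j} (within x∈K) D q f 1≤D q< ex)
        where
        open RemoveLike like
        insideD : suc r ≤ oldD q + M
        insideD = μ⇒ {r} {j} ex (h-old q (ℕ.m≤n⇒m≤1+n q<)) (inside x∈K)
        insideN : suc r ≤ new b₀ b₁ b₃ q + M
        insideN = μ′⇒ {r} {j} ex (on D f q q<) x∈μ′

        ct-next : ∀ q → ct (r , j) ≡ at q D → ct (r , suc j) ≡ at (suc q) D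
        ct-next q ex = trans (ct-right r j) (trans (cong (λ x → + 1 ℤ.+ x) ex) (at-suc q D))
        ct-below : ∀ q c → ct (r , c) ≡ at (suc q) D → ct (suc r , c) ≡ at q D
        ct-below q c ec = trans (ct-down r c) (trans (cong (λ x → ℤ.- + 1 ℤ.+ x) ec) (at-pred q D))

        second : ∀ q → q < 2 → b₂ ≡ true → r ≡ oldD 2 + M → ct (r , j) ≡ at q D → ∃[ c ] ct (r , c) ≡ at 1 D × (r , c) ∈ K
        second 1 _ _ _ ex = j , ex , x∈K
        second 0 _ fl rw ex = suc j , ct-next 0 ex , closed x∈K (shareEdge right) (row-cell 2 1 (s≤s (s≤s z<s)) (s≤s z<s) fl refl {r} {suc j} (ct-next 0 ex) rw)
        second (suc (suc _)) (s≤s (s≤s ())) _ _ _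

        blocked₀ : b₂ ≡ true → b₀ ≡ true → r ≡ oldD 2 + M → ∃[ c ] ct (r , c) ≡ at 1 D × (r , c) ∈ K → ⊥
        blocked₀ e₂ e₀ rw (c , ec , c∈K) = ℕ.n≮n (suc M) (subst (λ s → suc (suc s) ≤ suc M) r≡
            (μ⇒ {suc r} {c} ed (trans (h-old 0 z<s) (cong (_+ M) old0)) (inside (closed c∈K (shareEdge down)
              (row-cell 0 0 z<s z<s e₀ refl {suc r} {c} ed (trans (cong suc r≡) (cong (_+ M) (sym old0))))))))
          where
          old0 : oldD 0 ≡ 1
          old0 = old-cong 0 (∧-left (proj₂ excl) e₂) e₂ (∧-right (proj₁ excl) e₀)
          r≡ : r ≡ M
          r≡ = trans rw (cong (_+ M) (old-cong {b₁} {b₂} 2 refl refl (∧-right (proj₁ excl) e₀)))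
          ed : ct (suc r , c) ≡ at 0 D
          ed = ct-below 0 c ec

        third : ∀ q → 0 < q → q < 3 → b₃ ≡ true → r ≡ oldD 3 + M → ct (r , j) ≡ at q D → ∃[ c ] ct (r , c) ≡ at 2 D × (r , c) ∈ K
        third 2 _ _ _ _ ex = j , ex , x∈K
        third 1 _ _ fl rw ex = suc j , ct-next 1 ex , closed x∈K (shareEdge right) (row-cell 3 2 (s≤s (s≤s (s≤s z<s))) (s≤s (s≤s z<s)) fl refl {r} {suc j} (ct-next 1 ex) rw)
        third (suc (suc (suc _))) _ (s≤s (s≤s (s≤s ()))) _ _ _

        blocked₁ : b₃ ≡ true → b₁ ≡ true → r ≡ M → ∃[ c ] ct (r , c) ≡ at 2 D × (r , c) ∈ K → ⊥
        blocked₁ e₃ e₁ r≡ (c , ec , c∈K) = ℕ.n≮n (suc M) (subst (λ s → suc (suc s) ≤ suc M) r≡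
            (μ⇒ {suc r} {c} ed (trans (h-old 1 (s≤s z<s)) (cong (_+ M) old1)) (inside (closed c∈K (shareEdge down)
              (row-cell 1 1 (s≤s z<s) (s≤s z<s) e₁ refl {suc r} {c} ed (trans (cong suc r≡) (cong (_+ M) (sym old1))))))))
          where
          old1 : oldD 1 ≡ 1
          old1 = old-cong 1 e₁ (∧-right (proj₂ excl) e₁) e₃
          ed : ct (suc r , c) ≡ at 1 D
          ed = ct-below 1 c ec

        conclude : ∀ {p} → r ≡ oldD p + M → ¬ (new b₀ b₁ b₃ q ≤ oldD p)
        conclude rw l = ℕ.<⇒≱ insideN (subst (new b₀ b₁ b₃ q + M ≤_) (sym rw) (ℕ.+-monoˡ-≤ M l))

        finish : ∀ {p} → flagD p ≡ true → r ≡ oldD p + M →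
          (p ≡ 2 × q < 2 × (b₀ ≡ false → new b₀ b₁ b₃ q ≤ oldD p)) ⊎ (p ≡ 3 × 0 < q × (b₁ ≡ false → new b₀ b₁ b₃ q ≤ oldD p)) → ⊥
        finish {p} fl rw (inj₁ (refl , q<2 , u)) = conclude {p} rw (u (from-bool λ e₀ → blocked₀ fl e₀ rw (second q q<2 fl rw ex)))
        finish {p} fl rw (inj₂ (refl , 0<q , u)) = conclude {p} rw (u (from-bool λ e₁ → blocked₁ fl e₁ rw (third q 0<q q< fl rw ex)))

        start : Upper-at D q (r , j) → ⊥
        start (p , p< , fl , rw , rb) = finish {p} fl rw
          (inner-cells b₀ b₁ b₂ b₃ excl p p< q q< fl rb (ℕ.+-cancelʳ-≤ M (suc (oldD p)) (oldD q) (subst (λ m → suc m ≤ oldD q + M) rw insideD)))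

    module Main-band (B≡0 : B ≡ 0) where
      open Main

      f : fr (+ 0) ≡ B
      f = trans fr-0 (sym B≡0)

      main-R : ∀ {x} → MainResidue x 0 → R x
      main-R {x} r = residue⇐ sp (mainᵣ B≡0 (subst (MainResidue x) (sym B≡0) r))

      h-0 : h (+ 0) ≡ oldD 1 + M
      h-0 = h-D

      off-main : ∀ {x} → ct x ≡ + 2 ⊎ ct x ≡ ℤ.- + 2 → ¬ R x
      off-main (inj₁ e) r = [ proj₁ (outer₊ (+ 0) f) ∘ trans (cong fr (sym e)) , proj₂ (outer₊ (+ 0) f) ∘ trans (cong fr (sym e)) ]′ (R-zone r)
      off-main (inj₂ e) r = [ proj₁ (outer₋ (+ 0) f) ∘ trans (cong fr (sym e)) , proj₂ (outer₋ (+ 0) f) ∘ trans (cong fr (sym e)) ]′ (R-zone r)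

      square-block : ∀ {m r j t q} → q < 3 → ct (r , j) ≡ at q (+ 0) → r ≡ t + (m + m) → square q t ≡ true → Block m (r , j)
      square-block {m} {r} {j} {t} {q} q< ex r≡ s = go {r} {j} q t s ex r≡
        where
        col≡ : ∀ {r j} q → ct (r , j) ≡ at q (+ 0) → suc j ≡ q + r
        col≡ {r} {j} q ex = ℤ.+-injective (≡-via ex (k (+ r) (+ j) (+ q)))
          where
          k : ∀ r j q → + 1 ℤ.+ j ℤ.- (+ 1 ℤ.+ r) ℤ.- (ℤ.- + 1 ℤ.+ (q ℤ.+ + 0)) ≡ + 1 ℤ.+ j ℤ.- (q ℤ.+ r)
          k = solve-∀
        go : ∀ {r j} q t → square q t ≡ true → ct (r , j) ≡ at q (+ 0) → r ≡ t + (m + m) → Block m (r , j)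
        go {j = j} 0 1 _ ex refl with refl ← ℕ.suc-injective (col≡ {suc (m + m)} {j} 0 ex) = block {d = 1} {0} (s≤s z<s) z<s
        go {j = j} 1 0 _ ex refl with refl ← ℕ.suc-injective (col≡ {m + m} {j} 1 ex) = block {d = 0} {0} z<s z<s
        go {j = j} 1 1 _ ex refl with refl ← ℕ.suc-injective (col≡ {suc (m + m)} {j} 1 ex) = block {d = 1} {1} (s≤s z<s) (s≤s z<s)
        go {j = j} 2 0 _ ex refl with refl ← ℕ.suc-injective (col≡ {m + m} {j} 2 ex) = block {d = 0} {1} z<s (s≤s z<s)

      block-square : ∀ {m x} → Block m x → ∃[ q ] ∃[ t ] q < 3 × t < 2 × square q t ≡ true × ct x ≡ at q (+ 0) × proj₁ x ≡ t + (m + m)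
      block-square {m} (block {d = 0} {0} d< _) = 1 , 0 , s≤s z<s , z<s , refl , ct-diagonal (m + m) , refl
      block-square {m} (block {d = 1} {1} d< _) = 1 , 1 , s≤s z<s , s≤s z<s , refl , ct-diagonal (suc (m + m)) , refl
      block-square {m} (block {d = 0} {1} d< _) = 2 , 0 , s≤s (s≤s z<s) , z<s , refl , trans (ct-right (m + m) (m + m)) (cong (λ d → + 1 ℤ.+ d) (ct-diagonal (m + m))) , refl
      block-square {m} (block {d = 1} {0} d< _) = 0 , 1 , z<s , s≤s z<s , refl , trans (ct-down (m + m) (m + m)) (cong (λ d → ℤ.- + 1 ℤ.+ d) (ct-diagonal (m + m))) , refl
      block-square (block {d = suc (suc _)} (s≤s (s≤s ())) _)
      block-square (block {e = suc (suc _)} _ (s≤s (s≤s ())))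

      private
        mirrored-old : ∀ q → oldD q ≡ old b₁ (not b₁) (not b₀) q
        mirrored-old q = old-cong q refl b₂≡ b₃≡

        mirrored-new : ∀ q → new b₀ b₁ b₃ q ≡ new b₀ b₁ (not b₀) q
        mirrored-new q = new-cong q refl refl b₃≡

      -- The table leaves only beads at -2 and -1 and hence, by mirroring, gaps at 0 and 1. Then M =
      -- h 0, which the parity condition makes even, so the added square starts at even coordinates.
      added-block : ∀ q → q < 3 → ∀ {x} → ct x ≡ at q (+ 0) → Added x → ∃[ m ] Block m x × M ≡ m + m × b₀ ≡ true × b₁ ≡ true
      added-block q q< {r , j} ex a = start (added-offset (+ 0) f q q< {r} {j} ex a)
        where
        finish : ∀ {t} → r ≡ t + M → square q t ≡ true → b₀ ≡ true × b₁ ≡ true → ∃[ m ] M ≡ m + m → ∃[ m ] Block m (r , j) × M ≡ m + m × b₀ ≡ true × b₁ ≡ true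
        finish {t} r≡ s e (m , M≡) = m , square-block {m} {r} {j} q< ex (trans r≡ (cong (λ y → t + y) M≡)) s , M≡ , e
        start : ∃[ t ] t < 3 × r ≡ t + M × oldD q ≤ t × t < new b₀ b₁ b₃ q → ∃[ m ] Block m (r , j) × M ≡ m + m × b₀ ≡ true × b₁ ≡ true
        start (t , t< , r≡ , l , u) =
          let s , e₀ , e₁ = new-square b₀ b₁ q q< t t< (subst (_≤ t) (mirrored-old q) l) (subst (t <_) (mirrored-new q) u)
          in finish r≡ s (e₀ , e₁) (even⇒double (subst (2 ∣_) (trans h-0 (cong (_+ M) (trans (mirrored-old 1) (old-cong {b₁} 1 refl (cong not e₁) (cong not e₀))))) (even B≡0)))

      removed-block : ∀ q → q < 3 → ∀ {x} → ct x ≡ at q (+ 0) → Removed x → ∃[ m ] Block m x × M ≡ m + m × b₀ ≡ false × b₁ ≡ false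
      removed-block q q< {r , j} ex a = start (removed-offset (+ 0) f q q< {r} {j} ex a)
        where
        finish : ∀ {t} → r ≡ t + M → square q t ≡ true → b₀ ≡ false × b₁ ≡ false → ∃[ m ] M ≡ m + m → ∃[ m ] Block m (r , j) × M ≡ m + m × b₀ ≡ false × b₁ ≡ false
        finish {t} r≡ s e (m , M≡) = m , square-block {m} {r} {j} q< ex (trans r≡ (cong (λ y → t + y) M≡)) s , M≡ , e
        start : ∃[ t ] t < 3 × r ≡ t + M × new b₀ b₁ b₃ q ≤ t × t < oldD q → ∃[ m ] Block m (r , j) × M ≡ m + m × b₀ ≡ false × b₁ ≡ false
        start (t , t< , r≡ , l , u) =
          let s , e₀ , e₁ = lost-square b₀ b₁ q q< t t< (subst (_≤ t) (mirrored-new q) l) (subst (t <_) (mirrored-old q) u)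
          in finish r≡ s (e₀ , e₁) (even⇒double (∣m+n∣m⇒∣n (subst (2 ∣_) (trans h-0 (cong (_+ M) (trans (mirrored-old 1) (old-cong {b₁} 1 refl (cong not e₁) (cong not e₀))))) (even B≡0)) ∣-refl))

      block-added : ∀ {m x} → M ≡ m + m → b₀ ≡ true → b₁ ≡ true → Block m x → Added x
      block-added {m} {r , j} M≡ e₀ e₁ bl =
        let q , t , q< , t< , s , ex , r≡ = block-square bl
            (l , u) , _ = square-bounds q q< t t< s
        in added-here (+ 0) f q q< {r} {j} ex (trans r≡ (cong (λ y → t + y) (sym M≡)))
             (subst (_≤ t) (sym (trans (mirrored-old q) (old-cong q e₁ (cong not e₁) (cong not e₀)))) l)
             (subst (t <_) (sym (trans (mirrored-new q) (new-cong q e₀ e₁ (cong not e₀)))) u)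

      block-removed : ∀ {m x} → M ≡ m + m → b₀ ≡ false → b₁ ≡ false → Block m x → Removed x
      block-removed {m} {r , j} M≡ e₀ e₁ bl =
        let q , t , q< , t< , s , ex , r≡ = block-square bl
            _ , (l , u) = square-bounds q q< t t< s
        in removed-here (+ 0) f q q< {r} {j} ex (trans r≡ (cong (λ y → t + y) (sym M≡)))
             (subst (_≤ t) (sym (trans (mirrored-new q) (new-cong q e₀ e₁ (cong not e₀)))) l)
             (subst (t <_) (sym (trans (mirrored-old q) (old-cong q e₁ (cong not e₁) (cong not e₀)))) u)

      neighbour-block : ∀ {x y q} → q < 3 → ct x ≡ at q (+ 0) → ShareEdge x y → R y → ∃[ m ] Block m y
      neighbour-block {x} {y} {q} q< ex se ry =
        let q′ , q′< , ey = neighbour (+ 0) q f q< {x} {y} ex se (R-zone ry) in residue⇒block (main-at {y} ry q′ B≡0 q′< ey)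

      added-closed : ∀ q → q < 3 → ∀ {x y} → ct x ≡ at q (+ 0) → Added x → ShareEdge x y → R y → Added y
      added-closed q q< {x} {y} ex a se ry =
        let m , bx , M≡ , e₀ , e₁ = added-block q q< {x} ex a
            m′ , by = neighbour-block {x} {y} q< ex se ry
        in block-added M≡ e₀ e₁ (subst (λ k → Block k y) (sym (block-adjacent bx by se)) by)

      removed-closed : ∀ q → q < 3 → ∀ {x y} → ct x ≡ at q (+ 0) → Removed x → ShareEdge x y → R y → Removed y
      removed-closed q q< {x} {y} ex a se ry =
        let m , bx , M≡ , e₀ , e₁ = removed-block q q< {x} ex a
            m′ , by = neighbour-block {x} {y} q< ex se ry
        in block-removed M≡ e₀ e₁ (subst (λ k → Block k y) (sym (block-adjacent bx by se)) by)

      block-in : ∀ {K : Pred Box 0ℓ} → (∀ {x y} → x ∈ K → ShareEdge x y → y ∈ R → y ∈ K) → ∀ {m x} → Block m x → x ∈ K →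
        ∀ {y} → Block m y → y ∈ K
      block-in {K} closed {m} bx x∈K by = out by (corner bx x∈K)
        where
        go : ∀ {x y} → Block m y → Edge x y → x ∈ K → y ∈ K
        go by e x∈K = closed x∈K (shareEdge e) (main-R (block⇒residue by))
        bl : ∀ {d e} → d < 2 → e < 2 → Block m (d + (m + m) , e + (m + m))
        bl = block
        corner : ∀ {x} → Block m x → x ∈ K → (m + m , m + m) ∈ K
        corner (block {d = 0} {0} _ _) p = p
        corner (block {d = 0} {1} _ _) p = go (bl {0} {0} z<s z<s) left p
        corner (block {d = 1} {0} _ _) p = go (bl {0} {0} z<s z<s) up p
        corner (block {d = 1} {1} _ _) p = go (bl {0} {0} z<s z<s) left (go (bl {0} {1} z<s (s≤s z<s)) up p)
        corner (block {d = suc (suc _)} (s≤s (s≤s ())) _) p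
        corner (block {e = suc (suc _)} _ (s≤s (s≤s ()))) p
        out : ∀ {y} → Block m y → (m + m , m + m) ∈ K → y ∈ K
        out (block {d = 0} {0} _ _) p = p
        out (block {d = 0} {1} _ _) p = go (bl {0} {1} z<s (s≤s z<s)) right p
        out (block {d = 1} {0} _ _) p = go (bl {1} {0} (s≤s z<s) z<s) down p
        out (block {d = 1} {1} _ _) p = go (bl {1} {1} (s≤s z<s) (s≤s z<s)) down (go (bl {0} {1} z<s (s≤s z<s)) right p)
        out (block {d = suc (suc _)} (s≤s (s≤s ())) _) p
        out (block {e = suc (suc _)} _ (s≤s (s≤s ()))) p

      private
        bits-zero : ∀ c c′ → bit c + bit c′ ≡ 0 → c ≡ false × c′ ≡ false
        bits-zero false false _ = refl , refl
        bits-zero true  _ ()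
        bits-zero false true ()

        bits-two : ∀ c c′ → 2 ≤ bit c + bit c′ → c ≡ true × c′ ≡ true
        bits-two true true _ = refl , refl
        bits-two false false ()
        bits-two true false (s≤s ())
        bits-two false true (s≤s ())

        unnot : ∀ {c d} → c ≡ not d → ∀ {e} → c ≡ e → d ≡ not e
        unnot {d = true} refl refl = refl
        unnot {d = false} refl refl = refl

        ct-far : ∀ m → ct (m , suc (suc m)) ≡ + 2
        ct-far m = trans (ct-right m (suc m)) (cong (λ d → + 1 ℤ.+ d) (trans (ct-right m m) (cong (λ d → + 1 ℤ.+ d) (ct-diagonal m))))

      -- K contains a whole square with corner (2m, 2m). The box above its right column has content
      -- 2, hence lies in the diagram and gives 2m ≤ M; the corner lies outside and gives h 0 ≤ 2m.
      -- As h 0 exceeds M by two bits, both are zero and M = 2m.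
      addLike : ∀ {K} → AddLike μ R K → ∀ {x} → MainResidue x 0 → x ∈ K → x ∈ μ′
      addLike {K} like {x} r x∈K = proj₁ (block-added (sym m≡M) (unnot b₃≡ (proj₂ zeros)) (unnot b₂≡ (proj₁ zeros)) bx)
        where
        open AddLike like
        m = proj₁ (residue⇒block r)
        bx = proj₂ (residue⇒block r)
        all : ∀ {y} → Block m y → y ∈ K
        all = block-in closed bx x∈K
        m≤M : m + m ≤ M
        m≤M = go (m + m) refl
          where
          go : ∀ k → k ≡ m + m → k ≤ M
          go zero _ = z≤n
          go (suc k) e = [ μ⇒ {k} {suc (suc k)} (ct-far k) refl , (λ p → contradiction (within p) (off-main {k , suc (suc k)} (inj₁ (ct-far k)))) ]′
            (upward k (suc (suc k)) (subst (λ c → (c , suc c) ∈ K) (sym e) (all (block {d = 0} {1} z<s (s≤s z<s)))))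
        h≤m : h (+ 0) ≤ m + m
        h≤m = ℕ.≮⇒≥ λ p → disjoint (all (block {d = 0} {0} z<s z<s)) (μ⇐ {m + m} {m + m} (ct-diagonal (m + m)) refl p)
        M≤h : oldD 1 + M ≤ m + m
        M≤h = subst (_≤ m + m) h-0 h≤m
        m≡M : m + m ≡ M
        m≡M = ℕ.≤-antisym m≤M (ℕ.≤-trans (ℕ.m≤n+m M (oldD 1)) M≤h)
        zeros : b₂ ≡ false × b₃ ≡ false
        zeros = bits-zero b₂ b₃ (ℕ.n≤0⇒n≡0 (ℕ.+-cancelʳ-≤ M (oldD 1) 0 (ℕ.≤-trans M≤h m≤M)))

      -- Dually, the box to the right of the square's top row is missing, so M ≤ 2m, while its last
      -- diagonal box gives h 0 ≥ 2m + 2. Both bits must be one, and M = 2m.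
      removeLike : ∀ {K} → RemoveLike μ R K → ∀ {x} → MainResidue x 0 → x ∈ K → x ∉ μ′
      removeLike {K} like {x} r x∈K = proj₂ (block-removed (sym m≡M) (unnot b₃≡ (proj₂ ones)) (unnot b₂≡ (proj₁ ones)) bx)
        where
        open RemoveLike like
        m = proj₁ (residue⇒block r)
        bx = proj₂ (residue⇒block r)
        all : ∀ {y} → Block m y → y ∈ K
        all = block-in closed bx x∈K
        M≤m : M ≤ m + m
        M≤m = ℕ.≮⇒≥ λ p → rightward (m + m) (suc (m + m)) (all (block {d = 0} {1} z<s (s≤s z<s)))
          (μ⇐ {m + m} {suc (suc (m + m))} (ct-far (m + m)) refl p) λ q → off-main {m + m , suc (suc (m + m))} (inj₁ (ct-far (m + m))) (within q)
        m<h : 2 + (m + m) ≤ oldD 1 + M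
        m<h = subst (2 + (m + m) ≤_) h-0 (μ⇒ {suc (m + m)} {suc (m + m)} (ct-diagonal (suc (m + m))) refl (inside (all (block {d = 1} {1} (s≤s z<s) (s≤s z<s)))))
        ones : b₂ ≡ true × b₃ ≡ true
        ones = bits-two b₂ b₃ (ℕ.+-cancelʳ-≤ M 2 (oldD 1) (ℕ.≤-trans (ℕ.+-monoʳ-≤ 2 M≤m) m<h))
        m≡M : m + m ≡ M
        m≡M = ℕ.≤-antisym (ℕ.+-cancelˡ-≤ 2 (m + m) M (subst (2 + (m + m) ≤_) (cong (_+ M) (old-cong {b₁} 1 refl (proj₁ ones) (proj₂ ones))) m<h)) M≤m

    private
      -- The sign of the centre separates upper, lower and main bands; a lower band is handed over
      -- to the upper case by transposition.
      by-centre : ∀ {Q : Set} x → x ∈ Zone A B →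
        (∀ D q → fr D ≡ B → q < 3 → ct x ≡ at q D → + 1 ℤ.≤ D → Q) →
        (∀ D q → fr D ≡ B → q < 3 → ct (swap x) ≡ at q D → + 1 ℤ.≤ D → Q) →
        (∀ q → B ≡ 0 → q < 3 → ct x ≡ at q (+ 0) → Q) → Q
      by-centre {Q} x z upperQ lowerQ mainQ = start (located (ct x) z)
        where
        go : ∀ D q → fr D ≡ B → q < 3 → ct x ≡ at q D → Sign D → Q
        go D q f q< ex (positive 1≤D) = upperQ D q f q< ex 1≤D
        go D q f q< ex (negative 1≤-D) = lowerQ (ℤ.- D) (2 ∸ q) (trans (fr-neg D) f) (2∸<3 q) (opposite {x} D q q< ex) 1≤-D
        go D q f q< ex (null D≡0) = mainQ q (null⇒0 sp D f D≡0) q< (trans ex (cong (at q) D≡0))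
        start : ∃[ D ] ∃[ q ] fr D ≡ B × q < 3 × ct x ≡ at q D → Q
        start (D , q , f , q< , ex) = go D q f q< ex (sign D)

      module Target = Bands X n rank I′

    added-residue : ∀ {x} → Added x → R x
    added-residue {x} a = by-centre x (≢⇒zone {x} (added-≢ {x} a))
      (λ D q f q< ex 1≤D → proj₁ (Upper-band.added-row D f 1≤D q q< {x} ex a))
      (λ D q f q< ex 1≤D → R-swap (proj₁ (Upper-band.added-row D f 1≤D q q< {swap x} ex (added-swap {x} a))))
      (λ q B≡0 q< ex → Main-band.main-R B≡0 (block⇒residue (proj₁ (proj₂ (Main-band.added-block B≡0 q q< {x} ex a)))))

    removed-residue : ∀ {x} → Removed x → R x
    removed-residue {x} a = by-centre x (≢⇒zone {x} (removed-≢ {x} a))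
      (λ D q f q< ex 1≤D → proj₁ (Upper-band.removed-row D f 1≤D q q< {x} ex a))
      (λ D q f q< ex 1≤D → R-swap (proj₁ (Upper-band.removed-row D f 1≤D q q< {swap x} ex (removed-swap {x} a))))
      (λ q B≡0 q< ex → Main-band.main-R B≡0 (block⇒residue (proj₁ (proj₂ (Main-band.removed-block B≡0 q q< {x} ex a)))))

    added-closed : ∀ {x y} → Added x → ShareEdge x y → R y → Added y
    added-closed {x} {y} a se ry = by-centre x (≢⇒zone {x} (added-≢ {x} a))
      (λ D q f q< ex 1≤D → Upper-band.added-closed D f 1≤D q q< {x} {y} ex a se ry)
      (λ D q f q< ex 1≤D → added-swap {swap y} (Upper-band.added-closed D f 1≤D q q< {swap x} {swap y} ex (added-swap {x} a) (shareEdge-swap {x} {y} se) (R-swap ry)))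
      (λ q B≡0 q< ex → Main-band.added-closed B≡0 q q< {x} {y} ex a se ry)

    removed-closed : ∀ {x y} → Removed x → ShareEdge x y → R y → Removed y
    removed-closed {x} {y} a se ry = by-centre x (≢⇒zone {x} (removed-≢ {x} a))
      (λ D q f q< ex 1≤D → Upper-band.removed-closed D f 1≤D q q< {x} {y} ex a se ry)
      (λ D q f q< ex 1≤D → removed-swap {swap y} (Upper-band.removed-closed D f 1≤D q q< {swap x} {swap y} ex (removed-swap {x} a) (shareEdge-swap {x} {y} se) (R-swap ry)))
      (λ q B≡0 q< ex → Main-band.removed-closed B≡0 q q< {x} {y} ex a se ry)

    addLike : ∀ {K} → AddLike μ R K → ∀ {x} → x ∈ K → x ∈ μ′
    addLike {K} like {x} x∈K = by-centre x (R-zone {x} (AddLike.within like x∈K))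
      (λ D q f q< ex 1≤D → Upper-band.addLike D f 1≤D like q q< {x} ex x∈K)
      (λ D q f q< ex 1≤D → Target.μ-swap {swap x} (Upper-band.addLike D f 1≤D (addLike-swap like) q q< {swap x} ex x∈K))
      (λ q B≡0 q< ex → Main-band.addLike B≡0 like (main-at {x} (AddLike.within like x∈K) q B≡0 q< ex) x∈K)

    removeLike : ∀ {K} → RemoveLike μ R K → ∀ {x} → x ∈ K → x ∉ μ′
    removeLike {K} like {x} x∈K = by-centre x (R-zone {x} (RemoveLike.within like x∈K))
      (λ D q f q< ex 1≤D → Upper-band.removeLike D f 1≤D like q q< {x} ex x∈K)
      (λ D q f q< ex 1≤D p → Upper-band.removeLike D f 1≤D (removeLike-swap like) q q< {swap x} ex x∈K (Target.μ-swap {x} p))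
      (λ q B≡0 q< ex → Main-band.removeLike B≡0 like (main-at {x} (RemoveLike.within like x∈K) q B≡0 q< ex) x∈K)


-- Ascents, descents and the conclusion.

bit-mono : ∀ {c d} → (c ≡ true → d ≡ true) → bit c ≤ bit d
bit-mono {false} _ = z≤n
bit-mono {true} f = ℕ.≤-reflexive (cong bit (sym (f refl)))

old≤new : ∀ {b₀ b₁ b₂ b₃} → (b₂ ≡ true → b₀ ≡ true) → (b₃ ≡ true → b₁ ≡ true) → ∀ q → q < 3 → old b₁ b₂ b₃ q ≤ new b₀ b₁ b₃ q
old≤new {b₀} {b₁} {b₂} {b₃} f g 0 _ = ℕ.≤-trans (ℕ.≤-reflexive (k (bit b₁) (bit b₂) (bit b₃))) (ℕ.+-monoˡ-≤ (bit b₁ + bit b₃) (bit-mono f))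
  where
  k : ∀ x y z → x + (y + z) ≡ y + (x + z)
  k x y z = trans (sym (ℕ.+-assoc x y z)) (trans (cong (_+ z) (ℕ.+-comm x y)) (ℕ.+-assoc y x z))
old≤new f g 1 _ = ℕ.+-mono-≤ (bit-mono f) (bit-mono g)
old≤new f g 2 _ = bit-mono g
old≤new f g (suc (suc (suc _))) (s≤s (s≤s (s≤s ())))

new≤old : ∀ {b₀ b₁ b₂ b₃} → (b₀ ≡ true → b₂ ≡ true) → (b₁ ≡ true → b₃ ≡ true) → ∀ q → q < 3 → new b₀ b₁ b₃ q ≤ old b₁ b₂ b₃ q
new≤old {b₀} {b₁} {b₂} {b₃} f g 0 _ = ℕ.≤-trans (ℕ.+-monoˡ-≤ (bit b₁ + bit b₃) (bit-mono f)) (ℕ.≤-reflexive (k (bit b₂) (bit b₁) (bit b₃)))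
  where
  k : ∀ x y z → x + (y + z) ≡ y + (x + z)
  k x y z = trans (sym (ℕ.+-assoc x y z)) (trans (cong (_+ z) (ℕ.+-comm x y)) (ℕ.+-assoc y x z))
new≤old f g 1 _ = ℕ.+-mono-≤ (bit-mono f) (bit-mono g)
new≤old f g 2 _ = bit-mono g
new≤old f g (suc (suc (suc _))) (s≤s (s≤s (s≤s ())))

module Action (X : QuotientType) (n : ℕ) .{{_ : NonZero n}} (rank : minRank X ≤ n)
  (w : ℤ → ℤ) (w∈ : w ∈ Quotient.W̃/W X n) (i : Fin (suc n)) where
  open Quotient X n renaming (N to Nℕ)
  open Index n
  open Generators X n
  open Lengths X n rank
  open Words X n rank
  open Abacus X n rank
  open Shape X n rank
  open Diagrams X n rank

  mirrored-w : Mirrored w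
  mirrored-w = proj₁ (proj₁ w∈)

  g : ℤ → ℤ
  g = proj₁ (inverse mirrored-w)

  I : Inverse w g
  I = proj₂ (inverse mirrored-w)

  I′ : Inverse (s i ∘ w) (g ∘ s i)
  I′ = ∘-inverse (s-equivariant i) (s-involutive i) I

  open Inverse I using () renaming (equivariant to E; equivariant⁻ to F)

  open Bands X n rank I using (b; h; μ; module Bits; μ-shaped)
  open Changes X n rank I I′ using (μ′; h′; Added; Removed)

  F′ : Equivariant (g ∘ s i)
  F′ = Inverse.equivariant⁻ I′

  even₀ : Special 1 0 → 2 ∣ h (+ 0)
  even₀ (bottom v) = even⇒ I 0 z≤n (proj₁ (proj₂ (proj₁ w∈)) v)
  even₀ (top _ () _)

  member? : ∀ {w g} (I : Inverse w g) x → Dec (x ∈ 𝒞 w)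
  member? I x = map′ (from (𝒞⇔ I x)) (to (𝒞⇔ I x)) (row x ≤? h₀ I (ct x))

  open Transformation X n (toℕ i) μ μ′ (member? I) (member? I′) (𝒞-partition I) (𝒞-partition I′)

  ⊆-by-height : (∀ d → h d ≤ h′ d) → μ ⊆ μ′
  ⊆-by-height l {x} p = from (𝒞⇔ I′ x) (ℕ.≤-trans (to (𝒞⇔ I x) p) (l (ct x)))

  ⊇-by-height : (∀ d → h′ d ≤ h d) → μ′ ⊆ μ
  ⊇-by-height l {x} p = from (𝒞⇔ I x) (ℕ.≤-trans (to (𝒞⇔ I′ x) p) (l (ct x)))

  bead-mono : ∀ d d′ → g (ε d) ℤ.≤ g (ε d′) → b d′ ≡ true → b d ≡ true
  bead-mono d d′ l t = dec-true (g (ε d) ℤ.≤? N ℤ.+ + 0) (ℤ.≤-trans l (does-true (g (ε d′) ℤ.≤? N ℤ.+ + 0) t))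

  s∘s : w ≗ s i ∘ (s i ∘ w)
  s∘s z = sym (s-involutive i (w z))

  module Adjacent (e : s i ≗ sC (toℕ i)) (ns : ∀ A → ¬ Special A (toℕ i)) where
    private module S = Swap 0 F (toℕ i)

    on : ∀ d → fr d ≡ toℕ i → h′ d ≡ bit (b (ℤ.- + 1 ℤ.+ d)) + h (+ 1 ℤ.+ d)
    on d f = trans (height-cong 0 F′ S.E′ (λ z → cong g (e z)) d) (S.height-on d f)

    off : ∀ d → fr d ≢ toℕ i → h′ d ≡ h d
    off d f = trans (height-cong 0 F′ S.E′ (λ z → cong g (e z)) d) (S.height-off d f)

    open Changes.AdjacentCase X n rank I I′ (toℕ i) ns on off even₀

    h-on : ∀ d → h d ≡ bit (b d) + h (+ 1 ℤ.+ d)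
    h-on = height-step 0 F

    pointwise : (_⊑_ : ℕ → ℕ → Set) → (∀ {m} → m ⊑ m) → (∀ d → fr d ≡ toℕ i → h d ⊑ h′ d) → ∀ d → h d ⊑ h′ d
    pointwise _⊑_ rfl on-content d = go (fr d ≟ toℕ i)
      where
      go : Dec (fr d ≡ toℕ i) → h d ⊑ h′ d
      go (yes f) = on-content d f
      go (no f) = subst (h d ⊑_) (sym (off d f)) rfl

    -- By the exchange condition a bead at d forces one at d - 1. The exchange replaces the bit of d
    -- by that of d - 1 in the count from d on, so no height drops.
    ascent-≤ : w <ℓ (s i ∘ w) → ∀ d → h d ≤ h′ d
    ascent-≤ asc = pointwise _≤_ ℕ.≤-refl λ d f → subst₂ _≤_ (sym (h-on d)) (sym (on d f))
        (ℕ.+-monoˡ-≤ (h (+ 1 ℤ.+ d)) (bit-mono (bead-mono (ℤ.- + 1 ℤ.+ d) d (order d f))))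
      where
      order : ∀ d → fr d ≡ toℕ i → g (ε (ℤ.- + 1 ℤ.+ d)) ℤ.≤ g (ε d)
      order d f = adjacent-order i {w} {s i ∘ w} {g (ε (ℤ.- + 1 ℤ.+ d))} {g (ε d)} asc (λ _ → refl) e ns d f (Inverse.w∘g I (ε (ℤ.- + 1 ℤ.+ d))) (Inverse.w∘g I (ε d))

    -- Here s_i w is the shorter element. The order is obtained for its inverse `g ∘ s i` and
    -- reverses when carried back to `g`, as `s i` exchanges the two labels.
    descent-≤ : (s i ∘ w) <ℓ w → ∀ d → h′ d ≤ h d
    descent-≤ desc = pointwise (λ x y → y ≤ x) ℕ.≤-refl λ d f → subst₂ _≤_ (sym (on d f)) (sym (h-on d))
        (ℕ.+-monoˡ-≤ (h (+ 1 ℤ.+ d)) (bit-mono (bead-mono d (ℤ.- + 1 ℤ.+ d) (order d f))))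
      where
      swap-s : ∀ {x y} → sC (toℕ i) (ε x) ≡ ε y → g (s i (ε x)) ≡ g (ε y)
      swap-s {x} p = cong g (trans (e (ε x)) p)
      order : ∀ d → fr d ≡ toℕ i → g (ε d) ℤ.≤ g (ε (ℤ.- + 1 ℤ.+ d))
      order d f = subst₂ ℤ._≤_ (swap-s (trans (sC-up (toℕ i) (ℤ.- + 1 ℤ.+ d) (trans (cong fr (suc-pred d)) f)) (cong ε (suc-pred d)))) (swap-s (sC-down (toℕ i) d f))
        (adjacent-order i {s i ∘ w} {w} {g (s i (ε (ℤ.- + 1 ℤ.+ d)))} {g (s i (ε d))} desc s∘s e ns d f (Inverse.w∘g I′ (ε (ℤ.- + 1 ℤ.+ d))) (Inverse.w∘g I′ (ε d)))

    adjacent-adds : w <ℓ (s i ∘ w) → μ′ ≐ addAll (toℕ i) μ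
    adjacent-adds asc = adds (⊆-by-height (ascent-≤ asc)) (λ {x} p q → changed-residue {x} (inj₁ (p , q)))
      (λ {x} {y} p q se r → contradiction r (neighbour-∉ {x} {y} (changed-fr {x} (inj₁ (p , q))) se)) addLike

    adjacent-removes : (s i ∘ w) <ℓ w → μ′ ≐ removeAll (toℕ i) μ
    adjacent-removes desc = removes (⊇-by-height (descent-≤ desc)) (λ {x} p q → changed-residue {x} (inj₂ (p , q)))
      (λ {x} {y} p q se r → contradiction r (neighbour-∉ {x} {y} (changed-fr {x} (inj₂ (p , q))) se)) removeLike

  module Doubled {A} (sp : Special A (toℕ i)) (e : s i ≗ sD A (toℕ i)) where
    private module S = Swap₂ 0 F sp
    open Double sp

    cong-h : ∀ d → h′ d ≡ height 0 S.E′ d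
    cong-h = height-cong 0 F′ S.E′ (λ z → cong g (e z))

    on : ∀ D → fr D ≡ toℕ i → ∀ q → q < 3 → h′ (at q D) ≡ new (Bits.b₀ D) (Bits.b₁ D) (Bits.b₃ D) q + Bits.M D
    on D f 0 _ = trans (trans (cong h′ (at-0 D)) (cong-h (ℤ.- + 1 ℤ.+ D))) (trans (S.height-D-1 D f) (k (bit (Bits.b₀ D)) (bit (Bits.b₁ D)) (bit (Bits.b₃ D)) (Bits.M D)))
      where
      k : ∀ x y z m → x + (y + (z + m)) ≡ x + (y + z) + m
      k x y z m = trans (cong (λ v → x + v) (sym (ℕ.+-assoc y z m))) (sym (ℕ.+-assoc x (y + z) m))
    on D f 1 _ = trans (trans (cong h′ (at-1 D)) (cong-h D)) (trans (S.height-D D f) (sym (ℕ.+-assoc (bit (Bits.b₀ D)) (bit (Bits.b₁ D)) (Bits.M D))))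
    on D f 2 _ = trans (trans (cong h′ (at-2 D)) (cong-h (+ 1 ℤ.+ D))) (S.height-D+1 D f)
    on D f (suc (suc (suc _))) (s≤s (s≤s (s≤s ())))

    off : ∀ d → fr d ≢ A → fr d ≢ toℕ i → h′ d ≡ h d
    off d p q = trans (cong-h d) (S.height-off d p q)

    even : toℕ i ≡ 0 → 2 ∣ h (+ 0)
    even z = even₀ (lemma sp z)
      where
      lemma : ∀ {A B} → Special A B → B ≡ 0 → Special 1 0
      lemma (bottom v) _ = bottom v
      lemma (top _ _ _) n≡0 = contradiction (sym n≡0) (ℕ.<⇒≢ 0<n)

    open DoubleChanges X n rank I I′ sp using (located)
    open DoubleChanges.DoubleCase X n rank I I′ sp on off even

    pointwise : (_⊑_ : ℕ → ℕ → Set) → (∀ {m} → m ⊑ m) →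
      (∀ D → fr D ≡ toℕ i → ∀ q → q < 3 → h (at q D) ⊑ h′ (at q D)) → ∀ d → h d ⊑ h′ d
    pointwise _⊑_ rfl zone d = go (fr d ≟ A) (fr d ≟ toℕ i)
      where
      in-zone : fr d ≡ A ⊎ fr d ≡ toℕ i → h d ⊑ h′ d
      in-zone p = let D , q , f , q< , d≡ = located d p in subst (λ x → h x ⊑ h′ x) (sym d≡) (zone D f q q<)
      go : Dec (fr d ≡ A) → Dec (fr d ≡ toℕ i) → h d ⊑ h′ d
      go (yes p) _ = in-zone (inj₁ p)
      go (no _) (yes q) = in-zone (inj₂ q)
      go (no p) (no q) = subst (h d ⊑_) (sym (off d p q)) rfl

    ascent-≤ : w <ℓ (s i ∘ w) → ∀ d → h d ≤ h′ d
    ascent-≤ asc = pointwise _≤_ ℕ.≤-refl zone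
      where
      order₀ : ∀ D → fr D ≡ toℕ i → g (ε (ℤ.- + 2 ℤ.+ D)) ℤ.≤ g (ε D)
      order₀ D f = proj₁ (double-order i {w} {s i ∘ w} {g (ε (ℤ.- + 2 ℤ.+ D))} {g (ε D)} asc (λ _ → refl) sp e D f) (Inverse.w∘g I (ε (ℤ.- + 2 ℤ.+ D))) (Inverse.w∘g I (ε D))
      order₁ : ∀ D → fr D ≡ toℕ i → g (ε (ℤ.- + 1 ℤ.+ D)) ℤ.≤ g (ε (+ 1 ℤ.+ D))
      order₁ D f = proj₂ (double-order i {w} {s i ∘ w} {g (ε (ℤ.- + 1 ℤ.+ D))} {g (ε (+ 1 ℤ.+ D))} asc (λ _ → refl) sp e D f) (Inverse.w∘g I (ε (ℤ.- + 1 ℤ.+ D))) (Inverse.w∘g I (ε (+ 1 ℤ.+ D)))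
      zone : ∀ D → fr D ≡ toℕ i → ∀ q → q < 3 → h (at q D) ≤ h′ (at q D)
      zone D f q q< = subst₂ _≤_ (sym (h-old q (ℕ.m≤n⇒m≤1+n q<))) (sym (on D f q q<)) (ℕ.+-monoˡ-≤ M
          (old≤new {b₀} {b₁} {b₂} {b₃} (bead-mono (ℤ.- + 2 ℤ.+ D) D (order₀ D f)) (bead-mono (ℤ.- + 1 ℤ.+ D) (+ 1 ℤ.+ D) (order₁ D f)) q q<))
        where open Bits D

    descent-≤ : (s i ∘ w) <ℓ w → ∀ d → h′ d ≤ h d
    descent-≤ desc = pointwise (λ x y → y ≤ x) ℕ.≤-refl zone
      where
      swap-s : ∀ {x y} → sD A (toℕ i) (ε x) ≡ ε y → g (s i (ε x)) ≡ g (ε y)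
      swap-s {x} p = cong g (trans (e (ε x)) p)
      order₀ : ∀ D → fr D ≡ toℕ i → g (ε D) ℤ.≤ g (ε (ℤ.- + 2 ℤ.+ D))
      order₀ D f = subst₂ ℤ._≤_ (swap-s (sD₀ D f)) (swap-s (sD₂ D f))
        (proj₁ (double-order i {s i ∘ w} {w} {g (s i (ε (ℤ.- + 2 ℤ.+ D)))} {g (s i (ε D))} desc s∘s sp e D f) (Inverse.w∘g I′ (ε (ℤ.- + 2 ℤ.+ D))) (Inverse.w∘g I′ (ε D)))
      order₁ : ∀ D → fr D ≡ toℕ i → g (ε (+ 1 ℤ.+ D)) ℤ.≤ g (ε (ℤ.- + 1 ℤ.+ D))
      order₁ D f = subst₂ ℤ._≤_ (swap-s (sD₁ D f)) (swap-s (sD₃ D f))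
        (proj₂ (double-order i {s i ∘ w} {w} {g (s i (ε (ℤ.- + 1 ℤ.+ D)))} {g (s i (ε (+ 1 ℤ.+ D)))} desc s∘s sp e D f) (Inverse.w∘g I′ (ε (ℤ.- + 1 ℤ.+ D))) (Inverse.w∘g I′ (ε (+ 1 ℤ.+ D))))
      zone : ∀ D → fr D ≡ toℕ i → ∀ q → q < 3 → h′ (at q D) ≤ h (at q D)
      zone D f q q< = subst₂ _≤_ (sym (on D f q q<)) (sym (h-old q (ℕ.m≤n⇒m≤1+n q<))) (ℕ.+-monoˡ-≤ M
          (new≤old {b₀} {b₁} {b₂} {b₃} (bead-mono D (ℤ.- + 2 ℤ.+ D) (order₀ D f)) (bead-mono (+ 1 ℤ.+ D) (ℤ.- + 1 ℤ.+ D) (order₁ D f)) q q<))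
        where open Bits D

    double-adds : w <ℓ (s i ∘ w) → μ′ ≐ addAll (toℕ i) μ
    double-adds asc = adds (⊆-by-height (ascent-≤ asc)) (λ {x} p q → added-residue {x} (p , q))
      (λ {x} {y} p q se r → added-closed {x} {y} (p , q) se r) (λ like {x} → addLike like {x})

    double-removes : (s i ∘ w) <ℓ w → μ′ ≐ removeAll (toℕ i) μ
    double-removes desc = removes (⊇-by-height (descent-≤ desc)) (λ {x} p q → removed-residue {x} (p , q))
      (λ {x} {y} p q se r → removed-closed {x} {y} (p , q) se r) (λ like {x} → removeLike like {x})

  ascent-adds : w <ℓ (s i ∘ w) → μ′ ≐ addAll (toℕ i) μ
  ascent-adds asc with kind 2≤n i
  ... | adjacent e ns   = Adjacent.adjacent-adds e ns asc
  ... | double A sp e = Doubled.double-adds sp e asc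

  descent-removes : (s i ∘ w) <ℓ w → μ′ ≐ removeAll (toℕ i) μ
  descent-removes desc with kind 2≤n i
  ... | adjacent e ns   = Adjacent.adjacent-removes e ns desc
  ... | double A sp e = Doubled.double-removes sp e desc

  s∘w-coset : (s i ∘ w) ∈ ((s i ∘ w) ·W)
  s∘w-coset = id , ([] , λ _ → refl) , λ _ → refl

theorem5p8 : (X : QuotientType) (n : ℕ) .{{_ : NonZero n}} → minRank X ≤ n →
    let open Quotient X n in
    (w : ℤ → ℤ) → w ∈ W̃/W → (i : Fin (suc n)) →
    (Ascent i w → ActsWithResult i w (addAll (toℕ i) (𝒞 w)))
    × (Descent i w → ActsWithResult i w (removeAll (toℕ i) (𝒞 w)))
    × (Neither i w → ActsWithResult i w (𝒞 w))
theorem5p8 X n rank w w∈ i =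
    (λ (asc , sw∈) → s i ∘ w , sw∈ , s∘w-coset , ascent-adds asc)
  -- `Descent` only compares lengths, so the parity conditions and the minimality of s_i w are
  -- supplied here.
  , (λ desc → s i ∘ w , (W̃-closed i (proj₁ w∈) , descent-minimal i (Inverse.equivariant I) w∈ desc) , s∘w-coset , descent-removes desc)
  -- The cosets coincide, so w itself represents s_i w W.
  , (λ same → w , w∈ , proj₂ same (id , ([] , λ _ → refl) , λ _ → refl) , (λ p → p) , λ p → p)
  where
  open Quotient X n
  open Words X n rank
  open Diagrams X n rank
  open Shape X n rank using (module Inverse)
  open Action X n rank w w∈ i
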